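{- Let $p$ be an odd prime, $q$ a power of $p$, $E/\mathbb F_p$ a finite extension, $\psi$ a nontrivial additive character of $\mathbb F_p$, and $\tilde f(x)=\sum_{i=0}^na_ix^{(q^i+1)/2}$ with $a_i\in E$. Let $\mathbb K$ be the unique quadratic subfield of $\mathbb Q(\zeta_p)$ and $\mathrm{Gauss}_{\mathbb F_p}$ a quadratic Gauss sum over $\mathbb F_p$. Then the sums $$S_{\tilde f,+}=\frac{ -1}{(\mathrm{Gauss}_{\mathbb F_p})^{\deg(E/\mathbb F_p)}}\sum_{x\in E}\psi_E(\tilde f(x)),\qquad S_{\tilde f,- }=\frac{ -1}{(\mathrm{Gauss}_{\mathbb F_p})^{\deg(E/\mathbb F_p)}}\sum_{x\in E}\psi_E(\tilde f(x))\chi_2(x)$$ both lie in $\mathbb K$. If moreover $q$ is a square and $E\supseteq\mathbb F_q$, both lie in $\mathbb Q$.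
   Context: $\psi_E=\psi\circ\mathrm{Tr}_{E/\mathbb F_p}$, $\chi_2$ is the quadratic character of $E^\times$ (extended by $\chi_2(0)=0$), and $\mathrm{Gauss}_{\mathbb F_p}=\sum_{x\in\mathbb F_p^\times}\psi(x)\chi_2(x)$. -}

module Defs where

open import Algebra.Apartness using (HeytingField)
open import Algebra.Bundles using (CommutativeRing; Semiring; Monoid)
open import Algebra.Morphism.Structures using (IsMonoidHomomorphism; IsRingHomomorphism)
import Algebra.Definitions.RawSemiring as RawSemiringDefs
import Algebra.Properties.Semiring.Sum as SemiringSum
open import Data.Fin.Base using (Fin; zero; suc; toℕ; combine; finToFun; funToFin)
open import Data.Fin.Properties using (any?; finToFun-funToFin; funToFin-finToFin)
import Data.Fin.Properties as Fin
open import Data.Nat.Base as ℕ using (ℕ)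
open import Data.Nat.DivMod using (_/_)
open import Data.Product.Base using (∃; _×_; _,_; proj₁; proj₂)
open import Data.Unit.Base using (tt)
open import Data.Vec.Functional using (Vector)
open import Function.Base using (_∘_)
open import Function.Bundles using (Inverse)
open import Level using (Level; _⊔_) renaming (suc to lsuc)
open import Relation.Binary.PropositionalEquality as ≡ using (_≡_; _≗_)
open import Relation.Nullary.Decidable using (Dec; yes; no; map′)
open import Relation.Unary using (Pred; U)

-- Over a classical metatheory `HeytingField` is exactly the notion of a field;
-- `x # 0#` means that `x` is invertible.
module FieldOps {c ℓ₁ ℓ₂ : Level} (F : HeytingField c ℓ₁ ℓ₂) where
  commutativeRing : CommutativeRing c ℓ₁
  commutativeRing = record { isCommutativeRing = HeytingField.isCommutativeRing F }

  open HeytingField F public using (_#_; #⇒invertible)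
  open CommutativeRing commutativeRing public
  open RawSemiringDefs (Semiring.rawSemiring semiring) public using (_^_; sum)

  -- `#⇒invertible` gives an inverse of `y - 0#`, which equals `y`.
  divide : (x y : Carrier) → y # 0# → Carrier
  divide x y y#0 = x * proj₁ (#⇒invertible y#0)

record Extension {c ℓ₁ ℓ₂ c′ ℓ₁′ ℓ₂′ : Level}
                 (k : HeytingField c ℓ₁ ℓ₂) (L : HeytingField c′ ℓ₁′ ℓ₂′) :
                 Set (c ⊔ ℓ₁ ⊔ c′ ⊔ ℓ₁′) where
  private
    module k = FieldOps k
    module L = FieldOps L
  field
    embed              : k.Carrier → L.Carrier
    isRingHomomorphism : IsRingHomomorphism k.rawRing L.rawRing embed

  open IsRingHomomorphism isRingHomomorphism public

  -- membership in `k`, viewed as a subfield of `L`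
  InBase : Pred L.Carrier (c ⊔ ℓ₁′)
  InBase x = ∃ λ r → embed r L.≈ x

  combination : ∀ {d} → Vector k.Carrier d → Vector L.Carrier d → L.Carrier
  combination r b = L.sum λ i → embed (r i) L.* b i

-- A basis with d elements, over k, of the k-subspace V of L; thus `Basis ext U d`
-- says that L/k is finite of degree d.
record Basis {c ℓ₁ ℓ₂ c′ ℓ₁′ ℓ₂′ ℓ : Level}
             {k : HeytingField c ℓ₁ ℓ₂} {L : HeytingField c′ ℓ₁′ ℓ₂′}
             (ext : Extension k L) (V : Pred (HeytingField.Carrier L) ℓ) (d : ℕ) :
             Set (c ⊔ ℓ₁ ⊔ c′ ⊔ ℓ₁′ ⊔ ℓ) where
  private
    module k = FieldOps k
    module L = FieldOps L
  open Extension ext using (combination)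
  field
    vector  : Vector L.Carrier d
    member  : ∀ i → V (vector i)
    coord   : ∀ {x} → V x → Vector k.Carrier d
    spans   : ∀ {x} (x∈V : V x) → combination (coord x∈V) vector L.≈ x
    unique  : ∀ r s → combination r vector L.≈ combination s vector → ∀ i → r i k.≈ s i

record Subfield {c ℓ₁ ℓ₂ : Level} (F : HeytingField c ℓ₁ ℓ₂) (m : Level) :
                Set (c ⊔ ℓ₁ ⊔ lsuc m) where
  open FieldOps F
  field
    Member : Pred Carrier m
    resp   : ∀ {x y} → x ≈ y → Member x → Member y
    0∈     : Member 0#
    1∈     : Member 1#
    +∈     : ∀ {x y} → Member x → Member y → Member (x + y)
    -∈     : ∀ {x} → Member x → Member (- x)
    *∈     : ∀ {x y} → Member x → Member y → Member (x * y)
    ⁻¹∈    : ∀ {x y} → x * y ≈ 1# → Member x → Member y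

-- `Adjoin ext a` is k(a), the smallest subfield of L containing k and a.
data Adjoin {c ℓ₁ ℓ₂ c′ ℓ₁′ ℓ₂′ : Level}
            {k : HeytingField c ℓ₁ ℓ₂} {L : HeytingField c′ ℓ₁′ ℓ₂′}
            (ext : Extension k L) (a : HeytingField.Carrier L) :
            Pred (HeytingField.Carrier L) (c ⊔ c′ ⊔ ℓ₁′) where
  base : ∀ r → Adjoin ext a (Extension.embed ext r)
  gen  : Adjoin ext a a
  resp : ∀ {x y} → HeytingField._≈_ L x y → Adjoin ext a x → Adjoin ext a y
  +∈   : ∀ {x y} → Adjoin ext a x → Adjoin ext a y → Adjoin ext a (HeytingField._+_ L x y)
  -∈   : ∀ {x} → Adjoin ext a x → Adjoin ext a (HeytingField.-_ L x)
  *∈   : ∀ {x y} → Adjoin ext a x → Adjoin ext a y → Adjoin ext a (HeytingField._*_ L x y)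
  ⁻¹∈  : ∀ {x y} → HeytingField._≈_ L (HeytingField._*_ L x y) (HeytingField.1# L) →
         Adjoin ext a x → Adjoin ext a y

IsPrimitiveRoot : ∀ {c ℓ₁ ℓ₂} (L : HeytingField c ℓ₁ ℓ₂) → ℕ → HeytingField.Carrier L → Set (ℓ₁ ⊔ ℓ₂)
IsPrimitiveRoot L n ζ = ζ ^ n ≈ 1# × (∀ m → 0 ℕ.< m → m ℕ.< n → ζ ^ m # 1#)
  where open FieldOps L

HasSize : ∀ {c ℓ₁ ℓ₂} → ℕ → HeytingField c ℓ₁ ℓ₂ → Set (c ⊔ ℓ₁)
HasSize n F = Inverse (≡.setoid (Fin n)) (FieldOps.setoid F)

funToFin-cong : ∀ {m n} {f g : Fin m → Fin n} → f ≗ g → funToFin f ≡ funToFin g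
funToFin-cong {ℕ.zero}  f≗g = ≡.refl
funToFin-cong {ℕ.suc m} f≗g = ≡.cong₂ combine (f≗g zero) (funToFin-cong (f≗g ∘ suc))

extensionSize : ∀ {c ℓ₁ ℓ₂ c′ ℓ₁′ ℓ₂′ n d} {k : HeytingField c ℓ₁ ℓ₂} {L : HeytingField c′ ℓ₁′ ℓ₂′}
                {ext : Extension k L} → HasSize n k → Basis ext U d → HasSize (n ℕ.^ d) L
extensionSize {n = n} {d} {k} {L} {ext} |k| basis = record
  { to        = to
  ; from      = from
  ; to-cong   = λ { ≡.refl → L.refl }
  ; from-cong = from-cong
  ; inverse   = (λ { ≡.refl → to∘from _ })
              , (λ {j} x≈to → ≡.trans (from-cong x≈to) (from∘to j))
  }
  where
  module k = FieldOps k
  module L = FieldOps L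
  module |k| = Inverse |k|
  open Extension ext using (combination; ⟦⟧-cong)
  open Basis basis

  combination-cong : ∀ {r s} → (∀ i → r i k.≈ s i) → combination r vector L.≈ combination s vector
  combination-cong r≈s = SemiringSum.sum-cong-≋ L.semiring (λ i → L.*-congʳ (⟦⟧-cong (r≈s i)))

  to : Fin (n ℕ.^ d) → L.Carrier
  to j = combination (|k|.to ∘ finToFun j) vector

  from : L.Carrier → Fin (n ℕ.^ d)
  from x = funToFin (|k|.from ∘ coord {x} tt)

  from-cong : ∀ {x y} → x L.≈ y → from x ≡ from y
  from-cong x≈y = funToFin-cong λ i → |k|.from-cong
    (unique _ _ (L.trans (spans tt) (L.trans x≈y (L.sym (spans tt)))) i)

  to∘from : ∀ x → to (from x) L.≈ x
  to∘from x = L.trans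
    (combination-cong λ i → k.trans
      (|k|.to-cong (finToFun-funToFin (|k|.from ∘ coord {x} tt) i))
      (|k|.strictlyInverseˡ (coord {x} tt i)))
    (spans tt)

  from∘to : ∀ j → from (to j) ≡ j
  from∘to j = ≡.trans
    (funToFin-cong λ i → ≡.trans
      (|k|.from-cong (unique _ _ (spans tt) i))
      (|k|.strictlyInverseʳ (finToFun j i)))
    (funToFin-finToFin {d} {n} j)

module FiniteField {c ℓ₁ ℓ₂ : Level} (F : HeytingField c ℓ₁ ℓ₂) {n : ℕ} (|F| : HasSize n F)
                   {c′ ℓ₁′ ℓ₂′ : Level} (L : HeytingField c′ ℓ₁′ ℓ₂′) where
  private
    module L = FieldOps L
  open FieldOps F
  open Inverse |F|

  sumOver : (Carrier → L.Carrier) → L.Carrier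
  sumOver g = L.sum (g ∘ to)

  infix 4 _≟_
  _≟_ : ∀ x y → Dec (x ≈ y)
  x ≟ y = map′ (λ eq → trans (sym (strictlyInverseˡ x)) (trans (to-cong eq) (strictlyInverseˡ y)))
               from-cong (from x Fin.≟ from y)

  IsSquare : Pred Carrier (c ⊔ ℓ₁)
  IsSquare x = ∃ λ y → y * y ≈ x

  isSquare? : ∀ x → Dec (IsSquare x)
  isSquare? x = map′ (λ (j , eq) → to j , eq)
    (λ (y , eq) → from y , trans (*-cong (strictlyInverseˡ y) (strictlyInverseˡ y)) eq)
    (any? λ j → to j * to j ≟ x)

  quadraticCharacter : Carrier → L.Carrier
  quadraticCharacter x with x ≟ 0# | isSquare? x
  ... | yes _ | _     = L.0#
  ... | no  _ | yes _ = L.1#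
  ... | no  _ | no  _ = L.- L.1#

record AdditiveCharacter {c ℓ₁ ℓ₂ c′ ℓ₁′ ℓ₂′ : Level}
                         (k : HeytingField c ℓ₁ ℓ₂) (L : HeytingField c′ ℓ₁′ ℓ₂′) :
                         Set (c ⊔ ℓ₁ ⊔ ℓ₂ ⊔ c′ ⊔ ℓ₁′ ⊔ ℓ₂′) where
  private
    module k = FieldOps k
    module L = FieldOps L
  field
    char           : k.Carrier → L.Carrier
    isHomomorphism : IsMonoidHomomorphism (Monoid.rawMonoid k.+-monoid) (Monoid.rawMonoid L.*-monoid) char

  Nontrivial : Set (c ⊔ ℓ₂′)
  Nontrivial = ∃ λ x → char x L.# L.1#

-- The trace of the k-linear endomorphism y ↦ x * y of L, computed in the given basis.
trace : ∀ {c ℓ₁ ℓ₂ c′ ℓ₁′ ℓ₂′ d} {k : HeytingField c ℓ₁ ℓ₂} {L : HeytingField c′ ℓ₁′ ℓ₂′}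
        {ext : Extension k L} → Basis ext U d → HeytingField.Carrier L → HeytingField.Carrier k
trace {k = k} {L} basis x = FieldOps.sum k λ i → coord {x * vector i} tt i
  where
  open FieldOps L using (_*_)
  open Basis basis

halfPowerPolynomial : ∀ {c ℓ₁ ℓ₂} (E : HeytingField c ℓ₁ ℓ₂) (q : ℕ) {n : ℕ} →
                      Vector (HeytingField.Carrier E) (ℕ.suc n) →
                      HeytingField.Carrier E → HeytingField.Carrier E
halfPowerPolynomial E q a x = sum λ i → a i * x ^ ((q ℕ.^ toℕ i ℕ.+ 1) / 2)
  where open FieldOps E

module GaussSums
  {c₁ ℓ₁ ℓ₁′ c₂ ℓ₂ ℓ₂′ c₃ ℓ₃ ℓ₃′ : Level}
  {𝔽p : HeytingField c₁ ℓ₁ ℓ₁′} {E : HeytingField c₂ ℓ₂ ℓ₂′} (L : HeytingField c₃ ℓ₃ ℓ₃′)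
  {p : ℕ} (|𝔽p| : HasSize p 𝔽p) {𝔽p⊆E : Extension 𝔽p E} {d : ℕ} (basis : Basis 𝔽p⊆E U d)
  (ψ : AdditiveCharacter 𝔽p L) where

  private
    module 𝔽p = FiniteField 𝔽p |𝔽p| L
    module E  = FiniteField E (extensionSize |𝔽p| basis) L
  open FieldOps L
  open AdditiveCharacter ψ using (char)

  -- The term at x = 0 vanishes, so this is the sum over the nonzero elements.
  gauss : Carrier
  gauss = 𝔽p.sumOver λ x → char x * 𝔽p.quadraticCharacter x

  charE : HeytingField.Carrier E → Carrier
  charE x = char (trace basis x)

  module _ (gauss^d#0 : gauss ^ d # 0#) (f : HeytingField.Carrier E → HeytingField.Carrier E) where

    S₊ : Carrier
    S₊ = divide (- 1#) (gauss ^ d) gauss^d#0 * E.sumOver λ x → charE (f x)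

    S₋ : Carrier
    S₋ = divide (- 1#) (gauss ^ d) gauss^d#0 *
         E.sumOver λ x → charE (f x) * E.quadraticCharacter x

{-# OPTIONS --safe #-}
-- Write t for a nonzero element of 𝔽p with t = v² and v^q = v for some v in E.  Then f̃(t x) = t f̃(x), and t is a
-- square in E, so the substitution x ↦ t x shows that the two sums do not change when ψ is replaced by ψ(t ·).
-- Averaging over such t replaces each value ψ_E(f̃(x)) by an average of ψ(t c).
--
-- Every t = s² with s in 𝔽p qualifies; the averages of ψ(s² c) are rational combinations of 1 and the Gauss sum,
-- so it remains to see that the Gauss sum lies in every quadratic subfield K of ℚ(ζ).  The values of ψ span ℚ(ζ)
-- and satisfy no ℤ-linear relation except that their sum is 0, so they have Galois conjugates.  An element of K
-- outside ℚ with rational square is fixed by the squares and negated by some conjugation; averaging its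
-- conjugates over the squares, and over their multiples by a negating t₀, exhibits it as a rational multiple of the
-- Gauss sum.
--
-- If q is a square and 𝔽q ⊆ E, then Euler's criterion in 𝔽q shows that every t in 𝔽p^× qualifies, and the averages
-- of ψ(t c) over all t are rational.  Moreover deg(E/𝔽p) is even, since otherwise Euler's criterion in 𝔽p would make
-- every element of 𝔽p a square; so the power of the Gauss sum in the denominator is rational as well.
module Submission where

open import Algebra.Apartness using (HeytingField)
open import Algebra.Bundles using (CommutativeMonoid; CommutativeRing; RawRing)
import Algebra.Apartness.Properties.HeytingCommutativeRing as HeytingProperties
import Algebra.Morphism.Construct.Composition as Composition
import Algebra.Morphism.RingMonomorphism as RingMonomorphism
open import Algebra.Morphism.Structures using (IsMonoidHomomorphism; IsRingHomomorphism; IsRingMonomorphism)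
import Algebra.Properties.AbelianGroup as AbelianGroupProperties
import Algebra.Properties.CommutativeMonoid.Sum as MonoidSum
import Algebra.Properties.CommutativeSemiring.Binomial as Binomial
import Algebra.Properties.CommutativeSemiring.Exp as CommutativeSemiringExp
import Algebra.Properties.Monoid.Mult as MonoidMult
import Algebra.Properties.Ring as RingProperties
import Algebra.Properties.Semiring.Exp as SemiringExp
import Algebra.Properties.Semiring.Mult as SemiringMult
import Algebra.Properties.Semiring.Mult.TCOptimised as SemiringMultTC
import Algebra.Properties.Semiring.Sum as SemiringSum
import Algebra.Solver.Ring as RingSolver
import Algebra.Solver.Ring.AlmostCommutativeRing as ACR
open import Algebra.Structures using (IsCommutativeRing)
open import Data.Bool.Base using (if_then_else_)
open import Data.Fin.Base as Fin using (Fin; zero; toℕ; fromℕ<; punchIn)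
import Data.Fin.Permutation as Perm
import Data.Fin.Properties as Fin
open import Data.Integer.Base as ℤ using (ℤ; +_; -[1+_])
import Data.Integer.Properties as ℤ
open import Data.Maybe.Base using (Maybe; just; nothing)
open import Data.Nat.Base using (ℕ; suc; _≤_) renaming (_*_ to _*ℕ_; _^_ to _^ℕ_)
import Data.Nat.Base as ℕ
open import Data.Nat.Combinatorics using (_C_; nCn≡1; nC1≡n; nCk+nC[k+1]≡[n+1]C[k+1])
import Data.Nat.Coprimality as Coprimality
import Data.Nat.DivMod as ℕ
open import Data.Nat.Divisibility using (_∣_; divides)
import Data.Nat.Divisibility as ℕ
import Data.Nat.GCD as GCD
open import Data.Nat.Primality using (Prime)
import Data.Nat.Primality as Prime
import Data.Nat.Properties as ℕ
import Data.Nat.Solver as ℕSolver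
open import Data.Product.Base using (Σ; ∃; _×_; _,_; proj₁; proj₂)
open import Data.Rational.Base as ℚ using (ℚ; mkℚ; toℚᵘ)
open import Data.Rational.Properties using () renaming (heytingField to ℚ-field)
import Data.Rational.Properties as ℚ
open import Data.Rational.Unnormalised.Base as ℚᵘ using (mkℚᵘ; *≡*)
import Data.Rational.Unnormalised.Properties as ℚᵘ
import Data.Sign.Base as Sign
open import Data.Sum.Base using (_⊎_; inj₁; inj₂; [_,_]′)
open import Data.Unit.Base using (tt)
open import Data.Vec.Base as Vec using (Vec; []; _∷_)
open import Data.Vec.Functional using (Vector)
open import Defs hiding (base; gen; resp; +∈; -∈; *∈; ⁻¹∈)
open import Function.Base using (_∘_; id; case_of_)
open import Function.Bundles using (Inverse)
open import Level using (_⊔_; 0ℓ)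
open import Relation.Binary.Definitions using (tri<; tri≈; tri>)
open import Relation.Binary.PropositionalEquality as ≡ using (_≡_; _≢_)
import Relation.Binary.Reasoning.Setoid as SetoidReasoning
open import Relation.Nullary using (¬_; Dec; yes; no; does; contradiction)
open import Relation.Unary using (U; _⊆_)

-- Equality in L is not assumed decidable, and no automorphisms of L are available. Both gaps are
-- closed in the integral group ring of 𝔽p: after clearing denominators, a number is kept as an
-- integer coefficient function f with value Σ f(a) ψ(a), its conjugates are the values of the same
-- f at ψ(t ·), and two values agree exactly when the coefficient functions differ by a constant.
-- This criterion stands in for the irreducibility of the cyclotomic polynomial. Put y = X - 1. If f
-- has value 0, comparing the augmentation of its norm with its value shows that p divides the sum
-- of the coefficients; this makes f divisible by y up to a constant, and the quotient again has
-- value 0. After p - 1 such divisions, one more factor y brings in y^p, which is a multiple of p,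
-- so all coefficients of f are congruent modulo p. Normalising f(0) = 0 and dividing by p then
-- starts a descent.

-- Finite sums, and integers in a commutative ring

module FiniteSum {c ℓ} (M : CommutativeMonoid c ℓ) where
  open CommutativeMonoid M
  open MonoidSum M public
  private module Mult = MonoidMult monoid

  sum-reindex : ∀ {n} (σ τ : Fin n → Fin n) → (∀ i → σ (τ i) ≡ i) → (∀ i → τ (σ i) ≡ i) →
                ∀ f → sum (f ∘ σ) ≈ sum f
  sum-reindex σ τ στ τσ f = sym (sum-permute f (Perm.permutation σ τ στ τσ))

  -- Sums and products over a finite field are always indexed by all of `Fin n`; this splits off an
  -- exceptional index, usually 0, and accounts for the n - 1 remaining ones. In a multiplicative
  -- monoid it produces a power.
  sum-off : ∀ {n} (i : Fin n) (f : Vector Carrier n) {y} → (∀ j → j ≢ i → f j ≈ y) →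
            sum f ≈ f i ∙ (ℕ.pred n Mult.× y)
  sum-off {suc n} i f off = trans (sum-remove f) (∙-congˡ (trans
    (sum-cong-≋ λ j → off (punchIn i j) (Fin.punchInᵢ≢i i j))
    (sum-replicate n)))

  sum-ε : ∀ {n} {f : Vector Carrier n} → (∀ i → f i ≈ ε) → sum f ≈ ε
  sum-ε {n} f≈ε = trans (sum-cong-≋ f≈ε) (sum-replicate-zero n)

  sum-single : ∀ {n} (i : Fin n) (f : Vector Carrier n) → (∀ j → j ≢ i → f j ≈ ε) → sum f ≈ f i
  sum-single {suc n} i f off = trans (sum-remove f) (trans
    (∙-congˡ (sum-ε λ j → off (punchIn i j) (Fin.punchInᵢ≢i i j))) (identityʳ _))

module Ring {c ℓ} (R : CommutativeRing c ℓ) where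
  open CommutativeRing R public hiding (zero)
  open RingProperties ring public using (-0#≈0#; -‿distribˡ-*; -‿distribʳ-*; -‿involutive; x∙y⁻¹≈ε⇒x≈y)
    renaming (x≈y⇒x∙y⁻¹≈ε to x≈y⇒x-y≈0)
  open AbelianGroupProperties +-abelianGroup public using (⁻¹-∙-comm)
  open FiniteSum +-commutativeMonoid public
  open SemiringSum semiring public using (*-distribˡ-sum; *-distribʳ-sum)
  open SemiringExp semiring public
  open CommutativeSemiringExp commutativeSemiring public using (^-distrib-*)
  open SemiringMultTC semiring public using (1+×; ×-homo-+; ×1-homo-*; ×ᵤ≈×) renaming (_×_ to _·_; ×-congʳ to ·-congʳ)
  open SetoidReasoning setoid

  x-y≈0⇒x≈y : ∀ {x y} → x - y ≈ 0# → x ≈ y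
  x-y≈0⇒x≈y = x∙y⁻¹≈ε⇒x≈y _ _

  -- The canonical homomorphism from ℤ. It gives the ring solver integer coefficients in every
  -- commutative ring.
  ι : ℤ → Carrier
  ι (+ n)    = n · 1#
  ι -[1+ n ] = - (suc n · 1#)

  private
    ι-⊖ : ∀ m n → ι (m ℤ.⊖ n) ≈ m · 1# - n · 1#
    ι-⊖ m ℕ.zero = sym (trans (+-congˡ -0#≈0#) (+-identityʳ _))
    ι-⊖ ℕ.zero (suc n) = sym (+-identityˡ _)
    ι-⊖ (suc m) (suc n) rewrite ℤ.[1+m]⊖[1+n]≡m⊖n m n = begin
      ι (m ℤ.⊖ n)  ≈⟨ ι-⊖ m n ⟩
      m · 1# - n · 1#  ≈⟨ +-congʳ (+-identityʳ _) ⟨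
      (m · 1# + 0#) - n · 1#                 ≈⟨ +-congʳ (+-congˡ (-‿inverseʳ 1#)) ⟨
      (m · 1# + (1# - 1#)) - n · 1#          ≈⟨ +-congʳ (+-assoc _ _ _) ⟨
      ((m · 1# + 1#) - 1#) - n · 1#          ≈⟨ +-assoc _ _ _ ⟩
      (m · 1# + 1#) + (- 1# - n · 1#)        ≈⟨ +-cong (+-comm _ _) (⁻¹-∙-comm 1# (n · 1#)) ⟩
      (1# + m · 1#) - (1# + n · 1#)          ≈⟨ +-cong (1+× m 1#) (-‿cong (1+× n 1#)) ⟨
      suc m · 1# - suc n · 1#  ∎

    ι-◃+ : ∀ n → ι (Sign.+ ℤ.◃ n) ≈ n · 1#
    ι-◃+ ℕ.zero = refl
    ι-◃+ (suc n) = refl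

    ι-◃- : ∀ n → ι (Sign.- ℤ.◃ n) ≈ - (n · 1#)
    ι-◃- ℕ.zero = sym -0#≈0#
    ι-◃- (suc n) = refl

  ι-+ : ∀ i j → ι (i ℤ.+ j) ≈ ι i + ι j
  ι-+ (+ m) (+ n) = ×-homo-+ 1# m n
  ι-+ (+ m) -[1+ n ] = ι-⊖ m (suc n)
  ι-+ -[1+ m ] (+ n) = trans (ι-⊖ n (suc m)) (+-comm _ _)
  ι-+ -[1+ m ] -[1+ n ] = trans (-‿cong (trans (reflexive (≡.cong (λ k → suc k · 1#) (≡.sym (ℕ.+-suc m n))))
    (×-homo-+ 1# (suc m) (suc n)))) (sym (⁻¹-∙-comm _ _))

  ι-neg : ∀ i → ι (ℤ.- i) ≈ - ι i
  ι-neg (+ ℕ.zero) = sym -0#≈0#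
  ι-neg (+ suc n) = refl
  ι-neg -[1+ n ] = sym (-‿involutive _)

  ι-* : ∀ i j → ι (i ℤ.* j) ≈ ι i * ι j
  ι-* (+ m) (+ n) = trans (ι-◃+ (m ℕ.* n)) (×1-homo-* m n)
  ι-* (+ m) -[1+ n ] = trans (ι-◃- (m ℕ.* suc n)) (trans (-‿cong (×1-homo-* m (suc n))) (-‿distribʳ-* _ _))
  ι-* -[1+ m ] (+ n) = trans (ι-◃- (suc m ℕ.* n)) (trans (-‿cong (×1-homo-* (suc m) n)) (-‿distribˡ-* _ _))
  ι-* -[1+ m ] -[1+ n ] = trans (ι-◃+ (suc m ℕ.* suc n)) (trans (×1-homo-* (suc m) (suc n)) (sym
    (trans (sym (-‿distribˡ-* _ _)) (trans (-‿cong (sym (-‿distribʳ-* _ _))) (-‿involutive _)))))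

  private
    ℤ⟶R : CommutativeRing.rawRing ℤ.+-*-commutativeRing ACR.-Raw-AlmostCommutative⟶ ACR.fromCommutativeRing R
    ℤ⟶R = record { ⟦_⟧ = ι ; +-homo = ι-+ ; *-homo = ι-* ; -‿homo = ι-neg ; 0-homo = refl ; 1-homo = refl }

    ι≟ : ∀ i j → Maybe (ι i ≈ ι j)
    ι≟ i j with i ℤ.≟ j
    ... | yes ≡.refl = just refl
    ... | no _ = nothing

  open RingSolver _ _ ℤ⟶R ι≟ public using (solve; _:=_; con; _:+_; _:*_; :-_; _:-_)

  ι-sum : ∀ {n} (f : Vector ℤ n) → ι (FiniteSum.sum ℤ.+-0-commutativeMonoid f) ≈ sum (ι ∘ f)
  ι-sum {ℕ.zero} f = refl
  ι-sum {suc n} f = trans (ι-+ (f zero) _) (+-congˡ (ι-sum (f ∘ Fin.suc)))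

  sum-neg : ∀ {n} (f : Vector Carrier n) → sum (λ i → - f i) ≈ - sum f
  sum-neg f = trans (sum-cong-≋ λ i → solve 1 (λ x → :- x := con (ℤ.- + 1) :* x) refl (f i))
    (trans (sym (*-distribˡ-sum _ f)) (solve 1 (λ x → con (ℤ.- + 1) :* x := :- x) refl (sum f)))

  ·-ι : ∀ n x → n · x ≈ ι (+ n) * x
  ·-ι ℕ.zero x = sym (zeroˡ x)
  ·-ι (suc n) x = trans (1+× n x) (trans (+-cong (sym (*-identityˡ x)) (·-ι n x))
    (trans (sym (distribʳ x _ _)) (*-congʳ (sym (1+× n 1#)))))

  1^ : ∀ n → 1# ^ n ≈ 1#
  1^ ℕ.zero = refl
  1^ (suc n) = trans (*-identityˡ _) (1^ n)

  sum-off-ι : ∀ {n} (i : Fin n) (f : Vector Carrier n) {y} → (∀ j → j ≢ i → f j ≈ y) →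
              sum f ≈ f i + ι (+ ℕ.pred n) * y
  sum-off-ι {n} i f off = trans (sum-off i f off) (+-congˡ (trans (×ᵤ≈× (ℕ.pred n) _) (·-ι (ℕ.pred n) _)))

  [x-1]*y : ∀ x y → (x - 1#) * y ≈ x * y - y
  [x-1]*y = solve 2 (λ x y → (x :- con (+ 1)) :* y := x :* y :- y) refl

  1+[x-1] : ∀ x → 1# + (x - 1#) ≈ x
  1+[x-1] = solve 1 (λ x → con (+ 1) :+ (x :- con (+ 1)) := x) refl

  x≈[1+x+yz]-1-yz : ∀ x y z → x ≈ (1# + x + y * z) - 1# + y * (- z)
  x≈[1+x+yz]-1-yz = solve 3 (λ x y z → x := (con (+ 1) :+ x :+ y :* z) :- con (+ 1) :+ y :* (:- z)) refl

-- Finite fields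

module ℕΣ = FiniteSum ℕ.+-0-commutativeMonoid

sum-mono : ∀ {n} {f g : Vector ℕ n} → (∀ i → f i ≤ g i) → ℕΣ.sum f ≤ ℕΣ.sum g
sum-mono {ℕ.zero} f≤g = ℕ.z≤n
sum-mono {suc n} f≤g = ℕ.+-mono-≤ (f≤g zero) (sum-mono (f≤g ∘ Fin.suc))

-- This converts a comparison of totals into pointwise information; the facts about squares in a
-- finite field are obtained from it by counting.
sum-tight : ∀ {n} {f g : Vector ℕ n} → (∀ i → f i ≤ g i) → ℕΣ.sum g ≤ ℕΣ.sum f → ∀ i → f i ≡ g i
sum-tight {suc n} {f} {g} f≤g Σg≤Σf zero = ℕ.≤-antisym (f≤g zero)
  (ℕ.+-cancelʳ-≤ (ℕΣ.sum (f ∘ Fin.suc)) (g zero) (f zero)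
    (ℕ.≤-trans (ℕ.+-monoʳ-≤ (g zero) (sum-mono (f≤g ∘ Fin.suc))) Σg≤Σf))
sum-tight {suc n} {f} {g} f≤g Σg≤Σf (Fin.suc i) = sum-tight (f≤g ∘ Fin.suc)
  (ℕ.+-cancelˡ-≤ (f zero) (ℕΣ.sum (g ∘ Fin.suc)) (ℕΣ.sum (f ∘ Fin.suc))
    (ℕ.≤-trans (ℕ.+-monoˡ-≤ (ℕΣ.sum (g ∘ Fin.suc)) (f≤g zero)) Σg≤Σf)) i

sum-const : ∀ n k → ℕΣ.sum {n} (λ _ → k) ≡ n *ℕ k
sum-const ℕ.zero k = ≡.refl
sum-const (suc n) k = ≡.cong (k ℕ.+_) (sum-const n k)

𝟙 : ∀ {a} {A : Set a} → Dec A → ℕ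
𝟙 d = if does d then 1 else 0

𝟙-yes : ∀ {a} {A : Set a} (d : Dec A) → A → 𝟙 d ≡ 1
𝟙-yes (yes _) a = ≡.refl
𝟙-yes (no ¬a) a = contradiction a ¬a

𝟙-no : ∀ {a} {A : Set a} (d : Dec A) → ¬ A → 𝟙 d ≡ 0
𝟙-no (yes a) ¬a = contradiction a ¬a
𝟙-no (no _) ¬a = ≡.refl

𝟙-mono-⊎ : ∀ {a b c} {A : Set a} {B : Set b} {C : Set c} (d : Dec A) (e : Dec B) (f : Dec C) →
           (A → B ⊎ C) → 𝟙 d ≤ 𝟙 e ℕ.+ 𝟙 f
𝟙-mono-⊎ (no _) e f h = ℕ.z≤n
𝟙-mono-⊎ (yes a) e f h with h a
... | inj₁ b = ℕ.≤-trans (ℕ.≤-reflexive (≡.sym (𝟙-yes e b))) (ℕ.m≤m+n _ _)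
... | inj₂ c = ℕ.≤-trans (ℕ.≤-reflexive (≡.sym (𝟙-yes f c))) (ℕ.m≤n+m _ _)

count-≡ : ∀ {n} (c : Fin n) → ℕΣ.sum (λ y → 𝟙 (y Fin.≟ c)) ≡ 1
count-≡ c = ≡.trans (ℕΣ.sum-single c _ λ j j≢c → 𝟙-no (j Fin.≟ c) j≢c) (𝟙-yes (c Fin.≟ c) ≡.refl)

count-≡′ : ∀ {n} (c : Fin n) → ℕΣ.sum (λ y → 𝟙 (c Fin.≟ y)) ≡ 1
count-≡′ c = ≡.trans (ℕΣ.sum-single c _ λ j j≢c → 𝟙-no (c Fin.≟ j) (j≢c ∘ ≡.sym)) (𝟙-yes (c Fin.≟ c) ≡.refl)

-- Finite fields are transported to Fin n, where every function respects equality.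
record FinField (n : ℕ) : Set where
  field
    _⊕_ _⊛_ : Fin n → Fin n → Fin n
    ⊖_      : Fin n → Fin n
    o e     : Fin n
    isCommutativeRing : IsCommutativeRing _≡_ _⊕_ _⊛_ ⊖_ o e
    inverse : ∀ x → x ≢ o → ∃ λ y → y ⊛ x ≡ e
    e≢o     : e ≢ o

  commutativeRing : CommutativeRing 0ℓ 0ℓ
  commutativeRing = record { isCommutativeRing = isCommutativeRing }

module FiniteFieldTheory {n} (F : FinField n) where
  open FinField F using (inverse) renaming (e≢o to 1≢0; commutativeRing to F-ring) public
  open Ring F-ring public
  open ≡ using (cong; cong₂)

  cancelˡ : ∀ {x y z} → x ≢ 0# → x * y ≡ x * z → y ≡ z
  cancelˡ {x} {y} {z} x≢0 xy≡xz with i , ix≡1 ← inverse x x≢0 = trans (sym (undo y)) (trans (cong (i *_) xy≡xz) (undo z))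
    where
    undo : ∀ w → i * (x * w) ≡ w
    undo w = trans (sym (*-assoc i x w)) (trans (cong (_* w) ix≡1) (*-identityˡ w))

  zero-product : ∀ {x y} → x ≢ 0# → x * y ≡ 0# → y ≡ 0#
  zero-product x≢0 xy≡0 = cancelˡ x≢0 (trans xy≡0 (sym (zeroʳ _)))

  *-≢0 : ∀ {x y} → x ≢ 0# → y ≢ 0# → x * y ≢ 0#
  *-≢0 x≢0 y≢0 xy≡0 = y≢0 (zero-product x≢0 xy≡0)

  module Reindex {c ℓ} (M : CommutativeMonoid c ℓ) where
    open CommutativeMonoid M using () renaming (Carrier to A; _≈_ to _≃_)
    open FiniteSum M using () renaming (sum to ∑; sum-reindex to ∑-reindex)

    shift : ∀ x (f : Vector A n) → ∑ (λ a → f (a + x)) ≃ ∑ f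
    shift x = ∑-reindex (_+ x) (_- x) (λ a → solve 2 (λ a x → (a :- x) :+ x := a) refl a x)
                                        (λ a → solve 2 (λ a x → (a :+ x) :- x := a) refl a x)

    reflect : ∀ x (f : Vector A n) → ∑ (λ a → f (x - a)) ≃ ∑ f
    reflect x = ∑-reindex (λ a → x - a) (λ a → x - a) inv inv
      where
      inv : ∀ a → x - (x - a) ≡ a
      inv a = solve 2 (λ a x → x :- (x :- a) := a) refl a x

    scale : ∀ {x} → x ≢ 0# → (f : Vector A n) → ∑ (λ a → f (x * a)) ≃ ∑ f
    scale {x} x≢0 with i , ix≡1 ← inverse x x≢0 = ∑-reindex (x *_) (i *_)
      (λ a → trans (sym (*-assoc x i a)) (trans (cong (_* a) (trans (*-comm x i) ix≡1)) (*-identityˡ a)))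
      (λ a → trans (sym (*-assoc i x a)) (trans (cong (_* a) ix≡1) (*-identityˡ a)))

  private
    module Π = FiniteSum *-commutativeMonoid

    -- Products over the nonzero elements are written as products over all of `Fin n` whose factor
    -- at 0 is replaced by 1.
    nz : Fin n → Fin n → Fin n
    nz a x = if does (a Fin.≟ 0#) then 1# else x

    nz-≢ : ∀ {a} x → a ≢ 0# → nz a x ≡ x
    nz-≢ {a} x a≢0 with a Fin.≟ 0#
    ... | yes a≡0 = contradiction a≡0 a≢0
    ... | no _ = ≡.refl

    nz-0 : ∀ x → nz 0# x ≡ 1#
    nz-0 x with 0# Fin.≟ 0#
    ... | yes _ = ≡.refl
    ... | no 0≢0 = contradiction ≡.refl 0≢0

    Π-≢0 : ∀ {m} (f : Vector (Fin n) m) → (∀ i → f i ≢ 0#) → Π.sum f ≢ 0#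
    Π-≢0 {ℕ.zero} f f≢0 = 1≢0
    Π-≢0 {suc m} f f≢0 = *-≢0 (f≢0 zero) (Π-≢0 (f ∘ Fin.suc) (f≢0 ∘ Fin.suc))

    Π-* : ∀ {m} (f g : Vector (Fin n) m) → Π.sum (λ i → f i * g i) ≡ Π.sum f * Π.sum g
    Π-* = Π.∑-distrib-+

  -- Multiplication by x permutes the nonzero elements, so their product P satisfies P = x^(n - 1)
  -- P, and P can be cancelled.
  fermat : ∀ {x} → x ≢ 0# → x ^ ℕ.pred n ≡ 1#
  fermat {x} x≢0 = cancelˡ (Π-≢0 (λ a → nz a a) all≢0) (begin
    P * x ^ ℕ.pred n  ≡⟨ *-comm _ _ ⟩
    x ^ ℕ.pred n * P
      ≡⟨ cong (_* P) (trans (sym (*-identityˡ _)) (*-congʳ (sym (nz-0 x)))) ⟩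
    nz 0# x * x ^ ℕ.pred n * P           ≡⟨ cong (_* P) (Π.sum-off 0# (λ a → nz a x) (λ a → nz-≢ x)) ⟨
    Π.sum (λ a → nz a x) * P             ≡⟨ Π-* (λ a → nz a x) (λ a → nz a a) ⟨
    Π.sum (λ a → nz a x * nz a a)        ≡⟨ Π.sum-cong-≗ step ⟨
    Π.sum (λ a → nz (x * a) (x * a))     ≡⟨ Reindex.scale *-commutativeMonoid x≢0 (λ a → nz a a) ⟩
    P  ≡⟨ *-identityʳ P ⟨
    P * 1#  ∎)
    where
    open ≡.≡-Reasoning
    P = Π.sum (λ a → nz a a)
    all≢0 : ∀ a → nz a a ≢ 0#
    all≢0 a with a Fin.≟ 0#
    ... | yes _ = 1≢0
    ... | no a≢0 = a≢0
    step : ∀ a → nz (x * a) (x * a) ≡ nz a x * nz a a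
    step a = case a Fin.≟ 0# of λ where
      (yes ≡.refl) → trans (trans (cong (λ b → nz b (x * 0#)) (zeroʳ x)) (nz-0 _))
                       (sym (trans (cong₂ _*_ (nz-0 x) (nz-0 0#)) (*-identityˡ 1#)))
      (no a≢0) → trans (nz-≢ _ (*-≢0 x≢0 a≢0)) (sym (cong₂ _*_ (nz-≢ x a≢0) (nz-≢ a a≢0)))

  fermat′ : ∀ x → x ^ n ≡ x
  fermat′ x with suc-pred ← ℕ.suc-pred n {{Fin.nonZeroIndex x}} = case x Fin.≟ 0# of λ where
    (no x≢0) → trans (cong (x ^_) (≡.sym suc-pred)) (trans (cong (x *_) (fermat x≢0)) (*-identityʳ x))
    (yes ≡.refl) → trans (cong (0# ^_) (≡.sym suc-pred)) (zeroˡ _)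

  -- Monic polynomials of degree k, given by their lower coefficients.
  eval : ∀ {k} → Vec (Fin n) k → Fin n → Fin n
  eval [] x = 1#
  eval (c ∷ cs) x = c + x * eval cs x

  -- Horner's scheme: the partial values at r are the coefficients of the quotient by X - r. The
  -- leading coefficient 1 stays implicit.
  quotient : ∀ {k} → Vec (Fin n) (suc k) → Fin n → Vec (Fin n) k
  quotient (c ∷ []) r = []
  quotient (c ∷ cs@(_ ∷ _)) r = eval cs r ∷ quotient cs r

  factor : ∀ {k} (f : Vec (Fin n) (suc k)) r x → eval f x - eval f r ≡ (x - r) * eval (quotient f r) x
  factor (c ∷ []) r x = solve 3 (λ c r x → (c :+ x :* con (+ 1)) :- (c :+ r :* con (+ 1)) := (x :- r) :* con (+ 1)) refl c r x
  factor (c ∷ cs@(_ ∷ _)) r x = begin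
    (c + x * fx) - (c + r * fr)
      ≡⟨ solve 5 (λ c r x s t → (c :+ x :* s) :- (c :+ r :* t) := x :* (s :- t) :+ (x :- r) :* t) refl c r x fx fr ⟩
    x * (fx - fr) + (x - r) * fr      ≡⟨ cong (λ t → x * t + (x - r) * fr) (factor cs r x) ⟩
    x * ((x - r) * h) + (x - r) * fr
      ≡⟨ solve 4 (λ x r h t → x :* ((x :- r) :* h) :+ (x :- r) :* t := (x :- r) :* (t :+ x :* h)) refl x r h fr ⟩
    (x - r) * (fr + x * h)            ∎
    where
    open ≡.≡-Reasoning
    fx = eval cs x
    fr = eval cs r
    h = eval (quotient cs r) x

  -- A root r splits off a linear factor, and in the absence of zero divisors every root other than
  -- r is a root of the quotient.
  roots-≤ : ∀ {k} (f : Vec (Fin n) k) → ℕΣ.sum (λ x → 𝟙 (eval f x Fin.≟ 0#)) ≤ k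
  roots-≤ [] = ℕ.≤-reflexive (ℕΣ.sum-ε {n} λ x → 𝟙-no (1# Fin.≟ 0#) 1≢0)
  roots-≤ {suc k} f@(_ ∷ _) = case Fin.any? (λ r → eval f r Fin.≟ 0#) of λ where
    (no ¬root) → ℕ.≤-trans (ℕ.≤-reflexive (ℕΣ.sum-ε λ x → 𝟙-no (eval f x Fin.≟ 0#) (λ fx → ¬root (x , fx)))) ℕ.z≤n
    (yes (r , fr≡0)) → ℕ.≤-trans
      (sum-mono λ x → 𝟙-mono-⊎ (eval f x Fin.≟ 0#) (x Fin.≟ r) (eval (quotient f r) x Fin.≟ 0#) λ fx≡0 →
        case x Fin.≟ r of λ where
          (yes x≡r) → inj₁ x≡r
          (no x≢r) → inj₂ (zero-product (λ x-r≡0 → x≢r (x-y≈0⇒x≈y x-r≡0))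
            (trans (sym (factor f r x)) (x≈y⇒x-y≈0 (trans fx≡0 (sym fr≡0))))))
      (ℕ.≤-trans (ℕ.≤-reflexive (ℕΣ.∑-distrib-+ (λ x → 𝟙 (x Fin.≟ r)) _))
        (ℕ.+-mono-≤ (ℕ.≤-reflexive (count-≡ r)) (roots-≤ (quotient f r))))

  -- The polynomial is X^(k + 1) - 1: `k` counts the zero coefficients between the constant and the
  -- leading one.
  xᵏ-1 : ∀ k → Vec (Fin n) (suc k)
  xᵏ-1 k = - 1# ∷ Vec.replicate k 0#

  eval-x^ : ∀ k x → eval (xᵏ-1 k) x ≡ x ^ suc k - 1#
  eval-x^ k x = trans (+-comm _ _) (cong (λ t → x * t - 1#) (go k))
    where
    go : ∀ k → eval (Vec.replicate k 0#) x ≡ x ^ k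
    go ℕ.zero = ≡.refl
    go (suc k) = trans (+-identityˡ _) (cong (x *_) (go k))

  module Odd (2≢0 : 1# + 1# ≢ 0#) where
    y≢-y : ∀ {y} → y ≢ 0# → y ≢ - y
    y≢-y {y} y≢0 y≡-y = y≢0 (zero-product 2≢0
      (trans (solve 1 (λ y → (con (+ 1) :+ con (+ 1)) :* y := y :- (:- y)) refl y) (x≈y⇒x-y≈0 y≡-y)))

    square-roots : ∀ {x y} → x * x ≡ y * y → x ≡ y ⊎ x ≡ - y
    square-roots {x} {y} x²≡y² = case x Fin.≟ y of λ where
      (yes x≡y) → inj₁ x≡y
      (no x≢y) → inj₂ (x-y≈0⇒x≈y (zero-product (λ x-y≡0 → x≢y (x-y≈0⇒x≈y x-y≡0))
        (trans (solve 2 (λ x y → (x :- y) :* (x :- (:- y)) := x :* x :- y :* y) refl x y) (x≈y⇒x-y≈0 x²≡y²))))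

    neg-square : ∀ y → (- y) * (- y) ≡ y * y
    neg-square = solve 1 (λ y → (:- y) :* (:- y) := y :* y) refl

    Square : Fin n → Set
    Square c = ∃ λ y → y * y ≡ c

    Square? : ∀ c → Dec (Square c)
    Square? c = Fin.any? (λ y → y * y Fin.≟ c)

    -- This is 1 + χ₂(c) for the quadratic character χ₂, kept in ℕ so that it can be handled by
    -- counting.
    rootCount : Fin n → ℕ
    rootCount c = ℕΣ.sum (λ y → 𝟙 (y * y Fin.≟ c))

    square≡0 : ∀ {y} → y * y ≡ 0# → y ≡ 0#
    square≡0 {y} y²≡0 = case y Fin.≟ 0# of λ where
      (yes y≡0) → y≡0
      (no y≢0) → zero-product y≢0 y²≡0

    rootCount-0 : rootCount 0# ≡ 1
    rootCount-0 = ≡.trans (ℕΣ.sum-single 0# _ λ y y≢0 → 𝟙-no (y * y Fin.≟ 0#) (y≢0 ∘ square≡0))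
      (𝟙-yes (0# * 0# Fin.≟ 0#) (zeroˡ 0#))

    rootCount-square : ∀ {y} → y ≢ 0# → rootCount (y * y) ≡ 2
    rootCount-square {y} y≢0 = ≡.trans
      (ℕΣ.sum-cong-≗ pointwise)
      (≡.trans (ℕΣ.∑-distrib-+ (λ x → 𝟙 (x Fin.≟ y)) (λ x → 𝟙 (x Fin.≟ - y))) (cong₂ ℕ._+_ (count-≡ y) (count-≡ (- y))))
      where
      pointwise : ∀ x → 𝟙 (x * x Fin.≟ y * y) ≡ 𝟙 (x Fin.≟ y) ℕ.+ 𝟙 (x Fin.≟ - y)
      pointwise x with x Fin.≟ y | x Fin.≟ - y
      ... | yes ≡.refl | yes x≡-y = contradiction x≡-y (y≢-y y≢0)
      ... | yes ≡.refl | no _ = 𝟙-yes (x * x Fin.≟ x * x) ≡.refl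
      ... | no _ | yes ≡.refl = 𝟙-yes (x * x Fin.≟ y * y) (neg-square y)
      ... | no x≢y | no x≢-y = 𝟙-no (x * x Fin.≟ y * y) λ eq → [ x≢y , x≢-y ]′ (square-roots eq)

    rootCount-nonsquare : ∀ {c} → ¬ Square c → rootCount c ≡ 0
    rootCount-nonsquare {c} ¬sq = ℕΣ.sum-ε λ y → 𝟙-no (y * y Fin.≟ c) (λ eq → ¬sq (y , eq))

    Σ-rootCount : ℕΣ.sum rootCount ≡ n
    Σ-rootCount = ≡.trans (ℕΣ.∑-comm (λ c y → 𝟙 (y * y Fin.≟ c)))
      (≡.trans (ℕΣ.sum-cong-≗ λ y → count-≡′ (y * y)) (≡.trans (sum-const n 1) (ℕ.*-identityʳ n)))

    rootCount-≤ : ∀ c → rootCount c ≤ 2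
    rootCount-≤ c = case Square? c of λ where
      (no ¬sq) → ℕ.≤-trans (ℕ.≤-reflexive (rootCount-nonsquare ¬sq)) ℕ.z≤n
      (yes (y , ≡.refl)) → case y Fin.≟ 0# of λ where
        (yes ≡.refl) → ℕ.≤-trans (ℕ.≤-reflexive (≡.trans (cong rootCount (zeroˡ 0#)) rootCount-0)) (ℕ.s≤s ℕ.z≤n)
        (no y≢0) → ℕ.≤-reflexive (rootCount-square y≢0)

    -- Both terms count square roots; together they are at most two for every c, while on average they are exactly two.
    rootCount-complement : ∀ {m} → ¬ Square m → (∃ λ i → m * i ≡ 1#) → ∃ λ i → m * i ≡ 1# ×
                           (∀ c → rootCount c ℕ.+ rootCount (i * c) ≡ 2)
    rootCount-complement {m} ¬sq (i , mi≡1) = i , mi≡1 , sum-tight bound (ℕ.≤-reflexive (≡.sym (≡.trans total (≡.sym (sum-const n 2)))))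
      where
      i≢0 : i ≢ 0#
      i≢0 ≡.refl = 1≢0 (trans (sym mi≡1) (zeroʳ m))
      total : ℕΣ.sum (λ c → rootCount c ℕ.+ rootCount (i * c)) ≡ n *ℕ 2
      total = ≡.trans (ℕΣ.∑-distrib-+ rootCount (λ c → rootCount (i * c)))
        (≡.trans (cong₂ ℕ._+_ Σ-rootCount (≡.trans (Reindex.scale ℕ.+-0-commutativeMonoid i≢0 rootCount) Σ-rootCount))
        (≡.trans (≡.cong (n ℕ.+_) (≡.sym (ℕ.+-identityʳ n))) (ℕ.*-comm 2 n)))
      bound : ∀ c → rootCount c ℕ.+ rootCount (i * c) ≤ 2
      bound c = case Square? c of λ where
          (no ¬c) → ℕ.≤-trans (ℕ.≤-reflexive (cong (ℕ._+ rootCount (i * c)) (rootCount-nonsquare ¬c))) (rootCount-≤ (i * c))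
          (yes (y , ≡.refl)) → case y Fin.≟ 0# of λ where
            (yes ≡.refl) → ℕ.≤-reflexive (cong₂ ℕ._+_ (≡.trans (cong rootCount (zeroˡ 0#)) rootCount-0)
              (≡.trans (cong rootCount (trans (cong (i *_) (zeroˡ 0#)) (zeroʳ i))) rootCount-0))
            (no y≢0) → ℕ.≤-reflexive (cong₂ ℕ._+_ (rootCount-square y≢0) (rootCount-nonsquare (notBoth y≢0)))
        where
        -- If i y² = z², then m = m z²/z² = (m i)(y/z)² = (y/z)² would be a square.
        notBoth : ∀ {y} → y ≢ 0# → ¬ Square (i * (y * y))
        notBoth {y} y≢0 (z , z²≡iy²) = ¬sq (j * y , (begin
          (j * y) * (j * y)
            ≡⟨ solve 2 (λ j y → (j :* y) :* (j :* y) := con (+ 1) :* (j :* j :* (y :* y))) refl j y ⟩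
          1# * (j * j * (y * y))     ≡⟨ *-congʳ mi≡1 ⟨
          m * i * (j * j * (y * y))
            ≡⟨ solve 4 (λ m i j y → m :* i :* (j :* j :* (y :* y)) := m :* (j :* j) :* (i :* (y :* y))) refl m i j y ⟩
          m * (j * j) * (i * (y * y)) ≡⟨ cong (m * (j * j) *_) z²≡iy² ⟨
          m * (j * j) * (z * z)
            ≡⟨ solve 3 (λ m j z → m :* (j :* j) :* (z :* z) := m :* ((j :* z) :* (j :* z))) refl m j z ⟩
          m * ((j * z) * (j * z))    ≡⟨ cong (λ t → m * (t * t)) jz≡1 ⟩
          m * (1# * 1#)              ≡⟨ trans (cong (m *_) (*-identityˡ 1#)) (*-identityʳ m) ⟩
          m  ∎))
          where
          open ≡.≡-Reasoning
          z≢0 : z ≢ 0#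
          z≢0 ≡.refl = *-≢0 i≢0 (*-≢0 y≢0 y≢0) (trans (sym z²≡iy²) (zeroˡ 0#))
          j = proj₁ (inverse z z≢0)
          jz≡1 = proj₂ (inverse z z≢0)

    -- Otherwise every root count would be at least 1. As they add up to n, each would be exactly 1,
    -- but 1 has two square roots.
    not-all-squares : ¬ (∀ c → Square c)
    not-all-squares squares = contradiction
      (≡.trans (sum-tight 1≤ (ℕ.≤-reflexive (≡.trans Σ-rootCount (≡.sym (≡.trans (sum-const n 1) (ℕ.*-identityʳ n))))) (1# * 1#)) (rootCount-square 1≢0)) λ ()
      where
      1≤ : ∀ c → 1 ≤ rootCount c
      1≤ c = case squares c of λ where
        (y , ≡.refl) → case y Fin.≟ 0# of λ where
          (yes ≡.refl) → ℕ.≤-reflexive (≡.sym (≡.trans (cong rootCount (zeroˡ 0#)) rootCount-0))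
          (no y≢0) → ℕ.≤-trans (ℕ.s≤s ℕ.z≤n) (ℕ.≤-reflexive (≡.sym (rootCount-square y≢0)))

    -- Otherwise c and all nonzero squares would be more than k roots of the polynomial x^k − 1.
    euler : ∀ {c k} → n ≡ suc (k ℕ.+ k) → c ^ k ≡ 1# → Square c
    euler {c} {ℕ.zero} ≡.refl c^k≡1 = contradiction (fin1 1# 0#) 1≢0
      where
      fin1 : (a b : Fin 1) → a ≡ b
      fin1 zero zero = ≡.refl
    euler {c} {suc k} n≡ c^k≡1 = case Square? c of λ where
        (yes sq) → sq
        (no ¬sq) → contradiction (few ¬sq) (ℕ.m+1+n≰m n)
      where
      R : Fin n → ℕ
      R x = 𝟙 (eval (xᵏ-1 k) x Fin.≟ 0#)

      c≢0 : ¬ Square c → c ≢ 0#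
      c≢0 ¬sq ≡.refl = ¬sq (0# , zeroˡ 0#)

      root : ∀ {x} → x ^ suc k ≡ 1# → R x ≡ 1
      root {x} x^k≡1 = 𝟙-yes (eval (xᵏ-1 k) x Fin.≟ 0#) (trans (eval-x^ k x) (x≈y⇒x-y≈0 x^k≡1))

      square-root : ∀ {y} → y ≢ 0# → (y * y) ^ suc k ≡ 1#
      square-root {y} y≢0 = trans (^-distrib-* y y (suc k)) (trans (sym (^-homo-* y (suc k) (suc k)))
        (trans (cong (y ^_) (≡.cong ℕ.pred (≡.sym n≡))) (fermat y≢0)))

      -- Nonzero squares have root count 2, so the other root sums are doubled as well. Summed over
      -- x, the inequality reads n + 2 ≤ 1 + 2 ΣR, and the bound on the number of roots makes the
      -- right side at most n.
      pointwise : ¬ Square c → ∀ x → rootCount x ℕ.+ 2 *ℕ 𝟙 (x Fin.≟ c) ≤ 𝟙 (x Fin.≟ 0#) ℕ.+ 2 *ℕ R x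
      pointwise ¬sq x = case x Fin.≟ c of λ where
          (yes ≡.refl) → ℕ.≤-reflexive (cong₂ ℕ._+_
            (≡.trans (rootCount-nonsquare ¬sq) (≡.sym (𝟙-no (x Fin.≟ 0#) (c≢0 ¬sq))))
            (≡.cong (2 *ℕ_) (≡.trans (𝟙-yes (x Fin.≟ c) ≡.refl) (≡.sym (root c^k≡1)))))
          (no x≢c) → ℕ.≤-trans (ℕ.≤-reflexive (≡.trans
            (≡.cong (λ t → rootCount x ℕ.+ 2 *ℕ t) (𝟙-no (x Fin.≟ c) x≢c)) (ℕ.+-identityʳ _))) (other x)
        where
        other : ∀ x → rootCount x ≤ 𝟙 (x Fin.≟ 0#) ℕ.+ 2 *ℕ R x
        other x = case Square? x of λ where
          (no ¬x) → ℕ.≤-trans (ℕ.≤-reflexive (rootCount-nonsquare ¬x)) ℕ.z≤n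
          (yes (y , ≡.refl)) → case y Fin.≟ 0# of λ where
            (yes ≡.refl) → ℕ.≤-trans (ℕ.≤-reflexive (≡.trans (cong rootCount (zeroˡ 0#)) (≡.trans rootCount-0
              (≡.sym (𝟙-yes (0# * 0# Fin.≟ 0#) (zeroˡ 0#)))))) (ℕ.m≤m+n _ _)
            (no y≢0) → ℕ.≤-trans (ℕ.≤-reflexive (≡.trans (rootCount-square y≢0)
              (≡.cong (2 *ℕ_) (≡.sym (root (square-root y≢0)))))) (ℕ.m≤n+m (2 *ℕ R (y * y)) (𝟙 (y * y Fin.≟ 0#)))

      ΣR≤ : 2 *ℕ ℕΣ.sum R ≤ 2 *ℕ suc k
      ΣR≤ = ℕ.*-monoʳ-≤ 2 (roots-≤ (xᵏ-1 k))

      Σ-double : ∀ (f : Fin n → ℕ) → ℕΣ.sum (λ x → 2 *ℕ f x) ≡ 2 *ℕ ℕΣ.sum f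
      Σ-double f = ≡.sym (SemiringSum.*-distribˡ-sum ℕ.+-*-semiring 2 f)

      few : ¬ Square c → n ℕ.+ 2 ≤ n
      few ¬sq = begin
        n ℕ.+ 2
          ≡⟨ ≡.cong₂ (λ a b → a ℕ.+ 2 *ℕ b) Σ-rootCount (count-≡ c) ⟨
        ℕΣ.sum rootCount ℕ.+ 2 *ℕ ℕΣ.sum (λ x → 𝟙 (x Fin.≟ c))
          ≡⟨ ≡.cong (ℕΣ.sum rootCount ℕ.+_) (Σ-double (λ x → 𝟙 (x Fin.≟ c))) ⟨
        ℕΣ.sum rootCount ℕ.+ ℕΣ.sum (λ x → 2 *ℕ 𝟙 (x Fin.≟ c))
          ≡⟨ ℕΣ.∑-distrib-+ rootCount (λ x → 2 *ℕ 𝟙 (x Fin.≟ c)) ⟨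
        ℕΣ.sum (λ x → rootCount x ℕ.+ 2 *ℕ 𝟙 (x Fin.≟ c)) ≤⟨ sum-mono (pointwise ¬sq) ⟩
        ℕΣ.sum (λ x → 𝟙 (x Fin.≟ 0#) ℕ.+ 2 *ℕ R x)
          ≡⟨ ℕΣ.∑-distrib-+ (λ x → 𝟙 (x Fin.≟ 0#)) (λ x → 2 *ℕ R x) ⟩
        ℕΣ.sum (λ x → 𝟙 (x Fin.≟ 0#)) ℕ.+ ℕΣ.sum (λ x → 2 *ℕ R x)
          ≡⟨ ≡.cong₂ ℕ._+_ (count-≡ 0#) (Σ-double R) ⟩
        1 ℕ.+ 2 *ℕ ℕΣ.sum R  ≤⟨ ℕ.s≤s ΣR≤ ⟩
        suc (2 *ℕ suc k)
          ≡⟨ ≡.cong (λ t → suc (suc k ℕ.+ t)) (ℕ.+-identityʳ (suc k)) ⟩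
        suc (suc k ℕ.+ suc k)  ≡⟨ n≡ ⟨
        n  ∎
        where open ℕ.≤-Reasoning

-- Characters and quadratic Gauss sums

record IsCharacter {n} (F : FinField n) {c ℓ} (B : CommutativeRing c ℓ) (χ : Fin n → CommutativeRing.Carrier B) : Set ℓ where
  open FinField F using (_⊕_; o)
  open CommutativeRing B
  field
    χ-+ : ∀ a b → χ (a ⊕ b) ≈ χ a * χ b
    χ-0 : χ o ≈ 1#

module Character {n} (F : FinField n) {c ℓ} (B : CommutativeRing c ℓ)
  (χ : Fin n → CommutativeRing.Carrier B)
  (isCharacter : IsCharacter F B χ) where
  private
    module K = FiniteFieldTheory F
    open IsCharacter isCharacter
  open Ring B
  open SetoidReasoning setoid

  χ-cong : ∀ {a b} → a ≡ b → χ a ≈ χ b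
  χ-cong = reflexive ∘ ≡.cong χ

  sum-fibres : ∀ (g : Fin n → Fin n) (h : Fin n → Carrier) →
               sum (h ∘ g) ≈ sum λ b → ι (+ ℕΣ.sum (λ s → 𝟙 (g s Fin.≟ b))) * h b
  sum-fibres g h = begin
    sum (h ∘ g)  ≈⟨ sum-cong-≋ (λ s → sym (inner s)) ⟩
    sum (λ s → sum λ b → ι (+ 𝟙 (g s Fin.≟ b)) * h b)
      ≈⟨ ∑-comm (λ s b → ι (+ 𝟙 (g s Fin.≟ b)) * h b) ⟩
    sum (λ b → sum λ s → ι (+ 𝟙 (g s Fin.≟ b)) * h b)
      ≈⟨ sum-cong-≋ (λ b → sym (trans (*-congʳ (ι-ℕsum (λ s → 𝟙 (g s Fin.≟ b)))) (*-distribʳ-sum (h b) (λ s → ι (+ 𝟙 (g s Fin.≟ b)))))) ⟩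
    sum (λ b → ι (+ ℕΣ.sum (λ s → 𝟙 (g s Fin.≟ b))) * h b)  ∎
    where
    ι-ℕsum : ∀ {m} (f : Vector ℕ m) → ι (+ ℕΣ.sum f) ≈ sum (λ i → ι (+ f i))
    ι-ℕsum {ℕ.zero} f = refl
    ι-ℕsum {suc m} f = trans (ι-+ (+ f zero) (+ ℕΣ.sum (f ∘ Fin.suc))) (+-congˡ (ι-ℕsum (f ∘ Fin.suc)))
    inner : ∀ s → sum (λ b → ι (+ 𝟙 (g s Fin.≟ b)) * h b) ≈ h (g s)
    inner s = trans (sum-single (g s) _ λ b b≢ → trans (*-congʳ (reflexive (≡.cong (ι ∘ +_) (𝟙-no (g s Fin.≟ b) (b≢ ∘ ≡.sym))))) (zeroˡ _))
      (trans (*-congʳ (reflexive (≡.cong (ι ∘ +_) (𝟙-yes (g s Fin.≟ g s) ≡.refl)))) (*-identityˡ _))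

  module Nontrivial {x u} (u[χx-1]≈1 : u * (χ x - 1#) ≈ 1#) where
    -- Translating the summation variable by x multiplies the sum by χ(x), and χ(x) - 1 is
    -- invertible.
    Σχ≈0 : sum χ ≈ 0#
    Σχ≈0 = begin
      sum χ  ≈⟨ *-identityˡ _ ⟨
      1# * sum χ                 ≈⟨ *-congʳ u[χx-1]≈1 ⟨
      u * (χ x - 1#) * sum χ
        ≈⟨ solve 3 (λ u y s → u :* (y :- con (+ 1)) :* s := u :* (y :* s :- s)) refl u (χ x) (sum χ) ⟩
      u * (χ x * sum χ - sum χ)  ≈⟨ *-congˡ (x≈y⇒x-y≈0 translate) ⟩
      u * 0#  ≈⟨ zeroʳ u ⟩
      0#  ∎
      where
      translate : χ x * sum χ ≈ sum χ
      translate = trans (*-distribˡ-sum (χ x) χ) (trans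
        (sum-cong-≋ λ a → trans (*-comm (χ x) (χ a)) (sym (χ-+ a x))) (K.Reindex.shift +-commutativeMonoid x χ))

    orthogonality : ∀ {b} → b ≢ K.0# → sum (λ a → χ (b K.* a)) ≈ 0#
    orthogonality b≢0 = trans (K.Reindex.scale +-commutativeMonoid b≢0 χ) Σχ≈0

    orthogonality-0 : sum (λ a → χ (K.0# K.* a)) ≈ ι (+ n)
    orthogonality-0 = trans (sum-cong-≋ λ a → trans (χ-cong (K.zeroˡ a)) χ-0)
      (trans (sum-replicate n) (×ᵤ≈× n 1#))

    Σ-nonzero : ∀ a → ∃ λ z → sum (λ t → χ (t K.* a)) ≈ ι z
    Σ-nonzero a = case a Fin.≟ K.0# of λ where
      (no a≢0) → ℤ.0ℤ , trans (sum-cong-≋ λ t → χ-cong (K.*-comm t a)) (orthogonality a≢0)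
      (yes ≡.refl) → + n , trans (sum-cong-≋ λ t → χ-cong (K.*-comm t K.0#)) orthogonality-0

    -- The Gauss sum in the form of a quadratic exponential sum, which behaves well under scaling of
    -- c and needs no quadratic character.
    G : Fin n → Carrier
    G c = sum λ s → χ (c K.* (s K.* s))

    G-0 : G K.0# ≈ ι (+ n)
    G-0 = trans (sum-cong-≋ λ s → trans (χ-cong (K.zeroˡ (s K.* s))) χ-0) (trans (sum-replicate n) (×ᵤ≈× n 1#))

    G-square : ∀ {y} → y ≢ K.0# → ∀ c → G (c K.* (y K.* y)) ≈ G c
    G-square {y} y≢0 c = trans (sum-cong-≋ λ s → χ-cong (K.solve 3 (λ c y s → c K.:* (y K.:* y) K.:* (s K.:* s) K.:= c K.:* ((y K.:* s) K.:* (y K.:* s))) ≡.refl c y s))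
      (K.Reindex.scale +-commutativeMonoid y≢0 (λ s → χ (c K.* (s K.* s))))

    module Gauss (2≢0 : K.1# K.+ K.1# ≢ K.0#) where
      open K.Odd 2≢0 public

      G-1 : G K.1# ≈ sum λ b → ι (+ rootCount b) * χ b
      G-1 = trans (sum-cong-≋ λ s → χ-cong (K.*-identityˡ (s K.* s))) (sum-fibres (λ s → s K.* s) χ)

      -- With i = 1/c, the root counts of b and i b add up to 2 for every b, so that G(1) + G(c) = 2
      -- Σ χ = 0.
      G-nonsquare : ∀ {c} → ¬ Square c → G c ≈ - G K.1#
      G-nonsquare {c} ¬sq with i′ , i′c≡1 ← K.inverse c (λ { ≡.refl → ¬sq (K.0# , K.zeroˡ _) })
        with i , ci≡1 , two ← rootCount-complement ¬sq (i′ , ≡.trans (K.*-comm c i′) i′c≡1) =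
        x-y≈0⇒x≈y (begin
          G c - (- G K.1#)
            ≈⟨ solve 2 (λ x y → x :- (:- y) := y :+ x) refl (G c) (G K.1#) ⟩
          G K.1# + G c
            ≈⟨ +-cong G-1 (trans (sum-fibres (λ s → s K.* s) (λ b → χ (c K.* b))) (trans
               (sym (K.Reindex.scale +-commutativeMonoid i≢0 (λ b → ι (+ rootCount b) * χ (c K.* b))))
               (sum-cong-≋ λ b → *-congˡ (χ-cong (cib b))))) ⟩
          sum (λ b → ι (+ rootCount b) * χ b) + sum (λ b → ι (+ rootCount (i K.* b)) * χ b)
            ≈⟨ ∑-distrib-+ (λ b → ι (+ rootCount b) * χ b) (λ b → ι (+ rootCount (i K.* b)) * χ b) ⟨
          sum (λ b → ι (+ rootCount b) * χ b + ι (+ rootCount (i K.* b)) * χ b)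
            ≈⟨ sum-cong-≋ (λ b → trans (sym (distribʳ _ _ _)) (*-congʳ (trans (sym (ι-+ (+ rootCount b) (+ rootCount (i K.* b)))) (reflexive (≡.cong (ι ∘ +_) (two b)))))) ⟩
          sum (λ b → ι (+ 2) * χ b)  ≈⟨ *-distribˡ-sum (ι (+ 2)) χ ⟨
          ι (+ 2) * sum χ  ≈⟨ trans (*-congˡ Σχ≈0) (zeroʳ _) ⟩
          0#  ∎)
        where
        i≢0 : i ≢ K.0#
        i≢0 ≡.refl = K.1≢0 (≡.trans (≡.sym ci≡1) (K.zeroʳ c))
        cib : ∀ b → c K.* (i K.* b) ≡ b
        cib b = ≡.trans (≡.sym (K.*-assoc c i b)) (≡.trans (≡.cong (K._* b) ci≡1) (K.*-identityˡ b))

      G-± : ∀ {c} → c ≢ K.0# → ∃ λ z → G c ≈ ι z * G K.1# × (z ≡ + 1 ⊎ z ≡ ℤ.- + 1)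
      G-± {c} c≢0 = case Square? c of λ where
        (yes (y , ≡.refl)) → + 1 , trans (reflexive (≡.cong G (≡.sym (K.*-identityˡ (y K.* y)))))
          (trans (G-square (λ { ≡.refl → c≢0 (K.zeroˡ _) }) K.1#) (sym (*-identityˡ _))) , inj₁ ≡.refl
        (no ¬sq) → ℤ.- + 1 , trans (G-nonsquare ¬sq) (solve 1 (λ x → :- x := con (ℤ.- + 1) :* x) refl (G K.1#)) , inj₂ ≡.refl

      -- The substitution x = u + y turns χ(x² − y²) into χ(u² + 2uy).
      G*G⁻ : G K.1# * G (K.- K.1#) ≈ ι (+ n)
      G*G⁻ = begin
        G K.1# * G (K.- K.1#)
          ≈⟨ *-distribˡ-sum (G K.1#) (λ y → χ (K.- K.1# K.* (y K.* y))) ⟩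
        sum (λ y → G K.1# * χ (K.- K.1# K.* (y K.* y)))
          ≈⟨ sum-cong-≋ (λ y → trans (*-distribʳ-sum _ (λ x → χ (K.1# K.* (x K.* x)))) (trans (sym (K.Reindex.shift +-commutativeMonoid y (λ x → χ (K.1# K.* (x K.* x)) * χ (K.- K.1# K.* (y K.* y)))))
             (sum-cong-≋ λ u → combine u y))) ⟩
        sum (λ y → sum λ u → χ (u K.* u) * χ ((u K.+ u) K.* y))
          ≈⟨ ∑-comm (λ y u → χ (u K.* u) * χ ((u K.+ u) K.* y)) ⟩
        sum (λ u → sum λ y → χ (u K.* u) * χ ((u K.+ u) K.* y))
          ≈⟨ sum-cong-≋ (λ u → sym (*-distribˡ-sum (χ (u K.* u)) (λ y → χ ((u K.+ u) K.* y)))) ⟩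
        sum (λ u → χ (u K.* u) * sum λ y → χ ((u K.+ u) K.* y))
          ≈⟨ sum-single K.0# _ (λ u u≢0 → trans (*-congˡ (orthogonality (u+u≢0 u≢0))) (zeroʳ _)) ⟩
        χ (K.0# K.* K.0#) * sum (λ y → χ ((K.0# K.+ K.0#) K.* y))
          ≈⟨ *-cong (trans (χ-cong (K.zeroˡ _)) χ-0) (trans (sum-cong-≋ λ y → χ-cong (≡.cong (K._* y) (K.+-identityˡ _))) orthogonality-0) ⟩
        1# * ι (+ n)  ≈⟨ *-identityˡ _ ⟩
        ι (+ n)  ∎
        where
        u+u≢0 : ∀ {u} → u ≢ K.0# → u K.+ u ≢ K.0#
        u+u≢0 {u} u≢0 eq = u≢0 (K.zero-product 2≢0 (≡.trans (K.solve 1 (λ u → (K.con (+ 1) K.:+ K.con (+ 1)) K.:* u K.:= u K.:+ u) ≡.refl u) eq))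
        combine : ∀ u y → χ (K.1# K.* ((u K.+ y) K.* (u K.+ y))) * χ (K.- K.1# K.* (y K.* y)) ≈ χ (u K.* u) * χ ((u K.+ u) K.* y)
        combine u y = trans (sym (χ-+ _ _)) (trans (χ-cong (K.solve 2 (λ u y →
          K.con (+ 1) K.:* ((u K.:+ y) K.:* (u K.:+ y)) K.:+ (K.:- K.con (+ 1)) K.:* (y K.:* y) K.:= u K.:* u K.:+ (u K.:+ u) K.:* y) ≡.refl u y)) (χ-+ _ _))

-- The integral group ring of the additive group

module Zr = Ring ℤ.+-*-commutativeRing

module GroupRing {n} (F : FinField n) where
  private module K = FiniteFieldTheory F

  private module Fn where
    _+_ : (f g : Fin n → ℤ) → Fin n → ℤ
    (f + g) a = f a ℤ.+ g a

  infixl 7 _✶_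
  -- Convolution is the product of the group ring when f stands for the formal sum of the f(a) X^a.
  -- `X b` below is the monomial X^b.
  _✶_ : (f g : Fin n → ℤ) → Fin n → ℤ
  (f ✶ g) c = Zr.sum λ a → f a ℤ.* g (c K.- a)

  X : Fin n → Fin n → ℤ
  X b a = + 𝟙 (a Fin.≟ b)

  X-same : ∀ b → X b b ≡ + 1
  X-same b = ≡.cong +_ (𝟙-yes (b Fin.≟ b) ≡.refl)

  X-other : ∀ {a b} → a ≢ b → X b a ≡ + 0
  X-other {a} {b} a≢b = ≡.cong +_ (𝟙-no (a Fin.≟ b) a≢b)

  X-✶ : ∀ b f c → (X b ✶ f) c ≡ f (c K.- b)
  X-✶ b f c = ≡.trans (Zr.sum-single b (λ a → X b a ℤ.* f (c K.- a)) (λ a a≢b → ≡.trans (≡.cong (ℤ._* f (c K.- a)) (X-other a≢b)) (ℤ.*-zeroˡ (f (c K.- a)))))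
    (≡.trans (≡.cong (ℤ._* f (c K.- b)) (X-same b)) (ℤ.*-identityˡ _))

  private
    ✶-cong : ∀ {f f′ g g′} → (∀ a → f a ≡ f′ a) → (∀ a → g a ≡ g′ a) → ∀ c → (f ✶ g) c ≡ (f′ ✶ g′) c
    ✶-cong f≡ g≡ c = Zr.sum-cong-≗ λ a → ≡.cong₂ ℤ._*_ (f≡ a) (g≡ (c K.- a))

    ✶-comm : ∀ f g c → (f ✶ g) c ≡ (g ✶ f) c
    ✶-comm f g c = ≡.trans (≡.sym (K.Reindex.reflect ℤ.+-0-commutativeMonoid c (λ a → f a ℤ.* g (c K.- a))))
      (Zr.sum-cong-≗ λ a → ≡.trans (ℤ.*-comm (f (c K.- a)) _) (≡.cong (λ b → g b ℤ.* f (c K.- a)) (K.solve 2 (λ a c → c K.:- (c K.:- a) K.:= a) ≡.refl a c)))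

    ✶-assoc : ∀ f g h c → ((f ✶ g) ✶ h) c ≡ (f ✶ (g ✶ h)) c
    ✶-assoc f g h c = begin
      Zr.sum (λ b → Zr.sum (λ a → f a ℤ.* g (b K.- a)) ℤ.* h (c K.- b))
        ≡⟨ Zr.sum-cong-≗ (λ b → Zr.*-distribʳ-sum (h (c K.- b)) (λ a → f a ℤ.* g (b K.- a))) ⟩
      Zr.sum (λ b → Zr.sum λ a → f a ℤ.* g (b K.- a) ℤ.* h (c K.- b))
        ≡⟨ Zr.∑-comm (λ b a → f a ℤ.* g (b K.- a) ℤ.* h (c K.- b)) ⟩
      Zr.sum (λ a → Zr.sum λ b → f a ℤ.* g (b K.- a) ℤ.* h (c K.- b))      ≡⟨ Zr.sum-cong-≗ inner ⟩
      Zr.sum (λ a → f a ℤ.* Zr.sum λ b → g b ℤ.* h ((c K.- a) K.- b))      ∎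
      where
      open ≡.≡-Reasoning
      inner : ∀ a → Zr.sum (λ b → f a ℤ.* g (b K.- a) ℤ.* h (c K.- b)) ≡ f a ℤ.* Zr.sum (λ b → g b ℤ.* h ((c K.- a) K.- b))
      inner a = begin
        Zr.sum (λ b → f a ℤ.* g (b K.- a) ℤ.* h (c K.- b))
          ≡⟨ K.Reindex.shift ℤ.+-0-commutativeMonoid a (λ b → f a ℤ.* g (b K.- a) ℤ.* h (c K.- b)) ⟨
        Zr.sum (λ b → f a ℤ.* g ((b K.+ a) K.- a) ℤ.* h (c K.- (b K.+ a)))
          ≡⟨ Zr.sum-cong-≗ (λ b → ≡.trans (ℤ.*-assoc (f a) _ _) (≡.cong₂ (λ u v → f a ℤ.* (g u ℤ.* h v))
             (K.solve 2 (λ a b → (b K.:+ a) K.:- a K.:= b) ≡.refl a b)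
             (K.solve 3 (λ a b c → c K.:- (b K.:+ a) K.:= (c K.:- a) K.:- b) ≡.refl a b c))) ⟩
        Zr.sum (λ b → f a ℤ.* (g b ℤ.* h ((c K.- a) K.- b)))
          ≡⟨ Zr.*-distribˡ-sum (f a) (λ b → g b ℤ.* h ((c K.- a) K.- b)) ⟨
        f a ℤ.* Zr.sum (λ b → g b ℤ.* h ((c K.- a) K.- b))  ∎

    ✶-identityˡ : ∀ f c → (X K.0# ✶ f) c ≡ f c
    ✶-identityˡ f c = ≡.trans (X-✶ K.0# f c) (≡.cong f (K.solve 1 (λ c → c K.:- K.con (+ 0) K.:= c) ≡.refl c))

    ✶-distribʳ : ∀ f g h c → ((g Fn.+ h) ✶ f) c ≡ (g ✶ f) c ℤ.+ (h ✶ f) c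
    ✶-distribʳ f g h c = ≡.trans (Zr.sum-cong-≗ λ a → ℤ.*-distribʳ-+ (f (c K.- a)) (g a) (h a))
      (Zr.∑-distrib-+ (λ a → g a ℤ.* f (c K.- a)) (λ a → h a ℤ.* f (c K.- a)))

  commutativeRing : CommutativeRing 0ℓ 0ℓ
  commutativeRing = record
    { Carrier = Fin n → ℤ
    ; _≈_ = λ f g → ∀ a → f a ≡ g a
    ; _+_ = Fn._+_
    ; _*_ = _✶_
    ; -_ = λ f a → ℤ.- f a
    ; 0# = λ _ → ℤ.0ℤ
    ; 1# = X K.0#
    ; isCommutativeRing = record
      { isRing = record
        { +-isAbelianGroup = record
          { isGroup = record
            { isMonoid = record
              { isSemigroup = record
                { isMagma = record
                  { isEquivalence = record
                    { refl = λ _ → ≡.refl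
                    ; sym = λ f≡g a → ≡.sym (f≡g a)
                    ; trans = λ f≡g g≡h a → ≡.trans (f≡g a) (g≡h a) }
                  ; ∙-cong = λ f≡ g≡ a → ≡.cong₂ ℤ._+_ (f≡ a) (g≡ a) }
                ; assoc = λ f g h a → ℤ.+-assoc (f a) (g a) (h a) }
              ; identity = (λ f a → ℤ.+-identityˡ (f a)) , (λ f a → ℤ.+-identityʳ (f a)) }
            ; inverse = (λ f a → ℤ.+-inverseˡ (f a)) , (λ f a → ℤ.+-inverseʳ (f a))
            ; ⁻¹-cong = λ f≡ a → ≡.cong ℤ.-_ (f≡ a) }
          ; comm = λ f g a → ℤ.+-comm (f a) (g a) }
        ; *-cong = ✶-cong
        ; *-assoc = ✶-assoc
        ; *-identity = ✶-identityˡ , (λ f c → ≡.trans (✶-comm f (X K.0#) c) (✶-identityˡ f c))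
        ; distrib = (λ f g h c → ≡.trans (✶-comm f (g Fn.+ h) c) (≡.trans (✶-distribʳ f g h c) (≡.cong₂ ℤ._+_ (✶-comm g f c) (✶-comm h f c))))
                  , ✶-distribʳ }
      ; *-comm = ✶-comm } }

  open Ring commutativeRing public
  module Π = FiniteSum *-commutativeMonoid

  X-+ : ∀ a b → X a * X b ≈ X (a K.+ b)
  X-+ a b c = ≡.trans (X-✶ a (X b) c) (≡.cong +_ (case c Fin.≟ a K.+ b of λ where
    (yes ≡.refl) → ≡.trans (𝟙-yes ((a K.+ b) K.- a Fin.≟ b) (K.solve 2 (λ a b → (a K.:+ b) K.:- a K.:= b) ≡.refl a b)) (≡.sym (𝟙-yes (a K.+ b Fin.≟ a K.+ b) ≡.refl))
    (no c≢) → ≡.trans (𝟙-no (c K.- a Fin.≟ b) (λ { ≡.refl → c≢ (K.solve 2 (λ a c → c K.:= a K.:+ (c K.:- a)) ≡.refl a c) })) (≡.sym (𝟙-no (c Fin.≟ a K.+ b) c≢))))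

  module Eval {c ℓ} (B : CommutativeRing c ℓ)
    (χ : Fin n → CommutativeRing.Carrier B)
    (isCharacter : IsCharacter F B χ) where
    private
      module B = Ring B
      module BΠ = FiniteSum B.*-commutativeMonoid
      open IsCharacter isCharacter
    open SetoidReasoning B.setoid

    -- The ring homomorphism from the group ring that sends X^a to χ(a).
    ev : (Fin n → ℤ) → B.Carrier
    ev f = B.sum λ a → B.ι (f a) B.* χ a

    ev-cong : ∀ {f g} → f ≈ g → ev f B.≈ ev g
    ev-cong f≈g = B.reflexive (B.sum-cong-≗ λ a → ≡.cong (λ z → B.ι z B.* χ a) (f≈g a))

    ev-+ : ∀ f g → ev (f + g) B.≈ ev f B.+ ev g
    ev-+ f g = B.trans (B.sum-cong-≋ λ a → B.trans (B.*-congʳ (B.ι-+ (f a) (g a))) (B.distribʳ _ _ _)) (B.∑-distrib-+ (λ a → B.ι (f a) B.* χ a) (λ a → B.ι (g a) B.* χ a))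

    ev-neg : ∀ f → ev (- f) B.≈ B.- ev f
    ev-neg f = B.trans (B.sum-cong-≋ λ a → B.trans (B.*-congʳ (B.ι-neg (f a))) (B.sym (B.-‿distribˡ-* _ _))) (B.sum-neg (λ a → B.ι (f a) B.* χ a))

    ev-X : ∀ b → ev (X b) B.≈ χ b
    ev-X b = B.trans (B.sum-single b _ λ a a≢b → B.trans (B.*-congʳ (B.reflexive (≡.cong B.ι (X-other a≢b)))) (B.zeroˡ _))
      (B.trans (B.*-congʳ (B.reflexive (≡.cong B.ι (X-same b)))) (B.*-identityˡ _))

    ev-1 : ev 1# B.≈ B.1#
    ev-1 = B.trans (ev-X K.0#) χ-0

    ev-scale : ∀ z f → ev (λ a → z ℤ.* f a) B.≈ B.ι z B.* ev f
    ev-scale z f = B.trans (B.sum-cong-≋ λ a → B.trans (B.*-congʳ (B.ι-* z (f a))) (B.*-assoc _ _ _)) (B.sym (B.*-distribˡ-sum (B.ι z) (λ a → B.ι (f a) B.* χ a)))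

    ev-const : ∀ z → ev (λ _ → z) B.≈ B.ι z B.* B.sum χ
    ev-const z = B.sym (B.*-distribˡ-sum (B.ι z) χ)

    ev-* : ∀ f g → ev (f * g) B.≈ ev f B.* ev g
    ev-* f g = begin
      B.sum (λ c → B.ι (Zr.sum λ a → f a ℤ.* g (c K.- a)) B.* χ c)
        ≈⟨ B.sum-cong-≋ expand ⟩
      B.sum (λ c → B.sum λ a → (B.ι (f a) B.* χ a) B.* (B.ι (g (c K.- a)) B.* χ (c K.- a)))
        ≈⟨ B.∑-comm (λ c a → (B.ι (f a) B.* χ a) B.* (B.ι (g (c K.- a)) B.* χ (c K.- a))) ⟩
      B.sum (λ a → B.sum λ c → (B.ι (f a) B.* χ a) B.* (B.ι (g (c K.- a)) B.* χ (c K.- a)))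
        ≈⟨ B.sum-cong-≋ (λ a → B.trans (B.sym (B.*-distribˡ-sum (B.ι (f a) B.* χ a) (λ c → B.ι (g (c K.- a)) B.* χ (c K.- a))))
           (B.*-congˡ (K.Reindex.shift B.+-commutativeMonoid (K.- a) (λ c → B.ι (g c) B.* χ c)))) ⟩
      B.sum (λ a → (B.ι (f a) B.* χ a) B.* ev g)
        ≈⟨ B.*-distribʳ-sum (ev g) (λ a → B.ι (f a) B.* χ a) ⟨
      ev f B.* ev g  ∎
      where
      expand : ∀ c → B.ι (Zr.sum λ a → f a ℤ.* g (c K.- a)) B.* χ c B.≈ B.sum (λ a → (B.ι (f a) B.* χ a) B.* (B.ι (g (c K.- a)) B.* χ (c K.- a)))
      expand c = B.trans (B.*-congʳ (B.ι-sum (λ a → f a ℤ.* g (c K.- a)))) (B.trans (B.*-distribʳ-sum (χ c) (λ a → B.ι (f a ℤ.* g (c K.- a))))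
        (B.sum-cong-≋ λ a → B.trans (B.*-cong (B.ι-* (f a) (g (c K.- a))) (B.trans (B.reflexive (≡.cong χ (K.solve 2 (λ a c → c K.:= a K.:+ (c K.:- a)) ≡.refl a c))) (χ-+ a (c K.- a))))
          (B.solve 4 (λ x y s t → (x B.:* y) B.:* (s B.:* t) B.:= (x B.:* s) B.:* (y B.:* t)) B.refl _ _ _ _)))

    ev-Π : ∀ {m} (f : Fin m → Fin n → ℤ) → ev (Π.sum f) B.≈ BΠ.sum (ev ∘ f)
    ev-Π {ℕ.zero} f = ev-1
    ev-Π {suc m} f = B.trans (ev-* (f zero) (Π.sum (f ∘ Fin.suc))) (B.*-congˡ (ev-Π (f ∘ Fin.suc)))

-- Divisibility by a prime and p-th powers

C-absorption : ∀ n k → suc k *ℕ (suc n C suc k) ≡ suc n *ℕ (n C k)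
C-absorption n ℕ.zero = ≡.trans (≡.cong (1 *ℕ_) (nC1≡n (suc n))) (ℕ.*-comm 1 (suc n))
C-absorption ℕ.zero (suc k) = ℕ.*-zeroʳ (2 ℕ.+ k)
C-absorption (suc n) (suc k) = begin
  suc (suc k) *ℕ (suc (suc n) C suc (suc k))
    ≡⟨ ≡.cong (suc (suc k) *ℕ_) (nCk+nC[k+1]≡[n+1]C[k+1] (suc n) (suc k)) ⟨
  suc (suc k) *ℕ (A ℕ.+ B)  ≡⟨ ℕ.*-distribˡ-+ (suc (suc k)) A B ⟩
  (A ℕ.+ suc k *ℕ A) ℕ.+ suc (suc k) *ℕ B
    ≡⟨ ≡.cong₂ (λ s t → (A ℕ.+ s) ℕ.+ t) (C-absorption n k) (C-absorption n (suc k)) ⟩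
  (A ℕ.+ suc n *ℕ D) ℕ.+ suc n *ℕ E
    ≡⟨ ≡.trans (ℕ.+-assoc A _ _) (≡.cong (A ℕ.+_) (≡.sym (ℕ.*-distribˡ-+ (suc n) D E))) ⟩
  A ℕ.+ suc n *ℕ (D ℕ.+ E)
    ≡⟨ ≡.cong (λ t → A ℕ.+ suc n *ℕ t) (nCk+nC[k+1]≡[n+1]C[k+1] n k) ⟩
  A ℕ.+ suc n *ℕ A  ∎
  where
  open ≡.≡-Reasoning
  A = suc n C suc k
  B = suc n C suc (suc k)
  D = n C k
  E = n C suc k

-- By absorption p divides k times the binomial coefficient, and p does not divide k because 0 < k <
-- p.
prime∣C : ∀ {p k} → Prime p → 0 ℕ.< k → k ℕ.< p → p ∣ p C k
prime∣C {suc n} {suc k} pr _ k<p = [ (λ p∣k → contradiction k<p (ℕ.≤⇒≯ (ℕ.∣⇒≤ p∣k))) , id ]′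
  (Prime.euclidsLemma (suc k) (suc n C suc k) pr (divides (n C k) (≡.trans (C-absorption n k) (ℕ.*-comm (suc n) _))))

module Frobenius {c ℓ} (R : CommutativeRing c ℓ) where
  open Ring R
  private module Bin = Binomial commutativeSemiring

  cofactor : ∀ {p m} → p ∣ m → ∃ λ q → ι (+ m) ≈ ι (+ p) * ι (+ q)
  cofactor {p} (divides q ≡.refl) = q , trans (×1-homo-* q p) (*-comm _ _)

  -- The inner terms of the binomial expansion are divisible by p. Their sum is kept as an explicit
  -- multiple of p because the lemma is applied in the integral group ring, where p is not 0.
  [1+y]^p : ∀ {p} → Prime p → ∀ y → ∃ λ v → (1# + y) ^ p ≈ 1# + y ^ p + ι (+ p) * v
  [1+y]^p {0} pr y = contradiction pr Prime.¬prime[0]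
  [1+y]^p {p@(suc p′)} pr y = sum v , (begin
    (1# + y) ^ p  ≈⟨ ^-congˡ p (+-comm 1# y) ⟩
    (y + 1#) ^ p  ≈⟨ Bin.theorem p y 1# ⟩
    sum term  ≈⟨ +-congˡ (sum-init-last (term ∘ Fin.suc)) ⟩
    term zero + (sum middle + term (Fin.fromℕ p))
      ≈⟨ +-cong first (+-cong (trans (sum-cong-≋ middle≈) (sym (*-distribˡ-sum (ι (+ p)) v))) last≈) ⟩
    1# + (ι (+ p) * sum v + y ^ p)
      ≈⟨ solve 2 (λ s t → con (+ 1) :+ (s :+ t) := con (+ 1) :+ t :+ s) refl (ι (+ p) * sum v) (y ^ p) ⟩
    1# + y ^ p + ι (+ p) * sum v  ∎)
    where
    open SetoidReasoning setoid
    module M = SemiringMult semiring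
    term : Fin (suc p) → Carrier
    term k = (p C toℕ k) M.× (y ^ toℕ k * 1# ^ (p ℕ.∸ toℕ k))
    middle : Fin p′ → Carrier
    middle i = term (Fin.suc (Fin.inject₁ i))
    p∣C : (i : Fin p′) → p ∣ p C (suc (toℕ i))
    p∣C i = prime∣C pr (ℕ.s≤s ℕ.z≤n) (ℕ.s≤s (Fin.toℕ<n i))
    v : Fin p′ → Carrier
    v i = ι (+ proj₁ (cofactor (p∣C i))) * y ^ suc (toℕ i)
    middle≈ : ∀ i → middle i ≈ ι (+ p) * v i
    middle≈ i rewrite Fin.toℕ-inject₁ i = begin
      (p C suc (toℕ i)) M.× (y ^ suc (toℕ i) * 1# ^ (p′ ℕ.∸ toℕ i))
        ≈⟨ M.×-congʳ (p C suc (toℕ i)) (trans (*-congˡ (1^ (p′ ℕ.∸ toℕ i))) (*-identityʳ _)) ⟩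
      (p C suc (toℕ i)) M.× y ^ suc (toℕ i)
        ≈⟨ trans (×ᵤ≈× (p C suc (toℕ i)) _) (·-ι (p C suc (toℕ i)) _) ⟩
      ι (+ (p C suc (toℕ i))) * y ^ suc (toℕ i)
        ≈⟨ *-congʳ (proj₂ (cofactor (p∣C i))) ⟩
      ι (+ p) * ι (+ proj₁ (cofactor (p∣C i))) * y ^ suc (toℕ i)         ≈⟨ *-assoc _ _ _ ⟩
      ι (+ p) * v i  ∎
    first : term zero ≈ 1#
    first = trans (+-identityʳ _) (trans (*-identityˡ _) (1^ p))
    last≈ : term (Fin.fromℕ p) ≈ y ^ p
    last≈ rewrite Fin.toℕ-fromℕ p′ | nCn≡1 p | ℕ.n∸n≡0 p′ = trans (+-identityʳ _) (*-identityʳ _)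

_∣ℤ_ : ℕ → ℤ → Set
p ∣ℤ z = ∃ λ m → z ≡ + p ℤ.* m

∣ℤ⇒∣ : ∀ {p z} → p ∣ℤ z → p ∣ ℤ.∣ z ∣
∣ℤ⇒∣ {p} {z} (m , z≡) = divides ℤ.∣ m ∣ (≡.trans (≡.cong ℤ.∣_∣ z≡) (≡.trans (ℤ.abs-* (+ p) m) (ℕ.*-comm p _)))

∣⇒∣ℤ : ∀ {p} z → p ∣ ℤ.∣ z ∣ → p ∣ℤ z
∣⇒∣ℤ {p} (+ n) (divides q eq) = + q , ≡.trans (≡.cong +_ (≡.trans eq (ℕ.*-comm q p))) (ℤ.pos-* p q)
∣⇒∣ℤ {p} -[1+ n ] (divides q eq) = ℤ.- + q , ≡.trans (≡.cong (ℤ.-_ ∘ +_) (≡.trans eq (ℕ.*-comm q p)))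
  (≡.trans (≡.cong ℤ.-_ (ℤ.pos-* p q)) (ℤ.neg-distribʳ-* (+ p) (+ q)))

prime-power-∣ℤ : ∀ {p} → Prime p → ∀ z k → p ∣ℤ (z Zr.^ k) → p ∣ℤ z
prime-power-∣ℤ {p} pr z ℕ.zero p∣1 = contradiction (≡.subst Prime (ℕ.∣1⇒≡1 (∣ℤ⇒∣ p∣1)) pr) Prime.¬prime[1]
prime-power-∣ℤ {p} pr z (suc k) p∣ = [ ∣⇒∣ℤ z , (λ d → prime-power-∣ℤ pr z k (∣⇒∣ℤ (z Zr.^ k) d)) ]′
  (Prime.euclidsLemma ℤ.∣ z ∣ ℤ.∣ z Zr.^ k ∣ pr (≡.subst (p ∣_) (ℤ.abs-* z (z Zr.^ k)) (∣ℤ⇒∣ p∣)))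

-- Multiples of 1 in a field with p elements

injective⇒surjective : ∀ {n} (f : Fin n → Fin n) → (∀ {i j} → f i ≡ f j → i ≡ j) → ∀ b → ∃ λ a → f a ≡ b
injective⇒surjective {suc n} f f-inj b = case Fin.any? (λ a → f a Fin.≟ b) of λ where
    (yes hit) → hit
    (no miss) → contradiction (Fin.injective⇒≤ {f = other miss} (λ {x} {y} → other-injective miss {x} {y})) ℕ.1+n≰n
  where
  other : ¬ (∃ λ a → f a ≡ b) → Fin (suc n) → Fin n
  other miss a = Fin.punchOut {i = b} {j = f a} (λ b≡fa → miss (a , ≡.sym b≡fa))
  other-injective : ∀ miss {x y} → other miss x ≡ other miss y → x ≡ y
  other-injective miss {x} {y} eq = f-inj (Fin.punchOut-injective (λ b≡fx → miss (x , ≡.sym b≡fx)) (λ b≡fy → miss (y , ≡.sym b≡fy)) eq)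

module Characteristic {n} (F : FinField n) where
  open FiniteFieldTheory F
  open ≡ using (cong)

  -- Shifting the summation variable by 1 does not change the sum of all elements, yet it adds n · 1
  -- to it.
  ι-size : ι (+ n) ≡ 0#
  ι-size = begin
    n · 1#                    ≡⟨ trans (sum-replicate n) (×ᵤ≈× n 1#) ⟨
    sum {n} (λ _ → 1#)
      ≡⟨ solve 2 (λ s t → s := (t :+ s) :- t) ≡.refl (sum {n} (λ _ → 1#)) (sum {n} id) ⟩
    (sum {n} id + sum {n} (λ _ → 1#)) - sum {n} id  ≡⟨ cong (_- sum id) (trans (sym (∑-distrib-+ id (λ _ → 1#))) (Reindex.shift +-commutativeMonoid 1# id)) ⟩
    sum {n} id - sum {n} id   ≡⟨ -‿inverseʳ _ ⟩
    0#  ∎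
    where open ≡.≡-Reasoning

  module _ (pr : Prime n) where
    -- Bézout turns k · 1 = 0 with 0 < k < n into 1 = 0.
    ι-≢0 : ∀ k → 0 ℕ.< k → k ℕ.< n → ι (+ k) ≢ 0#
    ι-≢0 k@(suc _) _ k<n ιk≡0 = case Coprimality.coprime-Bézout (Coprimality.prime⇒coprime pr k<n) of λ where
        (GCD.Bézout.+- x y eq) → 1≢0 (bezout y x eq ιk≡0 ι-size)
        (GCD.Bézout.-+ x y eq) → 1≢0 (bezout x y eq ι-size ιk≡0)
      where
      bezout : ∀ {a b} x y → 1 ℕ.+ x *ℕ a ≡ y *ℕ b → ι (+ a) ≡ 0# → ι (+ b) ≡ 0# → 1# ≡ 0#
      bezout {a} {b} x y eq a≡0 b≡0 = begin
        1#  ≡⟨ trans (sym (+-identityʳ 1#)) (+-congˡ (sym (vanish x a a≡0))) ⟩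
        1# + ι (+ (x *ℕ a))         ≡⟨ ι-+ (+ 1) (+ (x *ℕ a)) ⟨
        ι (+ (1 ℕ.+ x *ℕ a))        ≡⟨ cong (ι ∘ +_) eq ⟩
        ι (+ (y *ℕ b))              ≡⟨ vanish y b b≡0 ⟩
        0#  ∎
        where
        open ≡.≡-Reasoning
        vanish : ∀ x a → ι (+ a) ≡ 0# → ι (+ (x *ℕ a)) ≡ 0#
        vanish x a a≡0 = trans (×1-homo-* x a) (trans (*-congˡ a≡0) (zeroʳ _))

    ι-< : ∀ {i j} → i ℕ.< j → j ℕ.< n → ι (+ i) ≢ ι (+ j)
    ι-< {i} {j} i<j j<n eq = ι-≢0 (j ℕ.∸ i) (ℕ.m<n⇒0<n∸m i<j) (ℕ.≤-<-trans (ℕ.m∸n≤m j i) j<n) (begin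
      ι (+ (j ℕ.∸ i))
        ≡⟨ solve 2 (λ s t → s := (s :+ t) :- t) ≡.refl (ι (+ (j ℕ.∸ i))) (ι (+ i)) ⟩
      (ι (+ (j ℕ.∸ i)) + ι (+ i)) - ι (+ i)
        ≡⟨ cong (_- ι (+ i)) (trans (sym (ι-+ (+ (j ℕ.∸ i)) (+ i))) (≡.cong (ι ∘ +_) (ℕ.m∸n+n≡m (ℕ.<⇒≤ i<j)))) ⟩
      ι (+ j) - ι (+ i)  ≡⟨ x≈y⇒x-y≈0 (sym eq) ⟩
      0#  ∎)
      where open ≡.≡-Reasoning

    ι-injective : ∀ {i j} → i ℕ.< n → j ℕ.< n → ι (+ i) ≡ ι (+ j) → i ≡ j
    ι-injective {i} {j} i<n j<n eq with ℕ.<-cmp i j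
    ... | tri≈ _ i≡j _ = i≡j
    ... | tri< i<j _ _ = contradiction eq (ι-< i<j j<n)
    ... | tri> _ _ j<i = contradiction (sym eq) (ι-< j<i i<n)

    abstract
      -- The n multiples of 1 are distinct and therefore exhaust the field. The index is the least
      -- nonnegative representative of a residue class.
      index : ∀ a → ∃ λ (k : Fin n) → ι (+ toℕ k) ≡ a
      index = injective⇒surjective (λ k → ι (+ toℕ k)) λ {i} {j} eq → Fin.toℕ-injective (ι-injective (Fin.toℕ<n i) (Fin.toℕ<n j) eq)

      Fin-induction : ∀ {ℓ} (P : Fin n → Set ℓ) → P 0# → (∀ a → P a → P (a + 1#)) → ∀ a → P a
      Fin-induction P P0 P+ a with k , ιk≡a ← index a = ≡.subst P ιk≡a (go (toℕ k))
        where
        go : ∀ k → P (ι (+ k))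
        go ℕ.zero = P0
        go (suc k) = ≡.subst P (trans (+-comm _ _) (sym (1+× k 1#))) (P+ (ι (+ k)) (go k))

Zr-ι : ∀ z → Zr.ι z ≡ z
Zr-ι (+ n) = pos n
  where
  pos : ∀ n → n Zr.· (+ 1) ≡ + n
  pos ℕ.zero = ≡.refl
  pos (suc n) = ≡.trans (Zr.1+× n (+ 1)) (≡.cong (ℤ._+_ (+ 1)) (pos n))
Zr-ι -[1+ n ] = ≡.cong ℤ.-_ (Zr-ι (+ suc n))

-- Norms in the group ring

module Norm {n} (F : FinField n) where
  private module K = FiniteFieldTheory F
  open GroupRing F

  -- For i ≠ 0 this is the automorphism of the group ring that sends X^b to X^(b/i).
  τ : Fin n → (Fin n → ℤ) → Fin n → ℤ
  τ i f a = f (i K.* a)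

  τ-* : ∀ {i} → i ≢ K.0# → ∀ f g → τ i (f * g) ≈ τ i f * τ i g
  τ-* {i} i≢0 f g c = ≡.trans (≡.sym (K.Reindex.scale ℤ.+-0-commutativeMonoid i≢0 (λ a → f a ℤ.* g (i K.* c K.- a))))
    (Zr.sum-cong-≗ λ a → ≡.cong (λ b → f (i K.* a) ℤ.* g b) (K.solve 3 (λ i a c → i K.:* c K.:- i K.:* a K.:= i K.:* (c K.:- a)) ≡.refl i a c))

  τ-1 : ∀ {i} → i ≢ K.0# → τ i 1# ≈ 1#
  τ-1 {i} i≢0 a = case a Fin.≟ K.0# of λ where
    (yes ≡.refl) → ≡.cong 1# (K.zeroʳ i)
    (no a≢0) → ≡.trans (X-other (K.*-≢0 i≢0 a≢0)) (≡.sym (X-other a≢0))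

  τ-Π : ∀ {i} → i ≢ K.0# → ∀ {m} (g : Fin m → Fin n → ℤ) → τ i (Π.sum g) ≈ Π.sum (τ i ∘ g)
  τ-Π i≢0 {ℕ.zero} g = τ-1 i≢0
  τ-Π {i} i≢0 {suc m} g = trans {τ i (g zero * Π.sum (g ∘ Fin.suc))} {τ i (g zero) * τ i (Π.sum (g ∘ Fin.suc))} {τ i (g zero) * Π.sum (τ i ∘ g ∘ Fin.suc)}
    (τ-* i≢0 (g zero) (Π.sum (g ∘ Fin.suc))) (*-congˡ {τ i (g zero)} {τ i (Π.sum (g ∘ Fin.suc))} {Π.sum (τ i ∘ g ∘ Fin.suc)} (τ-Π i≢0 (g ∘ Fin.suc)))

  -- The index 0 gives no automorphism and contributes the factor 1, so that the norm can be a
  -- product over all of `Fin n`.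
  conjugate : (Fin n → ℤ) → Fin n → Fin n → ℤ
  conjugate f i = if does (i Fin.≟ K.0#) then 1# else τ i f

  conjugate-0 : ∀ f → conjugate f K.0# ≡ 1#
  conjugate-0 f with K.0# Fin.≟ K.0#
  ... | yes _ = ≡.refl
  ... | no 0≢0 = contradiction ≡.refl 0≢0

  conjugate-≢0 : ∀ f {i} → i ≢ K.0# → conjugate f i ≡ τ i f
  conjugate-≢0 f {i} i≢0 with i Fin.≟ K.0#
  ... | yes i≡0 = contradiction i≡0 i≢0
  ... | no _ = ≡.refl

  norm : (Fin n → ℤ) → Fin n → ℤ
  norm f = Π.sum (conjugate f)

  -- The factors are permuted by τ j, since i ↦ j i permutes the nonzero indices. As a consequence a
  -- norm has the same coefficient at all nonzero exponents.
  norm-invariant : ∀ f {j} → j ≢ K.0# → τ j (norm f) ≈ norm f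
  norm-invariant f {j} j≢0 = trans {τ j (norm f)} {Π.sum (τ j ∘ conjugate f)} {norm f} (τ-Π j≢0 (conjugate f))
    (trans {Π.sum (τ j ∘ conjugate f)} {Π.sum (λ i → conjugate f (j K.* i))} {norm f}
      (Π.sum-cong-≋ {n} {τ j ∘ conjugate f} {λ i → conjugate f (j K.* i)} step) (K.Reindex.scale *-commutativeMonoid j≢0 (conjugate f)))
    where
    step : ∀ i → τ j (conjugate f i) ≈ conjugate f (j K.* i)
    step i a = case i Fin.≟ K.0# of λ where
      (yes ≡.refl) → ≡.trans (≡.cong-app (conjugate-0 f) (j K.* a)) (≡.trans (τ-1 j≢0 a)
        (≡.sym (≡.trans (≡.cong (λ k → conjugate f k a) (K.zeroʳ j)) (≡.cong-app (conjugate-0 f) a))))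
      (no i≢0) → ≡.trans (≡.cong-app (conjugate-≢0 f i≢0) (j K.* a)) (≡.trans (≡.cong f (K.solve 3 (λ i j a → i K.:* (j K.:* a) K.:= (j K.:* i) K.:* a) ≡.refl i j a))
        (≡.sym (≡.cong-app (conjugate-≢0 f (K.*-≢0 j≢0 i≢0)) a)))

  norm-const : ∀ f {a} → a ≢ K.0# → norm f a ≡ norm f K.1#
  norm-const f {a} a≢0 = ≡.trans (≡.cong (norm f) (≡.sym (K.*-identityʳ a))) (norm-invariant f a≢0 K.1#)

  -- The augmentation. As evaluation at the trivial character it is multiplicative, and it takes the
  -- same value on all n - 1 conjugates of f.
  degree : (Fin n → ℤ) → ℤ
  degree = Zr.sum

  private
    trivial : IsCharacter F ℤ.+-*-commutativeRing (λ _ → + 1)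
    trivial = record { χ-+ = λ _ _ → ≡.refl ; χ-0 = ≡.refl }
    module Aug = Eval ℤ.+-*-commutativeRing (λ _ → + 1) trivial
    module ℤΠ = FiniteSum ℤ.*-1-commutativeMonoid

    aug : ∀ f → Aug.ev f ≡ degree f
    aug f = Zr.sum-cong-≗ λ a → ≡.trans (ℤ.*-identityʳ _) (Zr-ι (f a))

  degree-norm : ∀ f → degree (norm f) ≡ degree f Zr.^ ℕ.pred n
  degree-norm f = begin
    degree (norm f)  ≡⟨ aug (norm f) ⟨
    Aug.ev (norm f)  ≡⟨ Aug.ev-Π (conjugate f) ⟩
    ℤΠ.sum (Aug.ev ∘ conjugate f)         ≡⟨ ℤΠ.sum-off K.0# (Aug.ev ∘ conjugate f) other ⟩
    Aug.ev (conjugate f K.0#) ℤ.* degree f Zr.^ ℕ.pred n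
      ≡⟨ ≡.cong (ℤ._* degree f Zr.^ ℕ.pred n) (≡.trans (≡.cong Aug.ev (conjugate-0 f)) Aug.ev-1) ⟩
    + 1 ℤ.* degree f Zr.^ ℕ.pred n        ≡⟨ ℤ.*-identityˡ _ ⟩
    degree f Zr.^ ℕ.pred n  ∎
    where
    open ≡.≡-Reasoning
    other : ∀ i → i ≢ K.0# → Aug.ev (conjugate f i) ≡ degree f
    other i i≢0 = ≡.trans (≡.cong Aug.ev (conjugate-≢0 f i≢0)) (≡.trans (aug (τ i f)) (K.Reindex.scale ℤ.+-0-commutativeMonoid i≢0 f))

  module NormEval {c ℓ} (B : CommutativeRing c ℓ)
    (χ : Fin n → CommutativeRing.Carrier B)
    (isCharacter : IsCharacter F B χ)
    (Σχ≈0 : CommutativeRing._≈_ B (Ring.sum B χ) (CommutativeRing.0# B)) where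
    private
      module B = Ring B
      module BΠ = FiniteSum B.*-commutativeMonoid
    open Eval B χ isCharacter public

    ev-const≈0 : ∀ z → ev (λ _ → z) B.≈ B.0#
    ev-const≈0 z = B.trans (ev-const z) (B.trans (B.*-congˡ Σχ≈0) (B.zeroʳ _))

    -- With coefficient N₀ at 0 and N₁ elsewhere, the norm is (N₀ - N₁) + N₁ Σ X^a, and Σ X^a has
    -- value 0.
    ev-norm : ∀ f → ev (norm f) B.≈ B.ι (norm f K.0# ℤ.- norm f K.1#)
    ev-norm f = B.trans (ev-cong {norm f} {λ a → d ℤ.* X K.0# a ℤ.+ norm f K.1#} split)
      (B.trans (ev-+ (λ a → d ℤ.* X K.0# a) (λ _ → norm f K.1#))
      (B.trans (B.+-cong (B.trans (ev-scale d 1#) (B.trans (B.*-congˡ ev-1) (B.*-identityʳ _))) (ev-const≈0 (norm f K.1#))) (B.+-identityʳ _)))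
      where
      d = norm f K.0# ℤ.- norm f K.1#
      split : ∀ a → norm f a ≡ d ℤ.* X K.0# a ℤ.+ norm f K.1#
      split a = case a Fin.≟ K.0# of λ where
        (yes ≡.refl) → ≡.trans (Zr.solve 2 (λ s t → s Zr.:= (s Zr.:- t) Zr.:* Zr.con (+ 1) Zr.:+ t) ≡.refl (norm f K.0#) (norm f K.1#))
          (≡.cong (λ z → d ℤ.* z ℤ.+ norm f K.1#) (≡.sym (X-same K.0#)))
        (no a≢0) → ≡.trans (norm-const f a≢0) (≡.trans (Zr.solve 2 (λ s t → t Zr.:= (s Zr.:- t) Zr.:* Zr.con (+ 0) Zr.:+ t) ≡.refl (norm f K.0#) (norm f K.1#))
          (≡.cong (λ z → d ℤ.* z ℤ.+ norm f K.1#) (≡.sym (X-other a≢0))))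

    ev-Π-norm : ∀ f → ev (norm f) B.≈ BΠ.sum (ev ∘ conjugate f)
    ev-Π-norm f = ev-Π (conjugate f)

    -- The conjugate with index 1 is f itself; the cofactor is the product of the remaining ones.
    norm-factor : ∀ f → ∃ λ g → ev (norm f) B.≈ ev f B.* ev g
    norm-factor f = Π.sum others , B.trans (ev-cong {norm f} {f * Π.sum others} factor) (ev-* f (Π.sum others))
      where
      others : Fin n → Fin n → ℤ
      others i = if does (i Fin.≟ K.1#) then 1# else conjugate f i
      here : Fin n → Fin n → ℤ
      here i = if does (i Fin.≟ K.1#) then f else 1#
      split : ∀ i → conjugate f i ≈ here i * others i
      split i with i Fin.≟ K.1#
      ... | yes ≡.refl = λ a → ≡.trans (≡.trans (≡.cong-app (conjugate-≢0 f K.1≢0) a) (≡.cong f (K.*-identityˡ a))) (≡.sym (*-identityʳ f a))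
      ... | no _ = λ a → ≡.sym (*-identityˡ (conjugate f i) a)
      here-1 : here K.1# ≡ f
      here-1 with K.1# Fin.≟ K.1#
      ... | yes _ = ≡.refl
      ... | no 1≢1 = contradiction ≡.refl 1≢1
      here-≢1 : ∀ i → i ≢ K.1# → here i ≈ 1#
      here-≢1 i i≢1 with i Fin.≟ K.1#
      ... | yes i≡1 = contradiction i≡1 i≢1
      ... | no _ = λ _ → ≡.refl
      factor : norm f ≈ f * Π.sum others
      factor = trans {norm f} {Π.sum (λ i → here i * others i)} {f * Π.sum others} (Π.sum-cong-≋ {n} {conjugate f} {λ i → here i * others i} split)
        (trans {Π.sum (λ i → here i * others i)} {Π.sum here * Π.sum others} {f * Π.sum others} (Π.∑-distrib-+ here others)
        (*-congʳ {Π.sum others} {Π.sum here} {f} (trans {Π.sum here} {here K.1#} {f} (Π.sum-single K.1# here here-≢1) (λ a → ≡.cong-app here-1 a))))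

-- Heyting fields containing ℚ

module RingHom {c₁ ℓ₁ c₂ ℓ₂} (A : CommutativeRing c₁ ℓ₁) (B : CommutativeRing c₂ ℓ₂)
  {h : CommutativeRing.Carrier A → CommutativeRing.Carrier B}
  (isHom : IsRingHomomorphism (CommutativeRing.rawRing A) (CommutativeRing.rawRing B) h) where
  private
    module A = Ring A
    module B = Ring B
  open IsRingHomomorphism isHom

  hom-ι : ∀ z → h (A.ι z) B.≈ B.ι z
  hom-ι (+ n) = pos n
    where
    pos : ∀ n → h (n A.· A.1#) B.≈ n B.· B.1#
    pos ℕ.zero = 0#-homo
    pos (suc n) = B.trans (⟦⟧-cong (A.1+× n A.1#)) (B.trans (+-homo _ _) (B.trans (B.+-cong 1#-homo (pos n)) (B.sym (B.1+× n B.1#))))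
  hom-ι -[1+ n ] = B.trans (-‿homo _) (B.-‿cong (hom-ι (+ suc n)))

  hom-^ : ∀ x k → h (x A.^ k) B.≈ h x B.^ k
  hom-^ x ℕ.zero = 1#-homo
  hom-^ x (suc k) = B.trans (*-homo _ _) (B.*-congˡ (hom-^ x k))

module ℚr = Ring (FieldOps.commutativeRing ℚ-field)

-- The computation takes place on unnormalised fractions, where addition involves no reduction by a
-- gcd.
ℚ-ι : ∀ z → toℚᵘ (ℚr.ι z) ℚᵘ.≃ mkℚᵘ z 0
ℚ-ι (+ n) = pos n
  where
  pos : ∀ n → toℚᵘ (n ℚr.· ℚr.1#) ℚᵘ.≃ mkℚᵘ (+ n) 0
  pos ℕ.zero = *≡* ≡.refl
  pos (suc n) = ℚᵘ.≃-trans (ℚ.toℚᵘ-cong (ℚr.1+× n ℚr.1#)) (ℚᵘ.≃-trans (ℚ.toℚᵘ-homo-+ ℚr.1# (n ℚr.· ℚr.1#))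
    (ℚᵘ.≃-trans (ℚᵘ.+-cong {toℚᵘ ℚr.1#} {mkℚᵘ (+ 1) 0} (*≡* ≡.refl) (pos n))
    (*≡* (Zr.solve 1 (λ s → (Zr.con (+ 1) Zr.:+ s Zr.:* Zr.con (+ 1)) Zr.:* Zr.con (+ 1) Zr.:= (Zr.con (+ 1) Zr.:+ s) Zr.:* Zr.con (+ 1)) ≡.refl (+ n)))))
ℚ-ι -[1+ n ] = ℚᵘ.≃-trans (ℚ.toℚᵘ-homo‿- (ℚr.ι (+ suc n))) (ℚᵘ.-‿cong (ℚ-ι (+ suc n)))

ℚ-fraction : ∀ r → r ℚr.* ℚr.ι (ℚ.↧ r) ≡ ℚr.ι (ℚ.↥ r)
ℚ-fraction r@(mkℚ n d _) = ℚ.toℚᵘ-injective (ℚᵘ.≃-trans (ℚ.toℚᵘ-homo-* r (ℚr.ι (+ suc d)))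
  (ℚᵘ.≃-trans (ℚᵘ.*-congˡ {mkℚᵘ n d} (ℚ-ι (+ suc d))) (ℚᵘ.≃-trans (*≡* (≡.trans (ℤ.*-identityʳ _) (≡.cong (n ℤ.*_) (≡.trans (≡.sym (ℤ.*-identityʳ (+ suc d))) (≡.sym (ℤ.pos-* (suc d) 1)))))) (ℚᵘ.≃-sym (ℚ-ι n)))))

ℚ-ι≡0 : ∀ {z} → ℚr.ι z ≡ ℚr.0# → z ≡ ℤ.0ℤ
ℚ-ι≡0 {z} eq with ℚᵘ.≃-trans (ℚᵘ.≃-sym (ℚ-ι z)) (ℚ.toℚᵘ-cong eq)
... | *≡* z*1≡0 = ≡.trans (≡.sym (ℤ.*-identityʳ z)) z*1≡0

ℚ-inverse : ∀ r → r ≢ ℚr.0# → ∃ λ s → s ℚr.* r ≡ ℚr.1#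
ℚ-inverse r r≢0 = ℚ.1/_ r {{ℚ.≢-nonZero r≢0}} , ℚ.*-inverseˡ r {{ℚ.≢-nonZero r≢0}}

module HeytingTheory {c ℓ₁ ℓ₂} (L : HeytingField c ℓ₁ ℓ₂) where
  open FieldOps L using (_#_) public
  open Ring (FieldOps.commutativeRing L) public
  private module P = HeytingProperties (HeytingField.heytingCommutativeRing L)
  open HeytingField L using (tight; #⇒invertible; #-irrefl; #-cotrans; #-sym)

  -- Apartness from 0 in the form of an explicit inverse of x itself, instead of an inverse of x -
  -- 0.
  Unit : Carrier → Set (c ⊔ ℓ₁)
  Unit x = ∃ λ v → v * x ≈ 1#

  unit⇒#0 : ∀ {x} → Unit x → x # 0#
  unit⇒#0 {x} (v , vx≈1) = P.invertibleˡ⇒# (v , trans (*-congˡ (P.x-0≈x x)) vx≈1)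

  #⇒unit : ∀ {x y} → x # y → Unit (x - y)
  #⇒unit x#y = let v , eq , _ = #⇒invertible x#y in v , eq

  #0⇒unit : ∀ {x} → x # 0# → Unit x
  #0⇒unit {x} x#0 = let v , eq = #⇒unit x#0 in v , trans (*-congˡ (sym (P.x-0≈x x))) eq

  1≉0 : ¬ 1# ≈ 0#
  1≉0 1≈0 = #-irrefl 1≈0 P.1#0

  unit-cancel : ∀ {s t} → Unit s → s * t ≈ 0# → t ≈ 0#
  unit-cancel {s} {t} (v , vs≈1) st≈0 = trans (sym (*-identityˡ t)) (trans (*-congʳ (sym vs≈1))
    (trans (*-assoc v s t) (trans (*-congˡ st≈0) (zeroʳ v))))

  -- If y were apart from 0, cancelling it would give x ≈ 0; tightness turns this impossibility into
  -- y ≈ 0.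
  domain : ∀ {x y} → x * y ≈ 0# → ¬ (x ≈ 0#) → y ≈ 0#
  domain {x} {y} xy≈0 x≉0 = proj₁ (tight y 0#) λ y#0 → x≉0 (unit-cancel (#0⇒unit y#0) (trans (*-comm y x) xy≈0))

  unit-* : ∀ {x y} → Unit x → Unit y → Unit (x * y)
  unit-* {x} {y} (v , vx≈1) (w , wy≈1) = v * w , trans (solve 4 (λ v w x y → (v :* w) :* (x :* y) := (v :* x) :* (w :* y)) refl v w x y)
    (trans (*-cong vx≈1 wy≈1) (*-identityˡ 1#))

  unit-factor : ∀ {x y} → Unit (x * y) → Unit x
  unit-factor {x} {y} (v , eq) = v * y , trans (solve 3 (λ v x y → (v :* y) :* x := v :* (x :* y)) refl v x y) eq

  unit-^ : ∀ {x} k → Unit x → Unit (x ^ k)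
  unit-^ ℕ.zero _ = 1# , *-identityˡ 1#
  unit-^ (suc k) u = unit-* u (unit-^ k u)

  unit-resp : ∀ {x y} → x ≈ y → Unit x → Unit y
  unit-resp x≈y (v , eq) = v , trans (*-congˡ (sym x≈y)) eq

  -- Cotransitivity finds the term without any test for equality: either the first term is apart
  -- from 0, or the whole sum is apart from the first term and the search continues in the tail.
  sum-#0 : ∀ {n} (f : Fin n → Carrier) → sum f # 0# → ∃ λ i → f i # 0#
  sum-#0 {ℕ.zero} f 0#0 = contradiction 0#0 (#-irrefl refl)
  sum-#0 {suc n} f s#0 = case #-cotrans s#0 (f zero) of λ where
      (inj₁ s#f) → let i , eq = sum-#0 (f ∘ Fin.suc) (unit⇒#0 (unit-resp tail (#⇒unit s#f))) in Fin.suc i , eq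
      (inj₂ f#0) → zero , f#0
    where
    tail : sum f - f zero ≈ sum (f ∘ Fin.suc)
    tail = solve 2 (λ s t → (s :+ t) :- s := t) refl (f zero) (sum (f ∘ Fin.suc))

  module SubfieldTheory {m} (K : Subfield L m) where
    open Subfield K

    ι∈ : ∀ z → Member (ι z)
    ι∈ (+ n) = pos n
      where
      pos : ∀ n → Member (n · 1#)
      pos ℕ.zero = 0∈
      pos (suc n) = resp (sym (1+× n 1#)) (+∈ 1∈ (pos n))
    ι∈ -[1+ n ] = -∈ (ι∈ (+ suc n))

    sum∈ : ∀ {n} (f : Fin n → Carrier) → (∀ i → Member (f i)) → Member (sum f)
    sum∈ {ℕ.zero} f f∈ = 0∈
    sum∈ {suc n} f f∈ = +∈ (f∈ zero) (sum∈ (f ∘ Fin.suc) (f∈ ∘ Fin.suc))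

    ^∈ : ∀ {x} k → Member x → Member (x ^ k)
    ^∈ ℕ.zero x∈ = 1∈
    ^∈ (suc k) x∈ = *∈ x∈ (^∈ k x∈)

    unit∈ : ∀ {x} ((v , _) : Unit x) → Member x → Member v
    unit∈ {x} (v , vx≈1) = ⁻¹∈ (trans (*-comm x v) vx≈1)

    divide∈ : ∀ {s x} → Unit s → Member s → Member (s * x) → Member x
    divide∈ {s} {x} u s∈ sx∈ = resp (trans (sym (*-assoc _ s x)) (trans (*-congʳ (proj₂ u)) (*-identityˡ x))) (*∈ (unit∈ u s∈) sx∈)

  module Rational (ext : Extension ℚ-field L) where
    open Extension ext
    private module H = RingHom (FieldOps.commutativeRing ℚ-field) (FieldOps.commutativeRing L) isRingHomomorphism

    embed-unit : ∀ {r} → r ≢ ℚr.0# → Unit (embed r)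
    embed-unit {r} r≢0 = let s , sr≡1 = ℚ-inverse r r≢0 in embed s , trans (sym (*-homo s r)) (trans (⟦⟧-cong sr≡1) 1#-homo)

    embed≈0 : ∀ {r} → embed r ≈ 0# → r ≡ ℚr.0#
    embed≈0 {r} er≈0 = case r ℚ.≟ ℚr.0# of λ where
      (yes r≡0) → r≡0
      (no r≢0) → let v , eq = embed-unit r≢0 in contradiction (trans (sym eq) (trans (*-congˡ er≈0) (zeroʳ v))) 1≉0

    ι-unit : ∀ {z} → z ≢ ℤ.0ℤ → Unit (ι z)
    ι-unit {z} z≢0 = unit-resp (H.hom-ι z) (embed-unit (z≢0 ∘ ℚ-ι≡0))

    ι≈0 : ∀ {z} → ι z ≈ 0# → z ≡ ℤ.0ℤ
    ι≈0 {z} ιz≈0 = ℚ-ι≡0 (embed≈0 (trans (H.hom-ι z) ιz≈0))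

    prime-unit : ∀ {p} → Prime p → Unit (ι (+ p))
    prime-unit pr = ι-unit λ p≡0 → contradiction (≡.subst Prime (ℤ.+-injective p≡0) pr) Prime.¬prime[0]

    pred-prime-unit : ∀ {p} → Prime p → Unit (ι (+ ℕ.pred p))
    pred-prime-unit {p} pr = ι-unit λ p-1≡0 → contradiction (≡.subst Prime (p≡1 (ℤ.+-injective p-1≡0)) pr) Prime.¬prime[1]
      where
      p≡1 : ℕ.pred p ≡ 0 → p ≡ 1
      p≡1 eq = ≡.trans (≡.sym (ℕ.suc-pred p {{Prime.prime⇒nonZero pr}})) (≡.cong suc eq)

    embed-fraction : ∀ r → ι (ℚ.↧ r) * embed r ≈ ι (ℚ.↥ r)
    embed-fraction r = trans (*-comm _ _) (trans (*-congˡ (sym (H.hom-ι (ℚ.↧ r)))) (trans (sym (*-homo r (ℚr.ι (ℚ.↧ r))))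
      (trans (⟦⟧-cong (ℚ-fraction r)) (H.hom-ι (ℚ.↥ r)))))

    rationals : Subfield L _
    rationals = record
      { Member = InBase
      ; resp = λ x≈y (r , eq) → r , trans eq x≈y
      ; 0∈ = ℚr.0# , 0#-homo
      ; 1∈ = ℚr.1# , 1#-homo
      ; +∈ = λ (r , eq) (s , eq′) → r ℚr.+ s , trans (+-homo r s) (+-cong eq eq′)
      ; -∈ = λ (r , eq) → ℚr.- r , trans (-‿homo r) (-‿cong eq)
      ; *∈ = λ (r , eq) (s , eq′) → r ℚr.* s , trans (*-homo r s) (*-cong eq eq′)
      ; ⁻¹∈ = inverse∈
      }
      where
      inverse∈ : ∀ {x y} → x * y ≈ 1# → InBase x → InBase y
      inverse∈ {x} {y} xy≈1 (r , er≈x) = s , trans (sym (*-identityʳ _)) (trans (*-congˡ (sym xy≈1)) (trans (sym (*-assoc _ x y))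
        (trans (*-congʳ (trans (*-congˡ (sym er≈x)) (trans (sym (*-homo s r)) (trans (⟦⟧-cong (proj₂ inv)) 1#-homo)))) (*-identityˡ y))))
        where
        r≢0 : r ≢ ℚr.0#
        r≢0 r≡0 = 1≉0 (trans (sym xy≈1) (trans (*-congʳ (trans (sym er≈x) (trans (⟦⟧-cong r≡0) 0#-homo))) (zeroˡ y)))
        inv = ℚ-inverse r r≢0
        s = proj₁ inv

    embed∈ : ∀ {m} (K : Subfield L m) r → Subfield.Member K (embed r)
    embed∈ K r = divide∈ (ι-unit {ℚ.↧ r} (λ ())) (ι∈ (ℚ.↧ r)) (Subfield.resp K (sym (embed-fraction r)) (ι∈ (ℚ.↥ r)))
      where open SubfieldTheory K

    -- The generator is obtained by completing the square.
    quadratic-generator : ∀ {m} (K : Subfield L m) → Basis ext (Subfield.Member K) 2 →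
                          ∃ λ α → Subfield.Member K α × ¬ InBase α × InBase (α * α)
    -- Here 1 = r b₀ + s b₁. If r ≠ 0, then b₀ can be exchanged for 1; otherwise s ≠ 0 and b₁ can.
    -- In `generator` the vector v is the one exchanged and w the one that stays.
    quadratic-generator K basis = case r ℚ.≟ ℚr.0# of λ where
        (no r≢0) → generator b₀ b₁ (member (Fin.suc zero)) r s one r≢0
          (λ x∈ → coord x∈ zero , coord x∈ (Fin.suc zero) , trans (sym (two _ _)) (spans x∈))
          (λ a b a′ b′ eq → let u = unique (pair a b) (pair a′ b′) (trans (two a b) (trans eq (sym (two a′ b′)))) in u zero , u (Fin.suc zero))
        (yes r≡0) → generator b₁ b₀ (member zero) s r (trans (+-comm _ _) one)
          (λ s≡0 → 1≉0 (trans (sym one) (trans (+-cong (trans (*-congʳ (trans (⟦⟧-cong r≡0) 0#-homo)) (zeroˡ _)) (trans (*-congʳ (trans (⟦⟧-cong s≡0) 0#-homo)) (zeroˡ _))) (+-identityˡ 0#))))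
          (λ x∈ → coord x∈ (Fin.suc zero) , coord x∈ zero , trans (+-comm _ _) (trans (sym (two _ _)) (spans x∈)))
          (λ a b a′ b′ eq → let u = unique (pair b a) (pair b′ a′) (trans (two b a) (trans (+-comm _ _) (trans eq (trans (+-comm _ _) (sym (two b′ a′)))))) in u (Fin.suc zero) , u zero)
      where
      open Basis basis
      open Subfield K using (1∈; +∈; -∈; *∈) renaming (Member to _∈K; resp to K-resp)
      module ℚs = Subfield rationals

      b₀ = vector zero
      b₁ = vector (Fin.suc zero)
      r = coord 1∈ zero
      s = coord 1∈ (Fin.suc zero)

      pair : ℚ → ℚ → Vector ℚ 2
      pair a b zero = a
      pair a b (Fin.suc zero) = b

      two : ∀ a b → combination (pair a b) vector ≈ embed a * b₀ + embed b * b₁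
      two a b = +-congˡ (+-identityʳ _)

      one : embed r * b₀ + embed s * b₁ ≈ 1#
      one = trans (+-congˡ (sym (+-identityʳ _))) (spans 1∈)

      generator : ∀ v w → w ∈K → ∀ r s → embed r * v + embed s * w ≈ 1# → r ≢ ℚr.0# →
                  (∀ {x} → x ∈K → ∃ λ a → ∃ λ b → embed a * v + embed b * w ≈ x) →
                  (∀ a b a′ b′ → embed a * v + embed b * w ≈ embed a′ * v + embed b′ * w → a ≡ a′ × b ≡ b′) →
                  ∃ λ α → α ∈K × ¬ InBase α × InBase (α * α)
      generator v w w∈ r s one r≢0 spans′ unique′ = w - h , +∈ w∈ (-∈ (embed∈ K ½B)) , irrational , square
        where
        ρ = proj₁ (ℚ-inverse r r≢0)
        eρ*er≈1 : embed ρ * embed r ≈ 1#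
        eρ*er≈1 = trans (sym (*-homo ρ r)) (trans (⟦⟧-cong (proj₂ (ℚ-inverse r r≢0))) 1#-homo)
        v≈ : v ≈ embed ρ * (1# - embed s * w)
        v≈ = trans (trans (sym (*-identityˡ v)) (*-congʳ (sym eρ*er≈1))) (trans (solve 4 (λ ρ r v t → ρ :* r :* v := ρ :* ((r :* v :+ t) :- t)) refl (embed ρ) (embed r) v (embed s * w))
          (*-congˡ (+-congʳ one)))
        w²∈ = spans′ (*∈ w∈ w∈)
        a = proj₁ w²∈
        b = proj₁ (proj₂ w²∈)
        -- Eliminating v from w² = a v + b w gives w² = A + B w. The shift h below is B/2, so that
        -- (w - h)² = A + h².
        A B : Carrier
        A = embed a * embed ρ
        B = embed b - A * embed s
        w² : w * w ≈ A + B * w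
        w² = trans (sym (proj₂ (proj₂ w²∈))) (trans (+-congʳ (*-congˡ v≈))
          (solve 5 (λ a ρ s b w → a :* (ρ :* (con (+ 1) :- s :* w)) :+ b :* w := a :* ρ :+ (b :- a :* ρ :* s) :* w) refl (embed a) (embed ρ) (embed s) (embed b) w))
        ½B = ℚ.½ ℚr.* (b ℚr.- a ℚr.* ρ ℚr.* s)
        h = embed ½B
        h+h : h + h ≈ B
        h+h = trans (sym (+-homo ½B ½B)) (trans (⟦⟧-cong (≡.trans (≡.sym (ℚr.distribʳ (b ℚr.- a ℚr.* ρ ℚr.* s) ℚ.½ ℚ.½)) (ℚr.*-identityˡ _)))
          (trans (+-homo b _) (+-congˡ (trans (-‿homo _) (-‿cong (trans (*-homo _ s) (*-congʳ (*-homo a ρ))))))))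
        square : InBase ((w - h) * (w - h))
        square = ℚs.resp (sym (begin
          (w - h) * (w - h)
            ≈⟨ solve 2 (λ w h → (w :- h) :* (w :- h) := w :* w :- (h :+ h) :* w :+ h :* h) refl w h ⟩
          w * w - (h + h) * w + h * h              ≈⟨ +-congʳ (+-cong w² (-‿cong (*-congʳ h+h))) ⟩
          (A + B * w) - B * w + h * h
            ≈⟨ solve 3 (λ A t u → (A :+ t) :- t :+ u := A :+ u) refl A (B * w) (h * h) ⟩
          A + h * h  ∎))
          (ℚs.+∈ (ℚs.*∈ (a , refl) (ρ , refl)) (ℚs.*∈ (½B , refl) (½B , refl)))
          where open SetoidReasoning setoid
        -- If w were a rational c, then multiplying the expression of 1 by c gives w = c r v + c s
        -- w. Uniqueness of coordinates yields c r = 0 and c s = 1, which contradicts r ≠ 0.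
        irrational : ¬ InBase (w - h)
        irrational w-h∈ = case ℚs.resp (solve 2 (λ w h → (w :- h) :+ h := w) refl w h) (ℚs.+∈ w-h∈ (½B , refl)) of λ (c , ec≈w) →
          let cr≡0 , cs≡1 = unique′ (c ℚr.* r) (c ℚr.* s) ℚr.0# ℚr.1# (begin
                embed (c ℚr.* r) * v + embed (c ℚr.* s) * w
                  ≈⟨ +-cong (*-congʳ (*-homo c r)) (*-congʳ (*-homo c s)) ⟩
                embed c * embed r * v + embed c * embed s * w
                  ≈⟨ solve 5 (λ c r v s w → c :* r :* v :+ c :* s :* w := c :* (r :* v :+ s :* w)) refl (embed c) (embed r) v (embed s) w ⟩
                embed c * (embed r * v + embed s * w)         ≈⟨ trans (*-congˡ one) (*-identityʳ _) ⟩
                embed c  ≈⟨ ec≈w ⟩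
                w
                  ≈⟨ trans (+-cong (trans (*-congʳ 0#-homo) (zeroˡ v)) (trans (*-congʳ 1#-homo) (*-identityˡ w))) (+-identityˡ w) ⟨
                embed ℚr.0# * v + embed ℚr.1# * w             ∎)
              c≡0 = ≡.trans (≡.sym (ℚr.*-identityʳ c)) (≡.trans (≡.cong (c ℚr.*_) (≡.sym (proj₂ (ℚ-inverse r r≢0))))
                (≡.trans (≡.cong (c ℚr.*_) (ℚr.*-comm ρ r)) (≡.trans (≡.sym (ℚr.*-assoc c r ρ)) (≡.trans (ℚr.*-congʳ cr≡0) (ℚr.zeroˡ ρ)))))
          in contradiction (≡.trans (≡.sym cs≡1) (≡.trans (ℚr.*-congʳ c≡0) (ℚr.zeroˡ s))) (λ ())
          where open SetoidReasoning setoid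

-- Linear independence of the values of a character

module Independence {c ℓ₁ ℓ₂} (L : HeytingField c ℓ₁ ℓ₂) (ext : Extension ℚ-field L) {p} (pr : Prime p) (F : FinField p)
  (χ : Fin p → HeytingField.Carrier L) (isCharacter : IsCharacter F (FieldOps.commutativeRing L) χ)
  {x} (χx#1 : HeytingField._#_ L (χ x) (HeytingField.1# L)) where
  private
    module K = FiniteFieldTheory F
    module B = HeytingTheory L
    module Char = Characteristic F
    u[χx-1]≈1 = proj₂ (B.#⇒unit χx#1)
  open IsCharacter isCharacter
  open B.Rational ext using (ι≈0; prime-unit)
  open Norm F
  open Character.Nontrivial F (FieldOps.commutativeRing L) χ isCharacter u[χx-1]≈1 using (Σχ≈0)
  open NormEval (FieldOps.commutativeRing L) χ isCharacter Σχ≈0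
  open GroupRing F

  private
    -- When a is k times 1, χ(a) - 1 = χ(1)^k - 1. Invertibility, known only at the given x, thereby
    -- passes to χ(1) - 1.
    χ[a]-1-multiple : ∀ a → ∃ λ s → χ a B.- B.1# B.≈ s B.* (χ K.1# B.- B.1#)
    χ[a]-1-multiple = Char.Fin-induction pr (λ a → ∃ λ s → χ a B.- B.1# B.≈ s B.* (χ K.1# B.- B.1#)) (B.0# , B.trans (B.x≈y⇒x-y≈0 χ-0) (B.sym (B.zeroˡ _)))
      λ a (s , eq) → χ a B.+ s , B.trans (B.+-congʳ (χ-+ a K.1#))
        (B.trans (B.solve 2 (λ s t → s B.:* t B.:- B.con (+ 1) B.:= s B.:* (t B.:- B.con (+ 1)) B.:+ (s B.:- B.con (+ 1))) B.refl (χ a) (χ K.1#))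
        (B.trans (B.+-congˡ eq) (B.sym (B.distribʳ _ _ _))))

    χ[1]-1-unit : B.Unit (χ K.1# B.- B.1#)
    χ[1]-1-unit = let s , eq = χ[a]-1-multiple x in
      _ , B.trans (B.*-assoc _ s _) (B.trans (B.*-congˡ (B.sym eq)) u[χx-1]≈1)

    p≢0 : ℤ.NonZero (+ p)
    p≢0 = Prime.prime⇒nonZero pr

    p-cancel : ∀ {s t} → + p ℤ.* s ≡ + p ℤ.* t → s ≡ t
    p-cancel = ℤ.*-cancelˡ-≡ (+ p) _ _ {{p≢0}}

  -- The norm of f is then m Σ_{a} X^a for an integer m, so that (Σ f(a))^(p-1) = p m.
  p∣degree : ∀ f → ev f B.≈ B.0# → p ∣ℤ degree f
  p∣degree f evf≈0 = prime-power-∣ℤ pr (degree f) (ℕ.pred p) (norm f K.0# , (begin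
    degree f Zr.^ ℕ.pred p  ≡⟨ degree-norm f ⟨
    degree (norm f)
      ≡⟨ Zr.sum-off-ι K.0# (norm f) (λ a a≢0 → ≡.trans (norm-const f a≢0) (≡.sym N0≡N1)) ⟩
    norm f K.0# ℤ.+ Zr.ι (+ ℕ.pred p) ℤ.* norm f K.0#
      ≡⟨ ≡.cong (λ z → norm f K.0# ℤ.+ z ℤ.* norm f K.0#) (Zr-ι (+ ℕ.pred p)) ⟩
    norm f K.0# ℤ.+ + ℕ.pred p ℤ.* norm f K.0#                 ≡⟨ ℤ.suc-* (+ ℕ.pred p) (norm f K.0#) ⟨
    ℤ.suc (+ ℕ.pred p) ℤ.* norm f K.0#
      ≡⟨ ≡.cong (λ k → + k ℤ.* norm f K.0#) (ℕ.suc-pred p {{Prime.prime⇒nonZero pr}}) ⟩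
    + p ℤ.* norm f K.0#  ∎))
    where
    open ≡.≡-Reasoning
    N0≡N1 : norm f K.0# ≡ norm f K.1#
    N0≡N1 = Zr.x-y≈0⇒x≈y (ι≈0 (B.trans (B.sym (ev-norm f)) (let g , eq = norm-factor f in
      B.trans eq (B.trans (B.*-congʳ evf≈0) (B.zeroˡ (ev g))))))

  private
    -- X - 1, whose value generates the prime above p in the cyclotomic integers. Multiplication by
    -- it takes differences of neighbouring coefficients.
    y : Fin p → ℤ
    y = X K.1# - 1#

    y-* : ∀ f a → (y * f) a ≡ f (a K.- K.1#) ℤ.- f a
    y-* f a = ≡.trans ([x-1]*y (X K.1#) f a)
      (≡.cong (ℤ._- f a) (X-✶ K.1# f a))

    -- The element Σ k X^k with k from 0 to p - 1. Its differences are -1 everywhere except for the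
    -- jump p - 1 at 0, so (X - 1) ω is constant up to a multiple of p at the exponent 0.
    ω : Fin p → ℤ
    ω a = + toℕ (proj₁ (Char.index pr a))

    ω-unique : ∀ {k} a → k ℕ.< p → K.ι (+ k) ≡ a → ω a ≡ + k
    ω-unique a k<p ιk≡a = let i , ιi≡a = Char.index pr a in
      ≡.cong +_ (Char.ι-injective pr (Fin.toℕ<n i) k<p (≡.trans ιi≡a (≡.sym ιk≡a)))

    yω : ∀ a → (y * ω) a ≡ + p ℤ.* X K.0# a ℤ.- + 1
    yω a = ≡.trans (y-* ω a) (go a (proj₁ (Char.index pr a)) (proj₂ (Char.index pr a)))
      where
      predecessor : ∀ k → K.ι (+ suc k) K.- K.1# ≡ K.ι (+ k)
      predecessor k = ≡.trans (≡.cong (K._- K.1#) (K.1+× k K.1#)) (K.solve 1 (λ s → (K.con (+ 1) K.:+ s) K.:- K.con (+ 1) K.:= s) ≡.refl (K.ι (+ k)))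
      go : ∀ a (i : Fin p) → K.ι (+ toℕ i) ≡ a → ω (a K.- K.1#) ℤ.- ω a ≡ + p ℤ.* X K.0# a ℤ.- + 1
      go a i ιi≡a with toℕ i | Fin.toℕ<n i
      -- The wrap-around: the predecessor of 0 has index p - 1.
      ... | ℕ.zero | 0<p rewrite ≡.sym ιi≡a = ≡.trans
            (≡.cong₂ ℤ._-_ (ω-unique {ℕ.pred p} (K.0# K.- K.1#) (ℕ.≤-reflexive suc-pred) (≡.trans (≡.sym (predecessor (ℕ.pred p))) (≡.cong (K._- K.1#) (≡.trans (≡.cong (K.ι ∘ +_) suc-pred) Char.ι-size))))
                           (ω-unique {0} K.0# 0<p ≡.refl))
            (≡.trans (≡.trans (ℤ.+-identityʳ _) (≡.sym (ℤ.m-n≡m⊖n (suc (ℕ.pred p)) 1)))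
              (≡.cong (ℤ._- + 1) (≡.trans (≡.cong +_ suc-pred) (≡.trans (≡.sym (ℤ.*-identityʳ (+ p))) (≡.cong (+ p ℤ.*_) (≡.sym (X-same K.0#)))))))
        where
        suc-pred : suc (ℕ.pred p) ≡ p
        suc-pred = ℕ.suc-pred p {{Prime.prime⇒nonZero pr}}
      ... | suc k | k<p = ≡.trans
            (≡.cong₂ ℤ._-_ (ω-unique {k} (a K.- K.1#) (ℕ.<-trans (ℕ.n<1+n k) k<p) (≡.trans (≡.sym (predecessor k)) (≡.cong (K._- K.1#) ιi≡a)))
                           (ω-unique {suc k} a k<p ιi≡a))
            (≡.trans (ℤ.m-n≡m⊖n k (suc k)) (≡.trans (back k) (≡.cong (ℤ._- + 1) (≡.sym (≡.trans (≡.cong (+ p ℤ.*_) (X-other {b = K.0#} λ a≡0 → Char.ι-≢0 pr (suc k) (ℕ.s≤s ℕ.z≤n) k<p (≡.trans ιi≡a a≡0))) (ℤ.*-zeroʳ (+ p)))))))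
        where
        back : ∀ k → k ℤ.⊖ suc k ≡ ℤ.- + 1
        back ℕ.zero = ≡.refl
        back (suc k) = ≡.trans (ℤ.[1+m]⊖[1+n]≡m⊖n k (suc k)) (back k)

    shift-back : ∀ a → (a K.+ K.1#) K.- K.1# ≡ a
    shift-back a = K.solve 1 (λ a → (a K.:+ K.con (+ 1)) K.:- K.con (+ 1) K.:= a) ≡.refl a

    abstract
      congruent-steps : ∀ (f : Fin p → ℤ) → (∀ a → ∃ λ z → f (a K.- K.1#) ℤ.- f a ≡ + p ℤ.* z) → ∀ a → ∃ λ z → f a ≡ f K.0# ℤ.+ + p ℤ.* z
      congruent-steps f step = Char.Fin-induction pr (λ a → ∃ λ z → f a ≡ f K.0# ℤ.+ + p ℤ.* z) (ℤ.0ℤ , ≡.sym (≡.trans (≡.cong (λ z → f K.0# ℤ.+ z) (ℤ.*-zeroʳ (+ p))) (ℤ.+-identityʳ _)))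
        λ a (z , eq) → let w , eq′ = step (a K.+ K.1#) in z ℤ.- w ,
          (begin
            f (a K.+ K.1#)
              ≡⟨ Zr.solve 2 (λ s t → s Zr.:= t Zr.:- (t Zr.:- s)) ≡.refl (f (a K.+ K.1#)) (f a) ⟩
            f a ℤ.- (f a ℤ.- f (a K.+ K.1#))
              ≡⟨ ≡.cong₂ ℤ._-_ eq (≡.trans (≡.cong (λ b → f b ℤ.- f (a K.+ K.1#)) (≡.sym (shift-back a))) eq′) ⟩
            (f K.0# ℤ.+ + p ℤ.* z) ℤ.- + p ℤ.* w
              ≡⟨ Zr.solve 4 (λ s p z w → (s Zr.:+ p Zr.:* z) Zr.:- p Zr.:* w Zr.:= s Zr.:+ p Zr.:* (z Zr.:- w)) ≡.refl (f K.0#) (+ p) z w ⟩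
            f K.0# ℤ.+ + p ℤ.* (z ℤ.- w)  ∎)
        where open ≡.≡-Reasoning

    abstract
      -- p = (X − 1) ω + Σ_a X^a, so the quotient of f by X − 1 is ω f / p up to a constant.
      divide-y : ∀ (f : Fin p → ℤ) → ev f B.≈ B.0# → ∃ λ g → ∃ λ m → ev g B.≈ B.0# × (∀ a → f a ≡ (y * g) a ℤ.+ m)
      divide-y f evf≈0 = g , m , evg≈0 , f≡
        where
        m : ℤ
        m = proj₁ (p∣degree f evf≈0)
        deg≡ : degree f ≡ + p ℤ.* m
        deg≡ = proj₂ (p∣degree f evf≈0)
        h : Fin p → ℤ
        h = ω * f
        -- The product of Σ X^b and f has all its coefficients equal to the augmentation p m of f,
        -- hence (X - 1) ω f = p (f - m).
        y*h : ∀ a → h (a K.- K.1#) ℤ.- h a ≡ + p ℤ.* (f a ℤ.- m)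
        y*h a = begin
          h (a K.- K.1#) ℤ.- h a  ≡⟨ y-* h a ⟨
          (y * h) a  ≡⟨ *-assoc y ω f a ⟨
          (y * ω * f) a
            ≡⟨ Zr.sum-cong-≗ (λ b → ≡.cong (ℤ._* f (a K.- b)) (yω b)) ⟩
          Zr.sum (λ b → (+ p ℤ.* X K.0# b ℤ.- + 1) ℤ.* f (a K.- b))
            ≡⟨ Zr.sum-cong-≗ (λ b → Zr.solve 3 (λ p s t → (p Zr.:* s Zr.:- Zr.con (+ 1)) Zr.:* t Zr.:= p Zr.:* (s Zr.:* t) Zr.:+ (Zr.:- t)) ≡.refl (+ p) (X K.0# b) (f (a K.- b))) ⟩
          Zr.sum (λ b → + p ℤ.* (X K.0# b ℤ.* f (a K.- b)) ℤ.+ ℤ.- f (a K.- b))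
            ≡⟨ Zr.∑-distrib-+ (λ b → + p ℤ.* (X K.0# b ℤ.* f (a K.- b))) (λ b → ℤ.- f (a K.- b)) ⟩
          Zr.sum (λ b → + p ℤ.* (X K.0# b ℤ.* f (a K.- b))) ℤ.+ Zr.sum (λ b → ℤ.- f (a K.- b))
            ≡⟨ ≡.cong₂ ℤ._+_
               (≡.trans (≡.sym (Zr.*-distribˡ-sum (+ p) (λ b → X K.0# b ℤ.* f (a K.- b)))) (≡.cong (+ p ℤ.*_) (*-identityˡ f a)))
               (≡.trans (Zr.sum-neg (λ b → f (a K.- b))) (≡.cong ℤ.-_ (≡.trans (K.Reindex.reflect ℤ.+-0-commutativeMonoid a f) deg≡))) ⟩
          + p ℤ.* f a ℤ.- + p ℤ.* m
            ≡⟨ Zr.solve 3 (λ p s t → p Zr.:* s Zr.:- p Zr.:* t Zr.:= p Zr.:* (s Zr.:- t)) ≡.refl (+ p) (f a) m ⟩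
          + p ℤ.* (f a ℤ.- m)  ∎
          where open ≡.≡-Reasoning
        quotients : ∀ a → ∃ λ z → h a ≡ h K.0# ℤ.+ + p ℤ.* z
        quotients = congruent-steps h (λ a → f a ℤ.- m , y*h a)
        g : Fin p → ℤ
        g a = proj₁ (quotients a)
        f≡ : ∀ a → f a ≡ (y * g) a ℤ.+ m
        f≡ a = ≡.trans (Zr.solve 2 (λ s m → s Zr.:= (s Zr.:- m) Zr.:+ m) ≡.refl (f a) m) (≡.cong (ℤ._+ m) (≡.trans (p-cancel (begin
          + p ℤ.* (f a ℤ.- m)               ≡⟨ y*h a ⟨
          h (a K.- K.1#) ℤ.- h a
            ≡⟨ ≡.cong₂ ℤ._-_ (proj₂ (quotients (a K.- K.1#))) (proj₂ (quotients a)) ⟩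
          (h K.0# ℤ.+ + p ℤ.* g (a K.- K.1#)) ℤ.- (h K.0# ℤ.+ + p ℤ.* g a)
            ≡⟨ Zr.solve 4 (λ h p s t → (h Zr.:+ p Zr.:* s) Zr.:- (h Zr.:+ p Zr.:* t) Zr.:= p Zr.:* (s Zr.:- t)) ≡.refl (h K.0#) (+ p) (g (a K.- K.1#)) (g a) ⟩
          + p ℤ.* (g (a K.- K.1#) ℤ.- g a)  ∎)) (≡.sym (y-* g a))))
          where open ≡.≡-Reasoning
        evg≈0 : ev g B.≈ B.0#
        evg≈0 = B.unit-cancel χ[1]-1-unit (begin
          (χ K.1# B.- B.1#) B.* ev g
            ≈⟨ B.*-congʳ (B.+-cong (ev-X K.1#) (B.trans (ev-neg 1#) (B.-‿cong ev-1))) ⟨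
          (ev (X K.1#) B.+ ev (- 1#)) B.* ev g ≈⟨ B.*-congʳ (ev-+ (X K.1#) (- 1#)) ⟨
          ev y B.* ev g                 ≈⟨ ev-* y g ⟨
          ev (y * g)                    ≈⟨ B.trans (B.+-congˡ (ev-const≈0 m)) (B.+-identityʳ _) ⟨
          ev (y * g) B.+ ev (λ _ → m)   ≈⟨ ev-+ (y * g) (λ _ → m) ⟨
          ev (y * g + (λ _ → m))        ≈⟨ ev-cong {f} {y * g + (λ _ → m)} f≡ ⟨
          ev f  ≈⟨ evf≈0 ⟩
          B.0#  ∎)
          where open SetoidReasoning B.setoid

    abstract
      -- A constant is annihilated by X - 1, so the constants from the inner divisions disappear and
      -- only the outermost one survives.
      divide-y^ : ∀ k (f : Fin p → ℤ) → ev f B.≈ B.0# → ∃ λ g → ∃ λ m → (∀ a → f a ≡ (y ^ k * g) a ℤ.+ m)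
      divide-y^ ℕ.zero f evf≈0 = f , ℤ.0ℤ , λ a → ≡.sym (≡.trans (ℤ.+-identityʳ _) (*-identityˡ f a))
      divide-y^ (suc k) f evf≈0 =
        let g , m , evg≈0 , f≡ = divide-y f evf≈0
            g′ , m′ , g≡ = divide-y^ k g evg≈0
        in g′ , m , λ a → ≡.trans (f≡ a) (≡.cong (ℤ._+ m) (begin
          (y * g) a  ≡⟨ y-* g a ⟩
          g (a K.- K.1#) ℤ.- g a  ≡⟨ ≡.cong₂ ℤ._-_ (g≡ (a K.- K.1#)) (g≡ a) ⟩
          ((y ^ k * g′) (a K.- K.1#) ℤ.+ m′) ℤ.- ((y ^ k * g′) a ℤ.+ m′)
            ≡⟨ Zr.solve 3 (λ s t m → (s Zr.:+ m) Zr.:- (t Zr.:+ m) Zr.:= s Zr.:- t) ≡.refl ((y ^ k * g′) (a K.- K.1#)) ((y ^ k * g′) a) m′ ⟩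
          (y ^ k * g′) (a K.- K.1#) ℤ.- (y ^ k * g′) a ≡⟨ y-* (y ^ k * g′) a ⟨
          (y * (y ^ k * g′)) a  ≡⟨ *-assoc y (y ^ k) g′ a ⟨
          (y ^ suc k * g′) a  ∎))
        where open ≡.≡-Reasoning

    X-^ : ∀ k → X K.1# ^ k ≈ X (K.ι (+ k))
    X-^ ℕ.zero = λ _ → ≡.refl
    X-^ (suc k) a = ≡.trans (*-congˡ {X K.1#} {X K.1# ^ k} {X (K.ι (+ k))} (X-^ k) a) (≡.trans (X-+ K.1# (K.ι (+ k)) a) (≡.cong (λ b → X b a) (≡.sym (K.1+× k K.1#))))

    ι-*-at : ∀ n f a → (ι (+ n) * f) a ≡ + n ℤ.* f a
    ι-*-at n f a = ≡.trans (≡.sym (·-ι n f a)) (go n)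
      where
      go : ∀ n → (n · f) a ≡ + n ℤ.* f a
      go ℕ.zero = ≡.sym (ℤ.*-zeroˡ (f a))
      go (suc n) = ≡.trans (1+× n f a) (≡.trans (≡.cong (λ z → f a ℤ.+ z) (go n)) (≡.sym (ℤ.suc-* (+ n) (f a))))

    abstract
      -- In the group ring X^p = 1. Comparing this with (1 + y)^p = 1 + y^p + p v shows that y^p =
      -- -p v.
      y^p : ∃ λ (v : Fin p → ℤ) → ∀ (g : Fin p → ℤ) a → (y ^ p * g) a ≡ + p ℤ.* (v * g) a
      y^p = - v , λ g a → ≡.trans (chain g a) (ι-*-at p (- v * g) a)
        where
        v : Fin p → ℤ
        v = proj₁ (Frobenius.[1+y]^p commutativeRing pr y)
        eq : (1# + y) ^ p ≈ 1# + y ^ p + ι (+ p) * v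
        eq = proj₂ (Frobenius.[1+y]^p commutativeRing pr y)
        1+y : 1# + y ≈ X K.1#
        1+y = 1+[x-1] (X K.1#)
        power : (1# + y) ^ p ≈ 1#
        power a = ≡.trans (^-congˡ p {1# + y} {X K.1#} 1+y a) (≡.trans (X-^ p a) (≡.cong (λ b → X b a) Char.ι-size))
        y^p≈ : y ^ p ≈ ι (+ p) * - v
        y^p≈ a = ≡.trans (x≈[1+x+yz]-1-yz (y ^ p) (ι (+ p)) v a)
          (≡.trans (≡.cong (λ z → z ℤ.- 1# a ℤ.+ (ι (+ p) * - v) a) (≡.trans (≡.sym (eq a)) (power a)))
          (≡.trans (≡.cong (ℤ._+ (ι (+ p) * - v) a) (ℤ.+-inverseʳ (1# a))) (ℤ.+-identityˡ _)))
        chain : ∀ g → y ^ p * g ≈ ι (+ p) * (- v * g)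
        chain g a = ≡.trans (*-congʳ {g} {y ^ p} {ι (+ p) * - v} y^p≈ a) (*-assoc (ι (+ p)) (- v) g a)

    -- Up to a constant, f is y^(p - 1) g. One more factor y takes the differences of the
    -- coefficients of f and turns the power into y^p, a multiple of p.
    congruent : ∀ (f : Fin p → ℤ) → ev f B.≈ B.0# → ∀ a → ∃ λ z → f a ≡ f K.0# ℤ.+ + p ℤ.* z
    congruent f evf≈0 = congruent-steps f λ a → (v * g) a , (begin
      f (a K.- K.1#) ℤ.- f a  ≡⟨ ≡.cong₂ ℤ._-_ (f≡ (a K.- K.1#)) (f≡ a) ⟩
      (h (a K.- K.1#) ℤ.+ m) ℤ.- (h a ℤ.+ m)
        ≡⟨ Zr.solve 3 (λ s t m → (s Zr.:+ m) Zr.:- (t Zr.:+ m) Zr.:= s Zr.:- t) ≡.refl (h (a K.- K.1#)) (h a) m ⟩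
      h (a K.- K.1#) ℤ.- h a  ≡⟨ y-* h a ⟨
      (y * h) a  ≡⟨ *-assoc y (y ^ ℕ.pred p) g a ⟨
      (y ^ suc (ℕ.pred p) * g) a
        ≡⟨ ≡.cong (λ k → (y ^ k * g) a) (ℕ.suc-pred p {{Prime.prime⇒nonZero pr}}) ⟩
      (y ^ p * g) a  ≡⟨ y^p≡ g a ⟩
      + p ℤ.* (v * g) a  ∎)
      where
      open ≡.≡-Reasoning
      division = divide-y^ (ℕ.pred p) f evf≈0
      g = proj₁ division
      m = proj₁ (proj₂ division)
      f≡ = proj₂ (proj₂ division)
      v = proj₁ y^p
      y^p≡ = proj₂ y^p
      h = y ^ ℕ.pred p * g

    -- As f(0) = 0, all coefficients are divisible by p, and the quotient satisfies the same
    -- hypotheses. Since p ≥ 2, the bound M strictly decreases.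
    descent : ∀ M f → f K.0# ≡ ℤ.0ℤ → (∀ a → ℤ.∣ f a ∣ ≤ M) → ev f B.≈ B.0# → ∀ a → f a ≡ ℤ.0ℤ
    descent ℕ.zero f f0≡0 bound evf≈0 a = ℤ.∣i∣≡0⇒i≡0 (ℕ.n≤0⇒n≡0 (bound a))
    descent (suc M) f f0≡0 bound evf≈0 a = ≡.trans (f≡ a) (≡.trans (≡.cong (+ p ℤ.*_) (descent M g g0≡0 g-bound evg≈0 a)) (ℤ.*-zeroʳ (+ p)))
      where
      g : Fin p → ℤ
      g a = proj₁ (congruent f evf≈0 a)
      f≡ : ∀ a → f a ≡ + p ℤ.* g a
      f≡ a = ≡.trans (proj₂ (congruent f evf≈0 a)) (≡.trans (≡.cong (ℤ._+ + p ℤ.* g a) f0≡0) (ℤ.+-identityˡ _))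
      g0≡0 : g K.0# ≡ ℤ.0ℤ
      g0≡0 = p-cancel (≡.trans (≡.sym (f≡ K.0#)) (≡.trans f0≡0 (≡.sym (ℤ.*-zeroʳ (+ p)))))
      2≤p : 2 ≤ p
      2≤p = ℕ.nonTrivial⇒n>1 p {{Prime.prime⇒nonTrivial pr}}
      g-bound : ∀ a → ℤ.∣ g a ∣ ≤ M
      g-bound a = half ℤ.∣ g a ∣ (ℕ.≤-trans (ℕ.*-monoˡ-≤ ℤ.∣ g a ∣ 2≤p) (ℕ.≤-trans (ℕ.≤-reflexive (≡.sym (≡.trans (≡.cong ℤ.∣_∣ (f≡ a)) (ℤ.abs-* (+ p) (g a))))) (bound a)))
        where
        half : ∀ k → 2 *ℕ k ≤ suc M → k ≤ M
        half ℕ.zero _ = ℕ.z≤n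
        half (suc k) (ℕ.s≤s le) = ℕ.≤-trans (ℕ.m≤n+m (suc k) k) (ℕ.≤-trans (ℕ.≤-reflexive (≡.cong (λ t → k ℕ.+ suc t) (≡.sym (ℕ.+-identityʳ k)))) le)
      evg≈0 : ev g B.≈ B.0#
      evg≈0 = B.unit-cancel (prime-unit pr) (B.trans (B.sym (ev-scale (+ p) g)) (B.trans (B.sym (ev-cong {f} {λ a → + p ℤ.* g a} f≡)) evf≈0))

  -- Subtracting the constant f(0) leaves the value unchanged because constants have value 0. The
  -- descent then starts from the sum of the absolute values of the coefficients.
  ev≈0⇒const : ∀ f → ev f B.≈ B.0# → ∀ a → f a ≡ f K.0#
  ev≈0⇒const f evf≈0 a = Zr.x-y≈0⇒x≈y (descent (ℕΣ.sum (λ a → ℤ.∣ g a ∣)) g (ℤ.+-inverseʳ (f K.0#)) (term≤sum (λ a → ℤ.∣ g a ∣)) evg≈0 a)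
    where
    g : Fin p → ℤ
    g a = f a ℤ.- f K.0#
    evg≈0 : ev g B.≈ B.0#
    evg≈0 = B.trans (ev-+ f (λ _ → ℤ.- f K.0#)) (B.trans (B.+-cong evf≈0 (ev-const≈0 (ℤ.- f K.0#))) (B.+-identityˡ B.0#))
    term≤sum : ∀ {m} (f : Vector ℕ m) i → f i ≤ ℕΣ.sum f
    term≤sum f zero = ℕ.m≤m+n _ _
    term≤sum f (Fin.suc i) = ℕ.≤-trans (term≤sum (f ∘ Fin.suc) i) (ℕ.m≤n+m _ (f zero))

-- Quadratic subfields of the cyclotomic field

module CyclotomicField {c ℓ₁ ℓ₂} (L : HeytingField c ℓ₁ ℓ₂) (ext : Extension ℚ-field L) {p} (pr : Prime p) (F : FinField p)
  (χ : Fin p → HeytingField.Carrier L) (isCharacter : IsCharacter F (FieldOps.commutativeRing L) χ)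
  {x} (χx#1 : HeytingField._#_ L (χ x) (HeytingField.1# L)) where
  private
    module K = FiniteFieldTheory F
    module Char = Characteristic F
    module R = GroupRing F
  open HeytingTheory L
  open Rational ext
  open Norm F using (τ; conjugate; conjugate-0; conjugate-≢0; norm)
  open IsCharacter isCharacter
  open Character F (FieldOps.commutativeRing L) χ isCharacter public
  open Nontrivial (proj₂ (#⇒unit χx#1)) public
  open Norm.NormEval F (FieldOps.commutativeRing L) χ isCharacter Σχ≈0
  open Independence L ext pr F χ isCharacter χx#1 using (ev≈0⇒const)
  open SetoidReasoning setoid

  const⇒ev≈0 : ∀ {f} → (∀ a → f a ≡ f K.0#) → ev f ≈ 0#
  const⇒ev≈0 {f} const = trans (ev-cong {f} {λ _ → f K.0#} const) (ev-const≈0 (f K.0#))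

  -- Independence reduces a question about L to a comparison of integers.
  ev≈0? : ∀ f → Dec (ev f ≈ 0#)
  ev≈0? f = case Fin.all? (λ a → f a ℤ.≟ f K.0#) of λ where
    (yes const) → yes (const⇒ev≈0 const)
    (no ¬const) → no (¬const ∘ ev≈0⇒const f)

  geometric : ∀ η n → (η - 1#) * sum {n} (λ k → η ^ toℕ k) ≈ η ^ n - 1#
  geometric η ℕ.zero = trans (zeroʳ _) (sym (-‿inverseʳ 1#))
  geometric η (suc n) = begin
    (η - 1#) * (1# + sum {n} (λ k → η * η ^ toℕ k))  ≈⟨ *-congˡ (+-congˡ (*-distribˡ-sum η (λ (k : Fin n) → η ^ toℕ k))) ⟨
    (η - 1#) * (1# + η * S)
      ≈⟨ solve 2 (λ η S → (η :- con (+ 1)) :* (con (+ 1) :+ η :* S) := η :- con (+ 1) :+ η :* ((η :- con (+ 1)) :* S)) refl η S ⟩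
    η - 1# + η * ((η - 1#) * S)  ≈⟨ +-congˡ (*-congˡ (geometric η n)) ⟩
    η - 1# + η * (η ^ n - 1#)
      ≈⟨ solve 2 (λ η t → η :- con (+ 1) :+ η :* (t :- con (+ 1)) := η :* t :- con (+ 1)) refl η (η ^ n) ⟩
    η ^ suc n - 1#  ∎
    where S = sum {n} (λ k → η ^ toℕ k)

  χ-^ : ∀ a k → χ a ^ k ≈ χ (K.ι (+ k) K.* a)
  χ-^ a ℕ.zero = trans (sym χ-0) (χ-cong (≡.sym (K.zeroˡ a)))
  χ-^ a (suc k) = trans (*-congˡ (χ-^ a k)) (trans (sym (χ-+ a _)) (χ-cong (≡.trans
    (K.solve 2 (λ a s → a K.:+ s K.:* a K.:= (K.con (+ 1) K.:+ s) K.:* a) ≡.refl a (K.ι (+ k))) (≡.cong (K._* a) (≡.sym (K.1+× k K.1#))))))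

  -- Orthogonality gives Σ_a Σ_k (ζ χ(-a))^k = p, so some inner sum is apart from 0.
  root-of-unity⇒value : ∀ {ζ} → ζ ^ p ≈ 1# → ∃ λ a → χ a ≈ ζ
  root-of-unity⇒value {ζ} ζ^p≈1 = a , (begin
    χ a  ≈⟨ *-identityʳ _ ⟨
    χ a * 1#                ≈⟨ *-congˡ (x-y≈0⇒x≈y η-1≈0) ⟨
    χ a * (ζ * χ (K.- a))
      ≈⟨ solve 3 (λ s ζ t → s :* (ζ :* t) := ζ :* (s :* t)) refl (χ a) ζ (χ (K.- a)) ⟩
    ζ * (χ a * χ (K.- a))
      ≈⟨ *-congˡ (trans (sym (χ-+ a (K.- a))) (trans (χ-cong (K.-‿inverseʳ a)) χ-0)) ⟩
    ζ * 1#                  ≈⟨ *-identityʳ ζ ⟩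
    ζ  ∎)
    where
    η : Fin p → Carrier
    η a = ζ * χ (K.- a)
    S : Fin p → Carrier
    S a = sum {p} (λ k → η a ^ toℕ k)
    η^ : ∀ k a → η a ^ k ≈ ζ ^ k * χ (K.- K.ι (+ k) K.* a)
    η^ k a = trans (^-distrib-* ζ (χ (K.- a)) k) (*-congˡ (trans (χ-^ (K.- a) k) (χ-cong
      (K.solve 2 (λ s a → s K.:* (K.:- a) K.:= (K.:- s) K.:* a) ≡.refl (K.ι (+ k)) a))))
    0<p : 0 ℕ.< p
    0<p = ℕ.>-nonZero⁻¹ p {{Prime.prime⇒nonZero pr}}
    k₀ : Fin p
    k₀ = fromℕ< 0<p
    total : sum S ≈ ι (+ p)
    total = begin
      sum (λ a → sum {p} λ k → η a ^ toℕ k)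
        ≈⟨ ∑-comm (λ a (k : Fin p) → η a ^ toℕ k) ⟩
      sum {p} (λ k → sum λ a → η a ^ toℕ k)
        ≈⟨ sum-cong-≋ {p} (λ k → inner (toℕ k)) ⟩
      sum {p} (λ k → ζ ^ toℕ k * sum λ a → χ (K.- K.ι (+ toℕ k) K.* a))
        ≈⟨ sum-single k₀ (λ k → ζ ^ toℕ k * sum λ a → χ (K.- K.ι (+ toℕ k) K.* a)) vanish ⟩
      ζ ^ toℕ k₀ * sum (λ a → χ (K.- K.ι (+ toℕ k₀) K.* a))
        ≈⟨ reflexive (≡.cong (λ k → ζ ^ k * sum λ a → χ (K.- K.ι (+ k) K.* a)) (Fin.toℕ-fromℕ< 0<p)) ⟩
      1# * sum (λ a → χ (K.- K.0# K.* a))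
        ≈⟨ trans (*-identityˡ _) (trans (sum-cong-≋ λ a → χ-cong (≡.cong (λ b → b K.* a) K.-0#≈0#)) orthogonality-0) ⟩
      ι (+ p)  ∎
      where
      inner : ∀ k → sum (λ a → η a ^ k) ≈ ζ ^ k * sum (λ a → χ (K.- K.ι (+ k) K.* a))
      inner k = trans (sum-cong-≋ (η^ k)) (sym (*-distribˡ-sum (ζ ^ k) (λ a → χ (K.- K.ι (+ k) K.* a))))
      vanish : ∀ k → k ≢ k₀ → ζ ^ toℕ k * sum (λ a → χ (K.- K.ι (+ toℕ k) K.* a)) ≈ 0#
      vanish k k≢k₀ = trans (*-congˡ (orthogonality λ eq → Char.ι-≢0 pr (toℕ k)
          (ℕ.n≢0⇒n>0 λ k≡0 → k≢k₀ (Fin.toℕ-injective (≡.trans k≡0 (≡.sym (Fin.toℕ-fromℕ< 0<p))))) (Fin.toℕ<n k)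
          (≡.trans (≡.sym (K.-‿involutive _)) (≡.trans (≡.cong K.-_ eq) K.-0#≈0#)))) (zeroʳ _)
    nonzero-term = sum-#0 S (unit⇒#0 (unit-resp (sym total) (prime-unit pr)))
    a = proj₁ nonzero-term
    -- Since η(a)^p = 1, the geometric sum gives (η(a) - 1) S(a) = 0, and S(a) is invertible.
    η-1≈0 : η a - 1# ≈ 0#
    η-1≈0 = unit-cancel (#0⇒unit (proj₂ nonzero-term)) (trans (*-comm _ _) (trans (geometric (η a) p)
      (x≈y⇒x-y≈0 (trans (η^ p a) (trans (*-cong ζ^p≈1 (trans (χ-cong (≡.trans (≡.cong (λ s → K.- s K.* a) Char.ι-size)
        (K.solve 1 (λ a → (K.:- K.con (+ 0)) K.:* a K.:= K.con (+ 0)) ≡.refl a))) χ-0)) (*-identityˡ 1#))))))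

  -- Elements of ℚ(ζ) are given a single integer denominator, so that the numerators stay in the
  -- integral group ring, where independence applies.
  Fraction : Carrier → Set ℓ₁
  Fraction y = ∃ λ n → ∃ λ f → n ≢ ℤ.0ℤ × ι n * y ≈ ev f

  *-≢0ℤ : ∀ {m n} → m ≢ ℤ.0ℤ → n ≢ ℤ.0ℤ → m ℤ.* n ≢ ℤ.0ℤ
  *-≢0ℤ {m} m≢0 n≢0 mn≡0 = [ m≢0 , n≢0 ]′ (ℤ.i*j≡0⇒i≡0∨j≡0 m mn≡0)

  -- The coefficient functions of value 0 are the constant ones, and being constant is insensitive
  -- to a permutation of the exponents.
  ev-τ≈0 : ∀ f {i} → i ≢ K.0# → ev (τ i f) ≈ 0# → ev f ≈ 0#
  ev-τ≈0 f {i} i≢0 eq = let j , ji≡1 = K.inverse i i≢0 in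
    const⇒ev≈0 λ a → ≡.trans (≡.cong f (≡.sym (ija ji≡1 a))) (≡.trans (ev≈0⇒const (τ i f) eq (j K.* a)) (≡.cong f (K.zeroʳ i)))
    where
    ija : ∀ {j} → j K.* i ≡ K.1# → ∀ a → i K.* (j K.* a) ≡ a
    ija {j} ji≡1 a = ≡.trans (K.solve 3 (λ i j a → i K.:* (j K.:* a) K.:= j K.:* i K.:* a) ≡.refl i j a) (≡.trans (≡.cong (K._* a) ji≡1) (K.*-identityˡ a))

  norm-≉0 : ∀ f → ¬ ev f ≈ 0# → ¬ ev (norm f) ≈ 0#
  norm-≉0 f evf≉0 evN≈0 = product≉0 (ev ∘ conjugate f) factor≉0 (trans (sym (ev-Π-norm f)) evN≈0)
    where
    module LΠ = FiniteSum *-commutativeMonoid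
    product≉0 : ∀ {m} (g : Fin m → Carrier) → (∀ i → ¬ g i ≈ 0#) → ¬ LΠ.sum g ≈ 0#
    product≉0 {ℕ.zero} g g≉0 = 1≉0
    product≉0 {suc m} g g≉0 eq = product≉0 (g ∘ Fin.suc) (g≉0 ∘ Fin.suc) (domain eq (g≉0 zero))
    factor≉0 : ∀ i → ¬ ev (conjugate f i) ≈ 0#
    factor≉0 i eq = case i Fin.≟ K.0# of λ where
      (yes ≡.refl) → 1≉0 (trans (sym (trans (reflexive (≡.cong ev (conjugate-0 f))) ev-1)) eq)
      (no i≢0) → evf≉0 (ev-τ≈0 f i≢0 (trans (reflexive (≡.cong ev (≡.sym (conjugate-≢0 f i≢0)))) eq))

  -- The denominator is rationalised: ev f · ev g is the integer d given by the norm of f. It is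
  -- nonzero because no conjugate of f has value 0.
  fraction-inverse : ∀ {y z} → y * z ≈ 1# → Fraction y → Fraction z
  fraction-inverse {y} {z} yz≈1 (n , f , n≢0 , ny≈evf) = d , (λ a → n ℤ.* g a) , d≢0 , (begin
    ι d * z                 ≈⟨ *-congʳ (ev-norm f) ⟨
    ev (norm f) * z         ≈⟨ *-congʳ (proj₂ (norm-factor f)) ⟩
    ev f * ev g * z         ≈⟨ *-congʳ (*-congʳ ny≈evf) ⟨
    ι n * y * ev g * z
      ≈⟨ solve 4 (λ n y g z → n :* y :* g :* z := n :* g :* (y :* z)) refl (ι n) y (ev g) z ⟩
    ι n * ev g * (y * z)    ≈⟨ trans (*-congˡ yz≈1) (*-identityʳ _) ⟩
    ι n * ev g              ≈⟨ ev-scale n g ⟨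
    ev (λ a → n ℤ.* g a)    ∎)
    where
    d = norm f K.0# ℤ.- norm f K.1#
    g = proj₁ (norm-factor f)
    evf≉0 : ¬ ev f ≈ 0#
    evf≉0 evf≈0 = 1≉0 (trans (sym yz≈1) (trans (*-congʳ (unit-cancel (ι-unit n≢0) (trans ny≈evf evf≈0))) (zeroˡ z)))
    d≢0 : d ≢ ℤ.0ℤ
    d≢0 d≡0 = norm-≉0 f evf≉0 (trans (ev-norm f) (reflexive (≡.cong ι d≡0)))

  fraction : ∀ {ζ} → ζ ^ p ≈ 1# → ∀ {y} → Adjoin ext ζ y → Fraction y
  fraction ζ^p≈1 (Adjoin.base r) = ℚ.↧ r , (λ a → ℚ.↥ r ℤ.* R.1# a) , (λ ()) , trans (embed-fraction r) (sym (trans (ev-scale (ℚ.↥ r) R.1#) (trans (*-congˡ ev-1) (*-identityʳ _))))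
  fraction ζ^p≈1 Adjoin.gen = let a , χa≈ζ = root-of-unity⇒value ζ^p≈1 in
    + 1 , R.X a , (λ ()) , trans (*-identityˡ _) (sym (trans (ev-X a) χa≈ζ))
  fraction ζ^p≈1 (Adjoin.resp y≈z y∈) = let n , f , n≢0 , eq = fraction ζ^p≈1 y∈ in n , f , n≢0 , trans (*-congˡ (sym y≈z)) eq
  fraction ζ^p≈1 (Adjoin.+∈ {y} {z} y∈ z∈) =
    let m , f , m≢0 , eq = fraction ζ^p≈1 y∈
        n , g , n≢0 , eq′ = fraction ζ^p≈1 z∈
    in m ℤ.* n , ((λ a → n ℤ.* f a) R.+ (λ a → m ℤ.* g a)) , *-≢0ℤ m≢0 n≢0 , (begin
      ι (m ℤ.* n) * (y + z)  ≈⟨ *-congʳ (ι-* m n) ⟩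
      ι m * ι n * (y + z)
        ≈⟨ solve 4 (λ m n y z → m :* n :* (y :+ z) := n :* (m :* y) :+ m :* (n :* z)) refl (ι m) (ι n) y z ⟩
      ι n * (ι m * y) + ι m * (ι n * z)  ≈⟨ +-cong (*-congˡ eq) (*-congˡ eq′) ⟩
      ι n * ev f + ι m * ev g  ≈⟨ +-cong (ev-scale n f) (ev-scale m g) ⟨
      ev (λ a → n ℤ.* f a) + ev (λ a → m ℤ.* g a)           ≈⟨ ev-+ (λ a → n ℤ.* f a) (λ a → m ℤ.* g a) ⟨
      ev ((λ a → n ℤ.* f a) R.+ (λ a → m ℤ.* g a))          ∎)
  fraction ζ^p≈1 (Adjoin.-∈ {y} y∈) = let n , f , n≢0 , eq = fraction ζ^p≈1 y∈ in
    n , R.- f , n≢0 , trans (sym (-‿distribʳ-* _ _)) (trans (-‿cong eq) (sym (ev-neg f)))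
  fraction ζ^p≈1 (Adjoin.*∈ {y} {z} y∈ z∈) =
    let m , f , m≢0 , eq = fraction ζ^p≈1 y∈
        n , g , n≢0 , eq′ = fraction ζ^p≈1 z∈
    in m ℤ.* n , f R.* g , *-≢0ℤ m≢0 n≢0 , (begin
      ι (m ℤ.* n) * (y * z)         ≈⟨ *-congʳ (ι-* m n) ⟩
      ι m * ι n * (y * z)
        ≈⟨ solve 4 (λ m n y z → m :* n :* (y :* z) := (m :* y) :* (n :* z)) refl (ι m) (ι n) y z ⟩
      (ι m * y) * (ι n * z)         ≈⟨ *-cong eq eq′ ⟩
      ev f * ev g                   ≈⟨ ev-* f g ⟨
      ev (f R.* g)  ∎)
  fraction ζ^p≈1 (Adjoin.⁻¹∈ yz≈1 y∈) = fraction-inverse yz≈1 (fraction ζ^p≈1 y∈)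

  scaled-isCharacter : ∀ t → IsCharacter F (FieldOps.commutativeRing L) (λ a → χ (t K.* a))
  scaled-isCharacter t = record
    { χ-+ = λ a b → trans (χ-cong (K.distribˡ t a b)) (χ-+ _ _)
    ; χ-0 = trans (χ-cong (K.zeroʳ t)) χ-0 }

  module At (t : Fin p) = R.Eval (FieldOps.commutativeRing L) (λ a → χ (t K.* a)) (scaled-isCharacter t)

  -- For t ≠ 0 this is the image of `ev f` under the Galois automorphism ζ ↦ ζ^t, computed from the
  -- coefficients.
  evAt : Fin p → (Fin p → ℤ) → Carrier
  evAt t = At.ev t

  evAt-1 : ∀ f → evAt K.1# f ≈ ev f
  evAt-1 f = sum-cong-≋ λ a → *-congˡ (χ-cong (K.*-identityˡ a))

  -- Conjugation is thereby well defined on values: a coefficient function of value 0 is constant,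
  -- and orthogonality annihilates constants at every t ≠ 0.
  evAt≈0 : ∀ {t} → t ≢ K.0# → ∀ f → ev f ≈ 0# → evAt t f ≈ 0#
  evAt≈0 {t} t≢0 f evf≈0 = trans (At.ev-cong t {f} {λ _ → f K.0#} (ev≈0⇒const f evf≈0))
    (trans (At.ev-const t (f K.0#)) (trans (*-congˡ (orthogonality t≢0)) (zeroʳ _)))

  -- A conjugate is again the value of a group ring element, so relations involving conjugates can
  -- be decided by `ev≈0?` and conjugated once more.
  twist : ∀ {t} → t ≢ K.0# → ∀ f → ∃ λ g → ∀ s → evAt s g ≈ evAt (s K.* t) f
  twist {t} t≢0 f = τ i f , λ s → trans (sum-cong-≋ λ a → *-congˡ (χ-cong (cancel s a)))
    (trans (K.Reindex.scale +-commutativeMonoid i≢0 (λ a → ι (f a) * χ (s K.* (t K.* a))))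
    (sum-cong-≋ λ a → *-congˡ (χ-cong (≡.sym (K.*-assoc s t a)))))
    where
    i = proj₁ (K.inverse t t≢0)
    it≡1 = proj₂ (K.inverse t t≢0)
    i≢0 : i ≢ K.0#
    i≢0 i≡0 = K.1≢0 (≡.trans (≡.sym it≡1) (≡.trans (≡.cong (K._* t) i≡0) (K.zeroˡ t)))
    cancel : ∀ s a → s K.* a ≡ s K.* (t K.* (i K.* a))
    cancel s a = ≡.cong (s K.*_) (≡.trans (≡.sym (≡.trans (≡.cong (K._* a) it≡1) (K.*-identityˡ a)))
      (K.solve 3 (λ i t a → i K.:* t K.:* a K.:= t K.:* (i K.:* a)) ≡.refl i t a))

  -- The Galois conjugates of an irrational β with β² rational are ±β; the squares fix β and some t₀ negates it,
  -- so averaging over the squares and over their t₀-multiples writes β as a rational multiple of the Gauss sum.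
  module QuadraticElement (2≢0 : K.1# K.+ K.1# ≢ K.0#) (f : Fin p → ℤ)
    (irrational : ¬ Extension.InBase ext (ev f)) (square∈ℚ : Extension.InBase ext (ev f * ev f)) where
    open Gauss 2≢0
    private
      module ℚs = Subfield rationals
      module ℚt = SubfieldTheory rationals
      β = ev f
      D = proj₁ square∈ℚ
      M = ℚ.↧ D
      N = ℚ.↥ D

      Mβ²≈N : ι M * (β * β) ≈ ι N
      Mβ²≈N = trans (*-congˡ (sym (proj₂ square∈ℚ))) (embed-fraction D)

      -- Clearing the denominator of β² gives the relation M β² = N with integer coefficients, to
      -- which conjugation applies.
      conjugate-square : ∀ {t} → t ≢ K.0# → evAt t f * evAt t f ≈ β * β
      conjugate-square {t} t≢0 = x-y≈0⇒x≈y (unit-cancel (ι-unit {M} (λ ())) (begin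
        ι M * (evAt t f * evAt t f - β * β)
          ≈⟨ solve 3 (λ m x y → m :* (x :- y) := m :* x :- m :* y) refl (ι M) (evAt t f * evAt t f) (β * β) ⟩
        ι M * (evAt t f * evAt t f) - ι M * (β * β)     ≈⟨ x≈y⇒x-y≈0 (trans at (sym Mβ²≈N)) ⟩
        0#  ∎))
        where
        h : Fin p → ℤ
        h = (λ a → M ℤ.* (f R.* f) a) R.+ (R.- λ a → N ℤ.* R.1# a)
        evh≈0 : ev h ≈ 0#
        evh≈0 = trans (ev-+ (λ a → M ℤ.* (f R.* f) a) (R.- λ a → N ℤ.* R.1# a)) (trans (+-cong (trans (ev-scale M (f R.* f)) (*-congˡ (ev-* f f)))
          (trans (ev-neg (λ a → N ℤ.* R.1# a)) (-‿cong (trans (ev-scale N R.1#) (trans (*-congˡ ev-1) (*-identityʳ _)))))) (x≈y⇒x-y≈0 Mβ²≈N))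
        at : ι M * (evAt t f * evAt t f) ≈ ι N
        at = x-y≈0⇒x≈y (trans (sym (trans (At.ev-+ t (λ a → M ℤ.* (f R.* f) a) (R.- λ a → N ℤ.* R.1# a)) (+-cong (trans (At.ev-scale t M (f R.* f)) (*-congˡ (At.ev-* t f f)))
          (trans (At.ev-neg t (λ a → N ℤ.* R.1# a)) (-‿cong (trans (At.ev-scale t N R.1#) (trans (*-congˡ (At.ev-1 t)) (*-identityʳ _))))))))
          (evAt≈0 t≢0 h evh≈0))

      Fixes Negates : Fin p → Set ℓ₁
      Fixes t = evAt t f ≈ β
      Negates t = evAt t f ≈ - β

      fixes? : ∀ {t} → t ≢ K.0# → Dec (Fixes t)
      fixes? {t} t≢0 = let g , g≈ = twist t≢0 f in case ev≈0? (g R.+ (R.- f)) of λ where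
          (yes eq) → yes (x-y≈0⇒x≈y (trans (sym (difference g g≈)) eq))
          (no ¬eq) → no λ fix → ¬eq (trans (difference g g≈) (x≈y⇒x-y≈0 fix))
        where
        difference : ∀ g → (∀ s → evAt s g ≈ evAt (s K.* t) f) → ev (g R.+ (R.- f)) ≈ evAt t f - β
        difference g g≈ = trans (ev-+ g (R.- f)) (+-cong (trans (sym (evAt-1 g)) (trans (g≈ K.1#) (reflexive (≡.cong (λ s → evAt s f) (K.*-identityˡ t))))) (ev-neg f))

      fixes⊎negates : ∀ {t} → t ≢ K.0# → Fixes t ⊎ Negates t
      fixes⊎negates {t} t≢0 = case fixes? t≢0 of λ where
        (yes fix) → inj₁ fix
        (no ¬fix) → inj₂ (x-y≈0⇒x≈y (domain (trans (solve 2 (λ x y → (x :- y) :* (x :- (:- y)) := x :* x :- y :* y) refl (evAt t f) β)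
          (x≈y⇒x-y≈0 (conjugate-square t≢0))) (¬fix ∘ x-y≈0⇒x≈y)))

      -- Applying the automorphism X ↦ X^s to the relation evAt t f = ι z β.
      compose : ∀ {s t} → s ≢ K.0# → t ≢ K.0# → ∀ z → evAt t f ≈ ι z * β → evAt (s K.* t) f ≈ ι z * evAt s f
      compose {s} {t} s≢0 t≢0 z eq = x-y≈0⇒x≈y (begin
        evAt (s K.* t) f - ι z * evAt s f
          ≈⟨ +-cong (g≈ s) (trans (At.ev-neg s (λ a → z ℤ.* f a)) (-‿cong (At.ev-scale s z f))) ⟨
        evAt s g + evAt s (R.- λ a → z ℤ.* f a)    ≈⟨ At.ev-+ s g (R.- λ a → z ℤ.* f a) ⟨
        evAt s h  ≈⟨ evAt≈0 s≢0 h evh≈0 ⟩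
        0#  ∎)
        where
        g = proj₁ (twist t≢0 f)
        g≈ = proj₂ (twist t≢0 f)
        h : Fin p → ℤ
        h = g R.+ (R.- λ a → z ℤ.* f a)
        evh≈0 : ev h ≈ 0#
        evh≈0 = trans (ev-+ g (R.- λ a → z ℤ.* f a)) (trans (+-cong (trans (sym (evAt-1 g)) (trans (g≈ K.1#) (trans (reflexive (≡.cong (λ s → evAt s f) (K.*-identityˡ t))) eq)))
          (trans (ev-neg (λ a → z ℤ.* f a)) (-‿cong (ev-scale z f)))) (-‿inverseʳ _))

      -1* : ∀ y → ι (ℤ.- + 1) * y ≈ - y
      -1* = solve 1 (λ y → con (ℤ.- + 1) :* y := :- y) refl

      -- Conjugating twice by s applies the same sign twice.
      squares-fix : ∀ {s} → s ≢ K.0# → Fixes (s K.* s)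
      squares-fix {s} s≢0 = case fixes⊎negates s≢0 of λ where
        (inj₁ fix) → trans (compose s≢0 s≢0 (+ 1) (trans fix (sym (*-identityˡ β)))) (trans (*-identityˡ _) fix)
        (inj₂ neg) → trans (compose s≢0 s≢0 (ℤ.- + 1) (trans neg (sym (-1* β)))) (trans (-1* _) (trans (-‿cong neg) (-‿involutive β)))

      -- Otherwise (p - 1) β would be the sum of the conjugates over t ≠ 0. This sum is rational:
      -- over all t the sums of χ(t a) are integers, and the excluded term at t = 0 is an integer
      -- too.
      not-all-fix : ¬ (∀ t → t ≢ K.0# → Fixes t)
      not-all-fix fix = irrational (ℚt.divide∈ (pred-prime-unit pr) (ℚt.ι∈ (+ ℕ.pred p)) (ℚs.resp
        (trans (+-congʳ (sum-off-ι K.0# (λ t → evAt t f) fix)) (solve 2 (λ s t → (s :+ t) :- s := t) refl (evAt K.0# f) (ι (+ ℕ.pred p) * β)))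
        (ℚs.+∈ (ℚs.resp (sym average) (ℚt.sum∈ _ λ a → ℚs.*∈ (ℚt.ι∈ (f a)) (ℚs.resp (sym (proj₂ (Σ-nonzero a))) (ℚt.ι∈ (proj₁ (Σ-nonzero a))))))
               (ℚs.-∈ (ℚt.sum∈ _ λ a → ℚs.*∈ (ℚt.ι∈ (f a)) (ℚs.resp (sym (trans (χ-cong (K.zeroˡ a)) χ-0)) ℚs.1∈))))))
        where
        average : sum (λ t → evAt t f) ≈ sum (λ a → ι (f a) * sum λ t → χ (t K.* a))
        average = trans (∑-comm (λ t a → ι (f a) * χ (t K.* a))) (sum-cong-≋ λ a → sym (*-distribˡ-sum (ι (f a)) (λ t → χ (t K.* a))))

      negating : ∃ λ t → t ≢ K.0# × Negates t
      negating = case Fin.any? (λ t → negates? t) of λ where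
          (yes (t , t≢0 , ¬fix)) → t , t≢0 , [ (λ fix → contradiction fix ¬fix) , id ]′ (fixes⊎negates t≢0)
          (no none) → contradiction (λ t t≢0 → case fixes? t≢0 of λ where
            (yes fix) → fix
            (no ¬fix) → contradiction (t , t≢0 , ¬fix) none) not-all-fix
        where
        negates? : ∀ t → Dec (t ≢ K.0# × ¬ Fixes t)
        negates? t = case t Fin.≟ K.0# of λ where
          (yes t≡0) → no λ (t≢0 , _) → t≢0 t≡0
          (no t≢0) → case fixes? t≢0 of λ where
            (yes fix) → no λ (_ , ¬fix) → ¬fix fix
            (no ¬fix) → yes (t≢0 , ¬fix)

      t₀ = proj₁ negating
      t₀≢0 = proj₁ (proj₂ negating)

      squares-negate : ∀ {s} → s ≢ K.0# → Negates (s K.* s K.* t₀)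
      squares-negate {s} s≢0 = trans (compose (K.*-≢0 s≢0 s≢0) t₀≢0 (ℤ.- + 1) (trans (proj₂ (proj₂ negating)) (sym (-1* β))))
        (trans (-1* _) (-‿cong (squares-fix s≢0)))

      -- For a ≠ 0 both Gauss sums are ±G(1). At a = 0 both equal p, and the difference removes this
      -- rational contribution; this is why the two averages are subtracted.
      G-multiple : ∀ a → ∃ λ z → G a - G (t₀ K.* a) ≈ ι z * G K.1#
      G-multiple a = case a Fin.≟ K.0# of λ where
        (yes ≡.refl) → + 0 , trans (x≈y⇒x-y≈0 (reflexive (≡.cong G (≡.sym (K.zeroʳ t₀))))) (sym (zeroˡ _))
        (no a≢0) → let z , eq , _ = G-± a≢0
                       w , eq′ , _ = G-± (K.*-≢0 t₀≢0 a≢0)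
                   in z ℤ.+ ℤ.- w , trans (+-cong eq (-‿cong eq′)) (trans (solve 3 (λ z w g → z :* g :- w :* g := (z :- w) :* g) refl (ι z) (ι w) (G K.1#))
                        (*-congʳ (sym (trans (ι-+ z (ℤ.- w)) (+-congˡ (ι-neg w))))))

      k : ℤ
      k = Zr.sum λ a → f a ℤ.* proj₁ (G-multiple a)

      difference-term : ∀ s → evAt (s K.* s) f - evAt (s K.* s K.* t₀) f ≈ sum λ a → ι (f a) * (χ (a K.* (s K.* s)) - χ (t₀ K.* a K.* (s K.* s)))
      difference-term s = begin
        evAt (s K.* s) f - evAt (s K.* s K.* t₀) f
          ≈⟨ +-congˡ (sum-neg (λ a → ι (f a) * χ (s K.* s K.* t₀ K.* a))) ⟨
        evAt (s K.* s) f + sum (λ a → - (ι (f a) * χ (s K.* s K.* t₀ K.* a)))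
          ≈⟨ ∑-distrib-+ (λ a → ι (f a) * χ (s K.* s K.* a)) (λ a → - (ι (f a) * χ (s K.* s K.* t₀ K.* a))) ⟨
        sum (λ a → ι (f a) * χ (s K.* s K.* a) - ι (f a) * χ (s K.* s K.* t₀ K.* a))
          ≈⟨ sum-cong-≋ (λ a → trans (solve 3 (λ m x y → m :* x :- m :* y := m :* (x :- y)) refl (ι (f a)) _ _)
             (*-congˡ (+-cong (χ-cong (K.*-comm (s K.* s) a)) (-‿cong (χ-cong (K.solve 3 (λ s t a → s K.:* s K.:* t K.:* a K.:= t K.:* a K.:* (s K.:* s)) ≡.refl s t₀ a)))))) ⟩
        sum (λ a → ι (f a) * (χ (a K.* (s K.* s)) - χ (t₀ K.* a K.* (s K.* s)))) ∎

      -- Each of the p - 1 nonzero s contributes β - (-β) to the sum of the differences, and s = 0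
      -- contributes nothing. Summing over s first expresses the same total through G(a) - G(t₀ a).
      averaged : ι (+ ℕ.pred p) * (β + β) ≈ ι k * G K.1#
      averaged = begin
        ι (+ ℕ.pred p) * (β + β)
          ≈⟨ trans (+-congʳ (x≈y⇒x-y≈0 (reflexive (≡.cong (λ t → evAt t f) (K.solve 1 (λ t → K.con (+ 0) K.:* K.con (+ 0) K.:= K.con (+ 0) K.:* K.con (+ 0) K.:* t) ≡.refl t₀))))) (+-identityˡ _) ⟨
        term K.0# + ι (+ ℕ.pred p) * (β + β)
          ≈⟨ sum-off-ι K.0# term (λ s s≢0 → trans (+-cong (squares-fix s≢0) (-‿cong (squares-negate s≢0))) (+-congˡ (-‿involutive β))) ⟨
        sum term  ≈⟨ sum-cong-≋ difference-term ⟩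
        sum (λ s → sum λ a → ι (f a) * (χ (a K.* (s K.* s)) - χ (t₀ K.* a K.* (s K.* s))))
          ≈⟨ ∑-comm (λ s a → ι (f a) * (χ (a K.* (s K.* s)) - χ (t₀ K.* a K.* (s K.* s)))) ⟩
        sum (λ a → sum λ s → ι (f a) * (χ (a K.* (s K.* s)) - χ (t₀ K.* a K.* (s K.* s))))
          ≈⟨ sum-cong-≋ inner ⟩
        sum (λ a → ι (f a ℤ.* proj₁ (G-multiple a)) * G K.1#)
          ≈⟨ *-distribʳ-sum (G K.1#) (λ a → ι (f a ℤ.* proj₁ (G-multiple a))) ⟨
        sum (λ a → ι (f a ℤ.* proj₁ (G-multiple a))) * G K.1#
          ≈⟨ *-congʳ (ι-sum (λ a → f a ℤ.* proj₁ (G-multiple a))) ⟨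
        ι k * G K.1#  ∎
        where
        term : Fin p → Carrier
        term s = evAt (s K.* s) f - evAt (s K.* s K.* t₀) f
        inner : ∀ a → sum (λ s → ι (f a) * (χ (a K.* (s K.* s)) - χ (t₀ K.* a K.* (s K.* s)))) ≈ ι (f a ℤ.* proj₁ (G-multiple a)) * G K.1#
        inner a = trans (sym (*-distribˡ-sum (ι (f a)) (λ s → χ (a K.* (s K.* s)) - χ (t₀ K.* a K.* (s K.* s)))))
          (trans (*-congˡ (trans (∑-distrib-+ (λ s → χ (a K.* (s K.* s))) (λ s → - χ (t₀ K.* a K.* (s K.* s)))) (trans (+-congˡ (sum-neg (λ s → χ (t₀ K.* a K.* (s K.* s))))) (proj₂ (G-multiple a)))))
          (trans (sym (*-assoc _ _ _)) (*-congʳ (sym (ι-* (f a) _)))))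

      β≉0 : ¬ β ≈ 0#
      β≉0 β≈0 = irrational (ℚs.resp (sym β≈0) ℚs.0∈)

      k≢0 : k ≢ ℤ.0ℤ
      k≢0 k≡0 = β≉0 (unit-cancel (ι-unit {+ 2} (λ ())) (trans (solve 1 (λ b → con (+ 2) :* b := b :+ b) refl β)
        (unit-cancel (pred-prime-unit pr) (trans averaged (trans (*-congʳ (reflexive (≡.cong ι k≡0))) (zeroˡ _))))))

    gauss∈ : ∀ {m} (Q : Subfield L m) → Subfield.Member Q (ev f) → Subfield.Member Q (G K.1#)
    gauss∈ Q β∈ = divide∈ (ι-unit k≢0) (ι∈ k) (Subfield.resp Q averaged (Subfield.*∈ Q (ι∈ (+ ℕ.pred p)) (Subfield.+∈ Q β∈ β∈)))
      where open SubfieldTheory Q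

  -- The generator α of Q need not have integer coefficients; its multiple n α = ev f does, and it
  -- inherits irrationality and a rational square.
  quadratic-subfield⇒gauss∈ : ∀ {m} → K.1# K.+ K.1# ≢ K.0# → ∀ {ζ} → ζ ^ p ≈ 1# → (Q : Subfield L m) →
                              Subfield.Member Q ⊆ Adjoin ext ζ → Basis ext (Subfield.Member Q) 2 → Subfield.Member Q (G K.1#)
  quadratic-subfield⇒gauss∈ 2≢0 ζ^p≈1 Q Q⊆ basis = QuadraticElement.gauss∈ 2≢0 f
    (λ evf∈ → proj₁ (proj₂ (proj₂ generator)) (ℚt.divide∈ (ι-unit n≢0) (ℚt.ι∈ n) (ℚs.resp (sym eq) evf∈)))
    (ℚs.resp (trans (solve 2 (λ n y → n :* n :* (y :* y) := (n :* y) :* (n :* y)) refl (ι n) α) (*-cong eq eq))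
      (ℚs.*∈ (ℚs.*∈ (ℚt.ι∈ n) (ℚt.ι∈ n)) (proj₂ (proj₂ (proj₂ generator)))))
    Q (Subfield.resp Q eq (Subfield.*∈ Q (SubfieldTheory.ι∈ Q n) α∈))
    where
    module ℚs = Subfield rationals
    module ℚt = SubfieldTheory rationals
    generator = quadratic-generator Q basis
    α = proj₁ generator
    α∈ = proj₁ (proj₂ generator)
    fr = fraction ζ^p≈1 (Q⊆ α∈)
    n = proj₁ fr
    f = proj₁ (proj₂ fr)
    n≢0 = proj₁ (proj₂ (proj₂ fr))
    eq = proj₂ (proj₂ (proj₂ fr))

-- Transport to Fin n

module Transport {c ℓ₁ ℓ₂} (F : HeytingField c ℓ₁ ℓ₂) {n} (|F| : HasSize n F) where
  open HeytingTheory F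
  open Inverse |F| using (to; from; from-cong; strictlyInverseˡ; strictlyInverseʳ) public

  private
    _⊕_ _⊛_ : Fin n → Fin n → Fin n
    a ⊕ b = from (to a + to b)
    a ⊛ b = from (to a * to b)

    rawRing′ : RawRing 0ℓ 0ℓ
    rawRing′ = record { Carrier = Fin n ; _≈_ = _≡_ ; _+_ = _⊕_ ; _*_ = _⊛_ ; -_ = λ a → from (- to a) ; 0# = from 0# ; 1# = from 1# }

  to-injective : ∀ {a b} → to a ≈ to b → a ≡ b
  to-injective eq = ≡.trans (≡.sym (strictlyInverseʳ _)) (≡.trans (from-cong eq) (strictlyInverseʳ _))

  private
    to-isMonomorphism : IsRingMonomorphism rawRing′ (CommutativeRing.rawRing (FieldOps.commutativeRing F)) to
    to-isMonomorphism = record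
      { isRingHomomorphism = record
        { isSemiringHomomorphism = record
          { isNearSemiringHomomorphism = record
            { +-isMonoidHomomorphism = record
              { isMagmaHomomorphism = record
                { isRelHomomorphism = record { cong = reflexive ∘ ≡.cong to }
                ; homo = λ _ _ → strictlyInverseˡ _ }
              ; ε-homo = strictlyInverseˡ _ }
            ; *-homo = λ _ _ → strictlyInverseˡ _ }
          ; 1#-homo = strictlyInverseˡ _ }
        ; -‿homo = λ _ → strictlyInverseˡ _ }
      ; injective = to-injective }

  finField : FinField n
  finField = record
    { _⊕_ = _⊕_
    ; _⊛_ = _⊛_
    ; ⊖_ = λ a → from (- to a)
    ; o = from 0#
    ; e = from 1#
    ; isCommutativeRing = RingMonomorphism.isCommutativeRing to-isMonomorphism isCommutativeRing
    ; inverse = inverse′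
    ; e≢o = λ e≡o → 1≉0 (trans (sym (strictlyInverseˡ 1#)) (trans (reflexive (≡.cong to e≡o)) (strictlyInverseˡ 0#)))
    }
    where
    open HeytingField F using (tight)
    -- Inequality does not by itself give apartness. A search over the finite set finds an inverse,
    -- and if it failed, x could not be apart from 0, so tightness would give x = 0.
    inverse′ : ∀ x → x ≢ from 0# → ∃ λ y → y ⊛ x ≡ from 1#
    inverse′ x x≢0 = case Fin.any? (λ y → y ⊛ x Fin.≟ from 1#) of λ where
        (yes inv) → inv
        (no ¬inv) → contradiction (to-injective (trans (proj₁ (tight (to x) 0#) λ x#0 → let v , vx≈1 = #0⇒unit x#0 in
          ¬inv (from v , from-cong (trans (*-congʳ (strictlyInverseˡ v)) vx≈1))) (sym (strictlyInverseˡ 0#)))) x≢0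

  module K = FiniteFieldTheory finField

  to-isHom : IsRingHomomorphism (CommutativeRing.rawRing K.F-ring) (CommutativeRing.rawRing (FieldOps.commutativeRing F)) to
  to-isHom = IsRingMonomorphism.isRingHomomorphism to-isMonomorphism

module Embedding {n} (F : FinField n) {c ℓ₁ ℓ₂} (L : HeytingField c ℓ₁ ℓ₂)
  {h : Fin n → HeytingField.Carrier L}
  (isHom : IsRingHomomorphism (CommutativeRing.rawRing (FinField.commutativeRing F)) (CommutativeRing.rawRing (FieldOps.commutativeRing L)) h) where
  private module K = FiniteFieldTheory F
  open HeytingTheory L
  open IsRingHomomorphism isHom using (+-homo; *-homo; -‿homo; 0#-homo; 1#-homo) public
  open RingHom K.F-ring (FieldOps.commutativeRing L) isHom public

  h-unit : ∀ {a} → a ≢ K.0# → Unit (h a)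
  h-unit {a} a≢0 = let i , ia≡1 = K.inverse a a≢0 in h i , trans (sym (*-homo i a)) (trans (reflexive (≡.cong h ia≡1)) 1#-homo)

  h-injective : ∀ {a b} → h a ≈ h b → a ≡ b
  h-injective {a} {b} ha≈hb = case a Fin.≟ b of λ where
      (yes a≡b) → a≡b
      (no a≢b) → let v , eq = h-unit (a≢b ∘ K.x-y≈0⇒x≈y) in
        contradiction (trans (sym eq) (trans (*-congˡ (trans (+-homo a (K.- b)) (trans (+-congˡ (-‿homo b)) (x≈y⇒x-y≈0 ha≈hb)))) (zeroʳ v))) 1≉0

-- Arithmetic of odd prime powers

[1+a]^k : ∀ a k → ∃ λ b → suc a ^ℕ k ≡ suc (a *ℕ b)
[1+a]^k a ℕ.zero = 0 , ≡.cong suc (≡.sym (ℕ.*-zeroʳ a))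
[1+a]^k a (suc k) = let b , eq = [1+a]^k a k in
  b ℕ.+ suc (a *ℕ b) , ≡.trans (≡.cong (suc a *ℕ_) eq)
    (solve 2 (λ a b → (con 1 :+ a) :* (con 1 :+ a :* b) := con 1 :+ a :* (b :+ (con 1 :+ a :* b))) ≡.refl a b)
  where open ℕSolver.+-*-Solver

even⊎odd : ∀ n → (∃ λ k → n ≡ k ℕ.+ k) ⊎ (∃ λ k → n ≡ suc (k ℕ.+ k))
even⊎odd ℕ.zero = inj₁ (0 , ≡.refl)
even⊎odd (suc n) = case even⊎odd n of λ where
  (inj₁ (k , ≡.refl)) → inj₂ (k , ≡.refl)
  (inj₂ (k , ≡.refl)) → inj₁ (suc k , ≡.cong suc (≡.sym (ℕ.+-suc k k)))

odd-prime : ∀ {p} → Prime p → p ≢ 2 → ∃ λ k → p ≡ suc (k ℕ.+ k)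
odd-prime {p} pr p≢2 = case even⊎odd p of λ where
  (inj₂ odd) → odd
  (inj₁ (k , p≡k+k)) → contradiction (≡.sym (2≡p (Prime.prime⇒irreducible pr (divides k (≡.trans p≡k+k
    (≡.trans (≡.cong (k ℕ.+_) (≡.sym (ℕ.+-identityʳ k))) (ℕ.*-comm 2 k))))))) p≢2
    where
    2≡p : 2 ≡ 1 ⊎ 2 ≡ p → 2 ≡ p
    2≡p (inj₂ eq) = eq

odd-power : ∀ {p k} → p ≡ suc (k ℕ.+ k) → ∀ r → ∃ λ m → p ^ℕ r ≡ suc (m ℕ.+ m)
odd-power {p} {k} ≡.refl r = let b , eq = [1+a]^k (k ℕ.+ k) r in
  k *ℕ b , ≡.trans eq (≡.cong suc (ℕ.*-distribʳ-+ b k k))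

half-odd+1 : ∀ {n m} → n ≡ suc (m ℕ.+ m) → (n ℕ.+ 1) ℕ./ 2 ℕ.+ (n ℕ.+ 1) ℕ./ 2 ≡ suc n
half-odd+1 {n} {m} n≡ = ≡.trans (≡.trans (≡.cong (h ℕ.+_) (≡.sym (ℕ.+-identityʳ h))) (ℕ.*-comm 2 h))
  (≡.trans (ℕ.m/n*n≡m (divides (suc m) (≡.trans (≡.cong (ℕ._+ 1) n≡)
    (solve 1 (λ m → (con 1 :+ (m :+ m)) :+ con 1 := (con 1 :+ m) :* con 2) ≡.refl m)))) (ℕ.+-comm n 1))
  where
  open ℕSolver.+-*-Solver
  h = (n ℕ.+ 1) ℕ./ 2

-- Since p divides s, a factor p² can be removed from both sides. An odd exponent would lead to 1 =
-- p q² for some q.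
square-prime-power : ∀ {p} → Prime p → ∀ r s → p ^ℕ r ≡ s *ℕ s → ∃ λ j → s ≡ p ^ℕ j
square-prime-power pr 0 s eq = 0 , ℕ.m*n≡1⇒m≡1 s s (≡.sym eq)
square-prime-power {p} pr (suc r) s eq = root r eq (reduce (Prime.euclidsLemma s s pr (divides (p ^ℕ r) (≡.trans (≡.sym eq) (ℕ.*-comm p (p ^ℕ r))))))
  where
  instance _ = Prime.prime⇒nonZero pr
  reduce : p ∣ s ⊎ p ∣ s → p ∣ s
  reduce = [ id , id ]′
  cancelled : ∀ r q → p ^ℕ suc r ≡ (q *ℕ p) *ℕ (q *ℕ p) → p ^ℕ r ≡ p *ℕ (q *ℕ q)
  cancelled r q eq = ℕ.*-cancelˡ-≡ (p ^ℕ r) (p *ℕ (q *ℕ q)) p (≡.trans eq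
    (solve 2 (λ p q → (q :* p) :* (q :* p) := p :* (p :* (q :* q))) ≡.refl p q))
    where open ℕSolver.+-*-Solver
  root : ∀ r → p ^ℕ suc r ≡ s *ℕ s → p ∣ s → ∃ λ j → s ≡ p ^ℕ j
  root 0 eq (divides q ≡.refl) = contradiction (≡.subst Prime (ℕ.m*n≡1⇒m≡1 p (q *ℕ q) (≡.sym (cancelled 0 q eq))) pr) Prime.¬prime[1]
  root (suc r) eq (divides q ≡.refl) =
    let j , q≡ = square-prime-power pr r q (ℕ.*-cancelˡ-≡ (p ^ℕ r) (q *ℕ q) p (cancelled (suc r) q eq))
    in suc j , ≡.trans (≡.cong (_*ℕ p) q≡) (ℕ.*-comm (p ^ℕ j) p)

-- (q − 1)/2 is a multiple of p − 1 when q is the square of a power of p.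
half-square : ∀ {k} j → let P = suc (k ℕ.+ k) ^ℕ j in ∃ λ m → P *ℕ P ≡ suc ((k ℕ.+ k) *ℕ m ℕ.+ (k ℕ.+ k) *ℕ m)
half-square {k} j = let b , eq = [1+a]^k (k ℕ.+ k) j in
  -- From P = 1 + 2 k b one gets P² - 1 = 4 k b (1 + k b).
  b *ℕ suc (k *ℕ b) , ≡.trans (≡.cong₂ _*ℕ_ eq eq)
    (solve 2 (λ k b → (con 1 :+ (k :+ k) :* b) :* (con 1 :+ (k :+ k) :* b) :=
       con 1 :+ ((k :+ k) :* (b :* (con 1 :+ k :* b)) :+ (k :+ k) :* (b :* (con 1 :+ k :* b)))) ≡.refl k b)
  where open ℕSolver.+-*-Solver

-- (p^d − 1)/2 is congruent to (p − 1)/2 modulo p − 1 when d is odd.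
odd-degree : ∀ k e → ∃ λ z → suc (k ℕ.+ k) ^ℕ suc (e ℕ.+ e) ≡ suc ((k ℕ.+ (k ℕ.+ k) *ℕ z) ℕ.+ (k ℕ.+ (k ℕ.+ k) *ℕ z))
odd-degree k e = let b , eq = [1+a]^k (k ℕ.+ k) e
                     c = b ℕ.+ k *ℕ b *ℕ b
                 -- From p^e = 1 + 2 k b one gets p^(2 e) = 1 + 4 k c, and multiplication by 1 + 2 k
                 -- gives 1 + 2 (k + 2 k (c + 2 k c)).
                 in c ℕ.+ k *ℕ (c ℕ.+ c) , ≡.trans (≡.cong (suc (k ℕ.+ k) *ℕ_) (≡.trans (ℕ.^-distribˡ-+-* (suc (k ℕ.+ k)) e e) (≡.cong₂ _*ℕ_ eq eq)))
                      (solve 2 (λ k b → (con 1 :+ (k :+ k)) :* ((con 1 :+ (k :+ k) :* b) :* (con 1 :+ (k :+ k) :* b)) :=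
                        let c = b :+ k :* b :* b; h = k :+ (k :+ k) :* (c :+ k :* (c :+ c)) in con 1 :+ (h :+ h)) ≡.refl k b)
  where open ℕSolver.+-*-Solver

-- The sums S₊ and S₋

module TraceScaling {c ℓ₁ ℓ₂ c′ ℓ₁′ ℓ₂′} {k : HeytingField c ℓ₁ ℓ₂} {L : HeytingField c′ ℓ₁′ ℓ₂′}
  {ext : Extension k L} {d} (basis : Basis ext U d) where
  private
    module k = Ring (FieldOps.commutativeRing k)
    module L = Ring (FieldOps.commutativeRing L)
  open Extension ext
  open Basis basis

  trace-cong : ∀ {x y} → x L.≈ y → trace basis x k.≈ trace basis y
  trace-cong x≈y = k.sum-cong-≋ λ i → unique _ _ (L.trans (spans tt) (L.trans (L.*-congʳ x≈y) (L.sym (spans tt)))) i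

  trace-scale : ∀ r y → trace basis (embed r L.* y) k.≈ r k.* trace basis y
  trace-scale r y = k.trans (k.sum-cong-≋ λ i → unique (coord {embed r L.* y L.* vector i} tt) (λ j → r k.* coord {y L.* vector i} tt j) (begin
      combination (coord {embed r L.* y L.* vector i} tt) vector                   ≈⟨ spans tt ⟩
      embed r L.* y L.* vector i  ≈⟨ L.*-assoc _ _ _ ⟩
      embed r L.* (y L.* vector i)
        ≈⟨ L.*-congˡ (spans tt) ⟨
      embed r L.* combination (coord {y L.* vector i} tt) vector
        ≈⟨ L.*-distribˡ-sum (embed r) (λ j → embed (coord {y L.* vector i} tt j) L.* vector j) ⟩
      L.sum (λ j → embed r L.* (embed (coord {y L.* vector i} tt j) L.* vector j))
        ≈⟨ L.sum-cong-≋ (λ j → L.trans (L.sym (L.*-assoc (embed r) (embed (coord {y L.* vector i} tt j)) (vector j))) (L.*-congʳ {vector j} (L.sym (*-homo r (coord {y L.* vector i} tt j))))) ⟩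
      combination (λ j → r k.* coord {y L.* vector i} tt j) vector  ∎) i)
    (k.sym (k.*-distribˡ-sum r (λ i → coord {y L.* vector i} tt i)))
    where open SetoidReasoning L.setoid

module HalfPowers {c ℓ₁ ℓ₂} (E : HeytingField c ℓ₁ ℓ₂) {q} (q-odd : ∃ λ m → q ≡ suc (m ℕ.+ m)) where
  open HeytingTheory E

  ^-fixed : ∀ {v m} → v ^ m ≈ v → ∀ i → v ^ (m ^ℕ i) ≈ v
  ^-fixed v^m≈v ℕ.zero = *-identityʳ _
  ^-fixed {v} {m} v^m≈v (suc i) = trans (sym (^-assocʳ v m (m ^ℕ i))) (trans (^-congˡ (m ^ℕ i) v^m≈v) (^-fixed {v} {m} v^m≈v i))

  -- As q is odd the halving is exact, so the power is v^(q^i + 1) = v · v^(q^i). This is what makes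
  -- every term of f̃ scale by the same factor.
  half-power : ∀ {v} → v ^ q ≈ v → ∀ i → (v * v) ^ ((q ^ℕ i ℕ.+ 1) ℕ./ 2) ≈ v * v
  half-power {v} v^q≈v i = begin
    (v * v) ^ h           ≈⟨ ^-distrib-* v v h ⟩
    v ^ h * v ^ h         ≈⟨ ^-homo-* v h h ⟨
    v ^ (h ℕ.+ h)         ≈⟨ ^-congʳ v (half-odd+1 {m = proj₁ odd} (proj₂ odd)) ⟩
    v * v ^ (q ^ℕ i)      ≈⟨ *-congˡ (^-fixed v^q≈v i) ⟩
    v * v  ∎
    where
    open SetoidReasoning setoid
    h = (q ^ℕ i ℕ.+ 1) ℕ./ 2
    odd = odd-power {k = proj₁ q-odd} (proj₂ q-odd) i

  module _ {n} (a : Vector Carrier (suc n)) where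
    f̃ : Carrier → Carrier
    f̃ = halfPowerPolynomial E q a

    f̃-cong : ∀ {x y} → x ≈ y → f̃ x ≈ f̃ y
    f̃-cong x≈y = sum-cong-≋ {suc n} λ i → *-congˡ {a i} (^-congˡ ((q ^ℕ toℕ i ℕ.+ 1) ℕ./ 2) x≈y)

    f̃-scale : ∀ {v t} → v ^ q ≈ v → v * v ≈ t → ∀ x → f̃ (t * x) ≈ t * f̃ x
    f̃-scale {v} {t} v^q≈v v²≈t x = trans (sum-cong-≋ term) (sym (*-distribˡ-sum t (λ i → a i * x ^ ((q ^ℕ toℕ i ℕ.+ 1) ℕ./ 2))))
      where
      term : ∀ i → a i * (t * x) ^ ((q ^ℕ toℕ i ℕ.+ 1) ℕ./ 2) ≈ t * (a i * x ^ ((q ^ℕ toℕ i ℕ.+ 1) ℕ./ 2))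
      term i = trans (*-congˡ (trans (^-distrib-* t x m) (*-congʳ (trans (^-congˡ m (sym v²≈t)) (trans (half-power v^q≈v (toℕ i)) v²≈t)))))
        (solve 3 (λ a t y → a :* (t :* y) := t :* (a :* y)) refl (a i) t (x ^ m))
        where m = (q ^ℕ toℕ i ℕ.+ 1) ℕ./ 2

module QuadraticCharacter {c ℓ₁ ℓ₂} (F : HeytingField c ℓ₁ ℓ₂) {n} (|F| : HasSize n F)
  {c′ ℓ₁′ ℓ₂′} (L : HeytingField c′ ℓ₁′ ℓ₂′) where
  private
    module L = HeytingTheory L
    module Q = FiniteField F |F| L
    module T = Transport F |F|
    module H = IsRingHomomorphism T.to-isHom
    module K = T.K
  open HeytingTheory F
  open Q using (quadraticCharacter; IsSquare)

  quadraticCharacter-resp : ∀ {x y} → (x ≈ 0# → y ≈ 0#) → (y ≈ 0# → x ≈ 0#) → (IsSquare x → IsSquare y) → (IsSquare y → IsSquare x) →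
                            quadraticCharacter x L.≈ quadraticCharacter y
  quadraticCharacter-resp {x} {y} x⇒y y⇒x sx⇒sy sy⇒sx with x Q.≟ 0# | Q.isSquare? x | y Q.≟ 0# | Q.isSquare? y
  ... | yes _   | _      | yes _   | _      = L.refl
  ... | yes x≈0 | _      | no y≉0  | _      = contradiction (x⇒y x≈0) y≉0
  ... | no x≉0  | _      | yes y≈0 | _      = contradiction (y⇒x y≈0) x≉0
  ... | no _    | yes _  | no _    | yes _  = L.refl
  ... | no _    | yes sx | no _    | no ¬sy = contradiction (sx⇒sy sx) ¬sy
  ... | no _    | no ¬sx | no _    | yes sy = contradiction (sy⇒sx sy) ¬sx
  ... | no _    | no _   | no _    | no _   = L.refl

  quadraticCharacter-square : ∀ {v x y} → Unit v → y ≈ v * v * x → quadraticCharacter y L.≈ quadraticCharacter x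
  quadraticCharacter-square {v} {x} {y} (u , uv≈1) y≈v²x = quadraticCharacter-resp
    (λ y≈0 → trans (sym u²y≈x) (trans (*-congˡ y≈0) (zeroʳ _)))
    (λ x≈0 → trans y≈v²x (trans (*-congˡ x≈0) (zeroʳ _)))
    (λ (z , z²≈y) → u * z , trans (square u z) (trans (*-congˡ z²≈y) u²y≈x))
    (λ (z , z²≈x) → v * z , trans (square v z) (trans (*-congˡ z²≈x) (sym y≈v²x)))
    where
    square : ∀ s t → (s * t) * (s * t) ≈ s * s * (t * t)
    square = solve 2 (λ s t → (s :* t) :* (s :* t) := s :* s :* (t :* t)) refl
    u²y≈x : u * u * y ≈ x
    u²y≈x = trans (*-congˡ y≈v²x) (trans (solve 3 (λ u v x → u :* u :* (v :* v :* x) := (u :* v) :* (u :* v) :* x) refl u v x)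
      (trans (*-congʳ (trans (*-cong uv≈1 uv≈1) (*-identityˡ 1#))) (*-identityˡ x)))

  quadraticCharacter∈ : ∀ {m} (S : Subfield L m) x → Subfield.Member S (quadraticCharacter x)
  quadraticCharacter∈ S x with x Q.≟ 0# | Q.isSquare? x
  ... | yes _ | _     = Subfield.0∈ S
  ... | no  _ | yes _ = Subfield.1∈ S
  ... | no  _ | no  _ = Subfield.-∈ S (Subfield.1∈ S)

  rootCount-quadraticCharacter : (2≢0 : K.1# K.+ K.1# ≢ K.0#) → ∀ b → L.ι (+ K.Odd.rootCount 2≢0 b) L.≈ L.1# L.+ quadraticCharacter (T.to b)
  rootCount-quadraticCharacter 2≢0 b with T.to b Q.≟ 0# | Q.isSquare? (T.to b)
  ... | yes b≈0 | _ = L.trans (L.reflexive (≡.cong (L.ι ∘ +_) (≡.trans (≡.cong (K.Odd.rootCount 2≢0) (T.to-injective (trans b≈0 (sym H.0#-homo)))) (K.Odd.rootCount-0 2≢0))))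
        (L.sym (L.+-identityʳ L.1#))
  ... | no b≉0 | yes (y , y²≈b) = L.reflexive (≡.cong (L.ι ∘ +_) (≡.trans (≡.cong (K.Odd.rootCount 2≢0) b≡) (K.Odd.rootCount-square 2≢0 y′≢0)))
    where
    y′ = T.from y
    b≡ : b ≡ y′ K.* y′
    b≡ = T.to-injective (trans (sym y²≈b) (sym (trans (H.*-homo y′ y′) (*-cong (T.strictlyInverseˡ y) (T.strictlyInverseˡ y)))))
    y′≢0 : y′ ≢ K.0#
    y′≢0 eq = b≉0 (trans (reflexive (≡.cong T.to (≡.trans b≡ (≡.trans (≡.cong (K._* y′) eq) (K.zeroˡ y′))))) H.0#-homo)
  ... | no b≉0 | no ¬sq = L.trans (L.reflexive (≡.cong (L.ι ∘ +_) (K.Odd.rootCount-nonsquare 2≢0 λ (y , y²≡b) →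
        ¬sq (T.to y , trans (sym (H.*-homo y y)) (reflexive (≡.cong T.to y²≡b)))))) (L.sym (L.-‿inverseʳ L.1#))

module Setting {c₁ ℓ₁ ℓ₁′ c₂ ℓ₂ ℓ₂′ c₃ ℓ₃ ℓ₃′} {p} (pr : Prime p) (p≢2 : p ≢ 2) {q r} (q≡p^r : q ≡ p ^ℕ r)
  (𝔽p : HeytingField c₁ ℓ₁ ℓ₁′) (|𝔽p| : HasSize p 𝔽p)
  (E : HeytingField c₂ ℓ₂ ℓ₂′) (𝔽p⊆E : Extension 𝔽p E) (d : ℕ) (basis : Basis 𝔽p⊆E U d)
  (L : HeytingField c₃ ℓ₃ ℓ₃′) (ℚ⊆L : Extension ℚ-field L)
  (ψ : AdditiveCharacter 𝔽p L) (nontrivial : AdditiveCharacter.Nontrivial ψ)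
  {n} (a : Vector (HeytingField.Carrier E) (suc n)) where

  open HeytingTheory L
  open Rational ℚ⊆L
  open GaussSums L |𝔽p| basis ψ
  private
    module E = HeytingTheory E
    |E| : HasSize (p ^ℕ d) E
    |E| = extensionSize |𝔽p| basis
    module TP = Transport 𝔽p |𝔽p|
    module TE = Transport E |E|
    module Fp = HeytingTheory 𝔽p
    module K = TP.K
    module KE = TE.K
    module Char = Characteristic TP.finField
    module HP = IsRingHomomorphism TP.to-isHom
    module HE = IsRingHomomorphism TE.to-isHom
    module QP = QuadraticCharacter 𝔽p |𝔽p| L
    module QE = QuadraticCharacter E |E| L
    module χP = FiniteField 𝔽p |𝔽p| L
    module χE = FiniteField E |E| L
    embed = Extension.embed 𝔽p⊆E
    open AdditiveCharacter ψ using (char; isHomomorphism)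
    module ψ = IsMonoidHomomorphism isHomomorphism

    half = odd-prime pr p≢2
    k = proj₁ half
    p≡1+2k = proj₂ half

    q-odd : ∃ λ m → q ≡ suc (m ℕ.+ m)
    q-odd = let m , eq = odd-power {k = k} p≡1+2k r in m , ≡.trans q≡p^r eq
    open HalfPowers E q-odd

    2<p : 2 ℕ.< p
    2<p = ℕ.≤∧≢⇒< (ℕ.nonTrivial⇒n>1 p {{Prime.prime⇒nonTrivial pr}}) (p≢2 ∘ ≡.sym)

    2≢0 : K.1# K.+ K.1# ≢ K.0#
    2≢0 = Char.ι-≢0 pr 2 (ℕ.s≤s ℕ.z≤n) 2<p

    χ : Fin p → Carrier
    χ b = char (TP.to b)

    isCharacter : IsCharacter TP.finField (FieldOps.commutativeRing L) χ
    isCharacter = record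
      { χ-+ = λ b c → trans (ψ.⟦⟧-cong (HP.+-homo b c)) (ψ.homo _ _)
      ; χ-0 = trans (ψ.⟦⟧-cong HP.0#-homo) ψ.ε-homo }
    open IsCharacter isCharacter using (χ-0)

    χ#1 : χ (TP.from (proj₁ nontrivial)) # 1#
    χ#1 = HeytingProperties.#-congʳ (HeytingField.heytingCommutativeRing L)
      (ψ.⟦⟧-cong (Fp.sym (TP.strictlyInverseˡ _))) (proj₂ nontrivial)

    module Cyc = CyclotomicField L ℚ⊆L pr TP.finField χ isCharacter χ#1
    open Cyc using (G; G-0; Σχ≈0; Σ-nonzero; quadratic-subfield⇒gauss∈)
    open Cyc.Gauss 2≢0 using (G-1; G-±; G*G⁻; rootCount)

    -- The root counts are 1 + χ₂, and the summand 1 contributes Σ χ = 0.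
    gauss≈G : gauss ≈ G K.1#
    gauss≈G = sym (begin
      G K.1#  ≈⟨ G-1 ⟩
      sum (λ b → ι (+ rootCount b) * χ b)
        ≈⟨ sum-cong-≋ (λ b → trans (*-congʳ (QP.rootCount-quadraticCharacter 2≢0 b))
           (solve 2 (λ s t → (con (+ 1) :+ s) :* t := t :+ t :* s) refl (χP.quadraticCharacter (TP.to b)) (χ b))) ⟩
      sum (λ b → χ b + χ b * χP.quadraticCharacter (TP.to b))
        ≈⟨ ∑-distrib-+ χ (λ b → χ b * χP.quadraticCharacter (TP.to b)) ⟩
      sum χ + gauss
        ≈⟨ trans (+-congʳ Σχ≈0) (+-identityˡ _) ⟩
      gauss  ∎)
      where open SetoidReasoning setoid

    -- The Gauss sum divides p, because G(1) G(-1) = p.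
    gauss-unit : Unit gauss
    gauss-unit = unit-factor (unit-resp (sym (trans (*-congʳ gauss≈G) G*G⁻)) (prime-unit pr))

  gauss^d#0 : gauss ^ d # 0#
  gauss^d#0 = unit⇒#0 (unit-^ d gauss-unit)

  private
    hP : Fin p → E.Carrier
    hP = embed ∘ TP.to

    hP-isHom : IsRingHomomorphism (CommutativeRing.rawRing K.F-ring) (CommutativeRing.rawRing (FieldOps.commutativeRing E)) hP
    hP-isHom = Composition.isRingHomomorphism E.trans TP.to-isHom (Extension.isRingHomomorphism 𝔽p⊆E)
    module hP = Embedding TP.finField E hP-isHom

    -- Transported to the finite index sets, the summand ψ_E(f̃(x)) is χ(c x).
    c : Fin (p ^ℕ d) → Fin p
    c x = TP.from (trace basis (f̃ a (TE.to x)))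

    module Scaling {s : Fin p} (s≢0 : s ≢ K.0#) {v : E.Carrier} (v²≈s : v E.* v E.≈ hP s) (v^q≈v : v E.^ q E.≈ v) where
      t : Fin (p ^ℕ d)
      t = TE.from (hP s)

      to-t* : ∀ x → TE.to (t KE.* x) E.≈ hP s E.* TE.to x
      to-t* x = E.trans (HE.*-homo t x) (E.*-congʳ (TE.strictlyInverseˡ (hP s)))

      t≢0 : t ≢ KE.0#
      t≢0 t≡0 = let u , eq = hP.h-unit s≢0 in E.1≉0 (E.trans (E.sym eq) (E.trans (E.*-congˡ
        (E.trans (E.sym (TE.strictlyInverseˡ (hP s))) (E.trans (E.reflexive (≡.cong TE.to t≡0)) HE.0#-homo))) (E.zeroʳ u)))

      c-scale : ∀ x → c (t KE.* x) ≡ s K.* c x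
      c-scale x = TP.to-injective (begin
        TP.to (c (t KE.* x))  ≈⟨ TP.strictlyInverseˡ _ ⟩
        trace basis (f̃ a (TE.to (t KE.* x)))
          ≈⟨ TraceScaling.trace-cong basis (E.trans (f̃-cong a (to-t* x)) (f̃-scale a v^q≈v v²≈s (TE.to x))) ⟩
        trace basis (hP s E.* f̃ a (TE.to x))
          ≈⟨ TraceScaling.trace-scale basis (TP.to s) (f̃ a (TE.to x)) ⟩
        TP.to s Fp.* trace basis (f̃ a (TE.to x))            ≈⟨ Fp.*-congˡ (TP.strictlyInverseˡ _) ⟨
        TP.to s Fp.* TP.to (c x)  ≈⟨ HP.*-homo s (c x) ⟨
        TP.to (s K.* c x)  ∎)
        where open SetoidReasoning Fp.setoid

      v-unit : E.Unit v
      v-unit = E.unit-factor (E.unit-resp (E.sym v²≈s) (hP.h-unit s≢0))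

      character-scale : ∀ x → χE.quadraticCharacter (TE.to (t KE.* x)) ≈ χE.quadraticCharacter (TE.to x)
      character-scale x = QE.quadraticCharacter-square v-unit (E.trans (to-t* x) (E.*-congʳ (E.sym v²≈s)))

    module Averaging {m} (Q : Subfield L m) where
      open Subfield Q
      open SubfieldTheory Q

      -- The multipliers are parametrised by ρ, and the weight w is 1 or the quadratic character. By
      -- the substitution, A(s) equals the sum T for every s ≠ 0, so (p - 1) T is Σ A(s) minus the
      -- term A(0) = Σ w. Exchanging the order of summation leaves inner sums that lie in Q by
      -- hypothesis.
      average∈ : ∀ (ρ : Fin p → Fin p) → ρ K.0# ≡ K.0# → (∀ b → Member (sum λ s → χ (ρ s K.* b))) →
                 (∀ {s} → s ≢ K.0# → ρ s ≢ K.0# × ∃ λ v → v E.* v E.≈ hP (ρ s) × v E.^ q E.≈ v) →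
                 ∀ (w : Fin (p ^ℕ d) → Carrier) → (∀ x → Member (w x)) →
                 (∀ {s} (s≢0 : s ≢ K.0#) {v} (v²≈s : v E.* v E.≈ hP s) (v^q≈v : v E.^ q E.≈ v) → ∀ x → w (Scaling.t s≢0 v²≈s v^q≈v KE.* x) ≈ w x) →
                 Member (sum λ x → χ (c x) * w x)
      average∈ ρ ρ0≡0 Σρ∈ root w w∈ w-scale = divide∈ (pred-prime-unit pr) (ι∈ (+ ℕ.pred p)) (resp isolate
        (+∈ (resp (sym swap) (sum∈ _ λ x → *∈ (Σρ∈ (c x)) (w∈ x))) (-∈ (sum∈ w w∈))))
        where
        open SetoidReasoning setoid
        T = sum λ x → χ (c x) * w x
        A : Fin p → Carrier
        A s = sum λ x → χ (ρ s K.* c x) * w x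
        A-0 : A K.0# ≈ sum w
        A-0 = sum-cong-≋ λ x → trans (*-congʳ (trans (Cyc.χ-cong (≡.trans (≡.cong (K._* c x) ρ0≡0) (K.zeroˡ (c x)))) χ-0)) (*-identityˡ _)
        A-≢0 : ∀ s → s ≢ K.0# → A s ≈ T
        A-≢0 s s≢0 = let ρs≢0 , v , v²≈s , v^q≈v = root s≢0 in
          trans (sum-cong-≋ λ x → sym (*-cong (Cyc.χ-cong (Scaling.c-scale ρs≢0 v²≈s v^q≈v x)) (w-scale ρs≢0 v²≈s v^q≈v x)))
            (KE.Reindex.scale +-commutativeMonoid (Scaling.t≢0 ρs≢0 v²≈s v^q≈v) (λ x → χ (c x) * w x))
        swap : sum A ≈ sum λ x → (sum λ s → χ (ρ s K.* c x)) * w x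
        swap = trans (∑-comm (λ s x → χ (ρ s K.* c x) * w x)) (sum-cong-≋ λ x → sym (*-distribʳ-sum (w x) (λ s → χ (ρ s K.* c x))))
        isolate : sum A - sum w ≈ ι (+ ℕ.pred p) * T
        isolate = trans (+-cong (trans (sum-off-ι K.0# A A-≢0) (+-congʳ A-0)) refl) (solve 2 (λ s t → (s :+ t) :- s := t) refl (sum w) (ι (+ ℕ.pred p) * T))

      S∈ : Member (gauss ^ d) → ∀ (ρ : Fin p → Fin p) → ρ K.0# ≡ K.0# → (∀ b → Member (sum λ s → χ (ρ s K.* b))) →
           (∀ {s} → s ≢ K.0# → ρ s ≢ K.0# × ∃ λ v → v E.* v E.≈ hP (ρ s) × v E.^ q E.≈ v) →
           Member (S₊ gauss^d#0 (f̃ a)) × Member (S₋ gauss^d#0 (f̃ a))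
      S∈ gauss^d∈ ρ ρ0≡0 Σρ∈ root =
          *∈ coefficient∈ (resp (sum-cong-≋ λ x → trans (*-identityʳ _) (charE≈ x))
            (average∈ ρ ρ0≡0 Σρ∈ root (λ _ → 1#) (λ _ → 1∈) (λ _ _ _ _ → refl)))
        , *∈ coefficient∈ (resp (sum-cong-≋ λ x → *-congʳ (charE≈ x))
            (average∈ ρ ρ0≡0 Σρ∈ root (λ x → χE.quadraticCharacter (TE.to x)) (λ x → QE.quadraticCharacter∈ Q (TE.to x)) (λ s≢0 v²≈s v^q≈v → Scaling.character-scale s≢0 v²≈s v^q≈v)))
        where
        charE≈ : ∀ x → χ (c x) ≈ charE (f̃ a (TE.to x))
        charE≈ x = ψ.⟦⟧-cong (TP.strictlyInverseˡ _)
        coefficient∈ : Member (FieldOps.divide L (- 1#) (gauss ^ d) gauss^d#0)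
        coefficient∈ = *∈ (-∈ 1∈) (⁻¹∈ (trans (*-comm _ _) (proj₁ (proj₂ (HeytingField.#⇒invertible L gauss^d#0)))) (resp (sym (HeytingProperties.x-0≈x (HeytingField.heytingCommutativeRing L) (gauss ^ d))) gauss^d∈))

  quadratic-subfield : ∀ {m} → (ζ : Carrier) → IsPrimitiveRoot L p ζ → (Q : Subfield L m) → Subfield.Member Q ⊆ Adjoin ℚ⊆L ζ →
                       Basis ℚ⊆L (Subfield.Member Q) 2 →
                       Subfield.Member Q (S₊ gauss^d#0 (f̃ a)) × Subfield.Member Q (S₋ gauss^d#0 (f̃ a))
  quadratic-subfield ζ ζ-primitive Q Q⊆ basis′ = Averaging.S∈ Q (^∈ d gauss∈) (λ s → s K.* s) (K.zeroˡ K.0#) G∈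
      λ {s} s≢0 → K.*-≢0 s≢0 s≢0 , hP s , E.sym (hP.*-homo s s) , fixed s
    where
    open Subfield Q
    open SubfieldTheory Q
    G1∈ : Member (G K.1#)
    G1∈ = quadratic-subfield⇒gauss∈ 2≢0 (proj₁ ζ-primitive) Q Q⊆ basis′
    gauss∈ : Member gauss
    gauss∈ = resp (sym gauss≈G) G1∈
    G∈ : ∀ b → Member (sum λ s → χ (s K.* s K.* b))
    G∈ b = resp (sum-cong-≋ λ s → Cyc.χ-cong (K.*-comm b (s K.* s))) (case b Fin.≟ K.0# of λ where
      (yes ≡.refl) → resp (sym G-0) (ι∈ (+ p))
      (no b≢0) → let z , eq , _ = G-± b≢0 in resp (sym eq) (*∈ (ι∈ z) G1∈))
    fixed : ∀ s → hP s E.^ q E.≈ hP s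
    fixed s = E.trans (E.^-congʳ (hP s) q≡p^r) (^-fixed (E.trans (E.sym (hP.hom-^ s p)) (E.reflexive (≡.cong hP (K.fermat′ s)))) r)

  module Rationality {s₀} (q≡s₀² : q ≡ s₀ *ℕ s₀) {c₄ ℓ₄ ℓ₄′} (𝔽q : HeytingField c₄ ℓ₄ ℓ₄′) (|𝔽q| : HasSize q 𝔽q) (𝔽q⊆E : Extension 𝔽q E) where
    private
      module TQ = Transport 𝔽q |𝔽q|
      module KQ = TQ.K
      hQ : Fin q → E.Carrier
      hQ = Extension.embed 𝔽q⊆E ∘ TQ.to
      hQ-isHom : IsRingHomomorphism (CommutativeRing.rawRing KQ.F-ring) (CommutativeRing.rawRing (FieldOps.commutativeRing E)) hQ
      hQ-isHom = Composition.isRingHomomorphism E.trans TQ.to-isHom (Extension.isRingHomomorphism 𝔽q⊆E)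
      module hQ = Embedding TQ.finField E hQ-isHom
      open K.Odd 2≢0 using (Square; euler; not-all-squares)

      -- No map between 𝔽p and 𝔽q is given; integers in the two fields are compared through their
      -- images in E.
      2≢0-q : KQ.1# KQ.+ KQ.1# ≢ KQ.0#
      2≢0-q eq = 2≢0 (hP.h-injective (E.trans (hP.hom-ι (+ 2)) (E.trans (E.sym (hQ.hom-ι (+ 2))) (E.trans (E.reflexive (≡.cong hQ eq)) (E.trans hQ.0#-homo (E.sym hP.0#-homo))))))

      j : ∃ λ j → s₀ ≡ p ^ℕ j
      j = square-prime-power pr r s₀ (≡.trans (≡.sym q≡p^r) q≡s₀²)

      m : ∃ λ m → q ≡ suc ((k ℕ.+ k) *ℕ m ℕ.+ (k ℕ.+ k) *ℕ m)
      m = let m , eq = half-square {k} (proj₁ j) in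
        m , ≡.trans q≡s₀² (≡.trans (≡.cong (λ P → P *ℕ P) (≡.trans (proj₂ j) (≡.cong (_^ℕ proj₁ j) p≡1+2k))) eq)

      fermat : ∀ {s} → s ≢ K.0# → s K.^ (k ℕ.+ k) ≡ K.1#
      fermat {s} s≢0 = ≡.trans (≡.cong (λ n → s K.^ ℕ.pred n) (≡.sym p≡1+2k)) (K.fermat s≢0)

      square-root : ∀ {s} → s ≢ K.0# → ∃ λ v → v E.* v E.≈ hP s × v E.^ q E.≈ v
      square-root {s} s≢0 = hQ v , E.trans (E.sym (hQ.*-homo v v)) (E.trans (E.reflexive (≡.cong hQ v²≡s′)) hQs′≈hPs)
                          , E.trans (E.sym (hQ.hom-^ v q)) (E.reflexive (≡.cong hQ (KQ.fermat′ v)))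
        where
        -- An integer representing s allows s to be read as an element s′ of 𝔽q with the same image
        -- in E.
        i : ℤ
        i = + toℕ (proj₁ (Char.index pr s))
        s′ : Fin q
        s′ = KQ.ι i
        hQs′≈hPs : hQ s′ E.≈ hP s
        hQs′≈hPs = E.trans (hQ.hom-ι i) (E.trans (E.sym (hP.hom-ι i)) (E.reflexive (≡.cong hP (proj₂ (Char.index pr s)))))
        s′^2k≡1 : s′ KQ.^ (k ℕ.+ k) ≡ KQ.1#
        s′^2k≡1 = hQ.h-injective (E.trans (hQ.hom-^ s′ (k ℕ.+ k)) (E.trans (E.^-congˡ (k ℕ.+ k) hQs′≈hPs) (E.trans (E.sym (hP.hom-^ s (k ℕ.+ k)))
          (E.trans (E.reflexive (≡.cong hP (fermat s≢0))) (E.trans hP.1#-homo (E.sym hQ.1#-homo))))))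
        -- The exponent (q - 1)/2 of Euler's criterion is (p - 1) m, and s′^(p - 1) = 1.
        s′-square : KQ.Odd.Square 2≢0-q s′
        s′-square = KQ.Odd.euler 2≢0-q {k = (k ℕ.+ k) *ℕ proj₁ m} (proj₂ m) (≡.trans (≡.sym (KQ.^-assocʳ s′ (k ℕ.+ k) (proj₁ m))) (≡.trans (KQ.^-congˡ (proj₁ m) s′^2k≡1) (KQ.1^ (proj₁ m))))
        v = proj₁ s′-square
        v²≡s′ = proj₂ s′-square

      -- If d were odd, then the square root v of s in E would give 1 = v^(p^d − 1) = s^((p − 1)/2) for every s ≠ 0.
      d-even : ∃ λ e → d ≡ e ℕ.+ e
      d-even = case even⊎odd d of λ where
          (inj₁ even) → even
          (inj₂ (e , d≡1+2e)) → contradiction (λ s → case s Fin.≟ K.0# of λ where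
            (yes ≡.refl) → K.0# , K.zeroˡ K.0#
            (no s≢0) → all-squares e d≡1+2e s≢0) not-all-squares
        where
        all-squares : ∀ e → d ≡ suc (e ℕ.+ e) → ∀ {s} → s ≢ K.0# → Square s
        -- The exponents h = (p^d - 1)/2 and k = (p - 1)/2 differ by a multiple of p - 1, so s^k =
        -- s^h; and s^h = v^(2 h) = 1 by Fermat in E.
        all-squares e d≡1+2e {s} s≢0 = euler {k = k} p≡1+2k (begin
          s K.^ k  ≡⟨ K.*-identityʳ _ ⟨
          s K.^ k K.* K.1#
            ≡⟨ K.*-congˡ (≡.trans (K.^-congˡ z (fermat s≢0)) (K.1^ z)) ⟨
          s K.^ k K.* (s K.^ (k ℕ.+ k)) K.^ z               ≡⟨ K.*-congˡ (K.^-assocʳ s (k ℕ.+ k) z) ⟩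
          s K.^ k K.* s K.^ ((k ℕ.+ k) *ℕ z)                ≡⟨ K.^-homo-* s k ((k ℕ.+ k) *ℕ z) ⟨
          s K.^ h  ≡⟨ s^h≡1 ⟩
          K.1#  ∎)
          where
          open ≡.≡-Reasoning
          z = proj₁ (odd-degree k e)
          h = k ℕ.+ (k ℕ.+ k) *ℕ z
          p^d≡1+2h : p ^ℕ d ≡ suc (h ℕ.+ h)
          p^d≡1+2h = ≡.trans (≡.cong₂ _^ℕ_ p≡1+2k d≡1+2e) (proj₂ (odd-degree k e))
          v = proj₁ (square-root s≢0)
          v²≈s = proj₁ (proj₂ (square-root s≢0))
          v′ : Fin (p ^ℕ d)
          v′ = TE.from v
          v′≢0 : v′ ≢ KE.0#
          v′≢0 v′≡0 = let u , eq = E.unit-factor (E.unit-resp (E.sym v²≈s) (hP.h-unit s≢0)) in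
            E.1≉0 (E.trans (E.sym eq) (E.trans (E.*-congˡ (E.trans (E.sym (TE.strictlyInverseˡ v)) (E.trans (E.reflexive (≡.cong TE.to v′≡0)) HE.0#-homo))) (E.zeroʳ u)))
          v^2h≈1 : v E.^ (h ℕ.+ h) E.≈ E.1#
          v^2h≈1 = E.trans (E.^-congʳ v (≡.cong ℕ.pred (≡.sym p^d≡1+2h))) (E.trans (E.^-congˡ (ℕ.pred (p ^ℕ d)) (E.sym (TE.strictlyInverseˡ v)))
            (E.trans (E.sym (RingHom.hom-^ KE.F-ring (FieldOps.commutativeRing E) TE.to-isHom v′ (ℕ.pred (p ^ℕ d)))) (E.trans (E.reflexive (≡.cong TE.to (KE.fermat v′≢0))) HE.1#-homo)))
          s^h≡1 : s K.^ h ≡ K.1#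
          s^h≡1 = hP.h-injective (E.trans (hP.hom-^ s h) (E.trans (E.^-congˡ h (E.sym v²≈s)) (E.trans (E.^-distrib-* v v h)
            (E.trans (E.sym (E.^-homo-* v h h)) (E.trans v^2h≈1 (E.sym hP.1#-homo))))))

      -- As G(1) G(-1) = p and G(-1) = ±G(1), the square of the Gauss sum is ±p.
      gauss²∈ : Extension.InBase ℚ⊆L (gauss * gauss)
      gauss²∈ = let z , eq , z≡±1 = G-± { K.- K.1# } (λ -1≡0 → K.1≢0 (≡.trans (≡.sym (K.-‿involutive K.1#)) (≡.trans (≡.cong K.-_ -1≡0) K.-0#≈0#))) in
        ℚs.resp (*-cong (sym gauss≈G) (sym gauss≈G)) (ℚt.divide∈ (ι-unit (sign≢0 z≡±1)) (ℚt.ι∈ z) (ℚs.resp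
          (trans (sym G*G⁻) (trans (*-congˡ eq) (solve 2 (λ z g → g :* (z :* g) := z :* (g :* g)) refl (ι z) (G K.1#)))) (ℚt.ι∈ (+ p))))
        where
        module ℚs = Subfield rationals
        module ℚt = SubfieldTheory rationals
        sign≢0 : ∀ {z} → z ≡ + 1 ⊎ z ≡ ℤ.- + 1 → z ≢ ℤ.0ℤ
        sign≢0 (inj₁ ≡.refl) = λ ()
        sign≢0 (inj₂ ≡.refl) = λ ()

    rational : Extension.InBase ℚ⊆L (S₊ gauss^d#0 (f̃ a)) × Extension.InBase ℚ⊆L (S₋ gauss^d#0 (f̃ a))
    rational = Averaging.S∈ rationals gauss^d∈ id ≡.refl (λ b → let z , eq = Σ-nonzero b in ℚs.resp (sym eq) (ℚt.ι∈ z)) (λ s≢0 → s≢0 , square-root s≢0)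
      where
      module ℚs = Subfield rationals
      module ℚt = SubfieldTheory rationals
      gauss^d∈ : Extension.InBase ℚ⊆L (gauss ^ d)
      gauss^d∈ = let e , d≡e+e = d-even in ℚs.resp
        (trans (^-distrib-* gauss gauss e) (trans (sym (^-homo-* gauss e e)) (^-congʳ gauss (≡.sym d≡e+e)))) (ℚt.^∈ e gauss²∈)

mainTheorem12 :
    ∀ {c₁ ℓ₁ ℓ₁′ c₂ ℓ₂ ℓ₂′ c₃ ℓ₃ ℓ₃′ c₄ ℓ₄ ℓ₄′ m}
    (p q r : ℕ) → Prime p → p ≢ 2 → 1 ≤ r → q ≡ p ^ℕ r →
    (𝔽p : HeytingField c₁ ℓ₁ ℓ₁′) (|𝔽p| : HasSize p 𝔽p)
    (E : HeytingField c₂ ℓ₂ ℓ₂′) (𝔽p⊆E : Extension 𝔽p E)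
    (d : ℕ) (basis : Basis 𝔽p⊆E U d)
    (L : HeytingField c₃ ℓ₃ ℓ₃′) (ℚ⊆L : Extension ℚ-field L)
    (ψ : AdditiveCharacter 𝔽p L) → AdditiveCharacter.Nontrivial ψ →
    (n : ℕ) (a : Vector (HeytingField.Carrier E) (suc n)) →
    let open GaussSums L |𝔽p| basis ψ
        open FieldOps L using (_#_)
        open FieldOps L using (_^_)
        open FieldOps L using (0#)
        f̃ = halfPowerPolynomial E q a
    in
    Σ (gauss ^ d # 0#) λ gauss^d#0 →
      ((ζ : HeytingField.Carrier L) → IsPrimitiveRoot L p ζ →
       (K : Subfield L m) → Subfield.Member K ⊆ Adjoin ℚ⊆L ζ →
       Basis ℚ⊆L (Subfield.Member K) 2 →
       Subfield.Member K (S₊ gauss^d#0 f̃) × Subfield.Member K (S₋ gauss^d#0 f̃))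
      ×
      ((∃ λ s → q ≡ s *ℕ s) →
       (𝔽q : HeytingField c₄ ℓ₄ ℓ₄′) → HasSize q 𝔽q → Extension 𝔽q E →
       Extension.InBase ℚ⊆L (S₊ gauss^d#0 f̃) × Extension.InBase ℚ⊆L (S₋ gauss^d#0 f̃))
mainTheorem12 p q r pr p≢2 1≤r q≡p^r 𝔽p |𝔽p| E 𝔽p⊆E d basis L ℚ⊆L ψ nontrivial n a =
  gauss^d#0 , quadratic-subfield , λ (s , q≡s²) 𝔽q |𝔽q| 𝔽q⊆E → Rationality.rational {s} q≡s² 𝔽q |𝔽q| 𝔽q⊆E
  where open Setting pr p≢2 {q} {r} q≡p^r 𝔽p |𝔽p| E 𝔽p⊆E d basis L ℚ⊆L ψ nontrivial a
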